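{- The quintuple $(\mathcal H,\ш_*,\mathbf 1,\Delta_{\mathrm{desc}},\varepsilon)$ is a connected graded bialgebra (graded by weight $|[s_1,\dots,s_k]|=s_1+\dots+s_k$, $|\mathbf 1|=0$), and hence a Hopf algebra.
   Context: Let $\{x_i\}_{i\ge1}$ be variables. For $k\ge1$, distinct $i_1,\dots,i_k\in\mathbb Z_{\ge1}$ and $(s_1,\dots,s_k)\in\mathbb Z_{\ge1}^k$, the Chen fraction is $\Phi^{s_1,\dots,s_k}_{i_1,\dots,i_k}:=\frac{1}{(x_{i_1}+\dots+x_{i_k})^{s_1}(x_{i_2}+\dots+x_{i_k})^{s_2}\cdots x_{i_k}^{s_k}}$. Let $F^{ch}$ be the set of Chen fractions together with $1$, and $\mathbb Q F^{ch}$ its span, in which $F^{ch}$ is a basis. Let $\partial_i:=-\frac{\partial}{\partial x_i}$, $d_{i,j}:=\partial_i-\partial_j$, and for indices $i_1,\dots,i_k$ set $d_{i_1,i_0}:=\partial_{i_1}$; operators act on tensors factorwise. $\Delta^{ch}$ is the linear map with $\Delta^{ch}(1)=1\otimes1$, $\Delta^{ch}(\Phi^{1,\dots,1}_{i_1,\dots,i_k})=\sum_{j=0}^k\Phi^{1,\dots,1}_{i_1,\dots,i_j}\otimes\Phi^{1,\dots,1}_{i_{j+1},\dots,i_k}$ (empty index list meaning $1$), and recursively $\Delta^{ch}(\Phi^{s_1,\dots,s_j+1,\dots,s_k}_{i_1,\dots,i_k})=\frac1{s_j}(\mathrm{id}\otimes d_{i_j,i_{j-1}}+d_{i_j,i_{j-1}}\otimes\mathrm{id})\Delta^{ch}(\Phi^{s_1,\dots,s_k}_{i_1,\dots,i_k})$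 (well defined). Let $\mathcal H$ be the $\mathbb Q$-vector space with basis a symbol $\mathbf 1$ and symbols $[s_1,\dots,s_k]$, $k\ge1$, $s_j\in\mathbb Z_{\ge1}$; $\pi:\mathbb Q F^{ch}\to\mathcal H$ is linear with $\pi(1)=\mathbf 1$, $\pi(\Phi^{s_1,\dots,s_k}_{i_1,\dots,i_k})=[s_1,\dots,s_k]$. Let $\ш$ be the shuffle product on $\mathbb Q\langle x_0,x_1\rangle$ ($1\ш w=w\ш1=w$, $au\ш bv=a(u\ш bv)+b(au\ш v)$), $\rho:\mathcal H\to\mathbb Q\langle x_0,x_1\rangle$ the injective linear map $\rho(\mathbf 1)=1$, $\rho([s_1,\dots,s_k])=x_0^{s_1-1}x_1\cdots x_0^{s_k-1}x_1$ (image closed under $\ш$), and $u\ш_*v:=\rho^{ -1}(\rho(u)\ш\rho(v))$. $\Delta_{\mathrm{desc}}:\mathcal H\to\mathcal H\otimes\mathcal H$ is the linear map with $\Delta_{\mathrm{desc}}(\mathbf 1)=\mathbf 1\otimes\mathbf 1$ and $\Delta_{\mathrm{desc}}([s_1,\dots,s_k])=(\pi\otimes\pi)\Delta^{ch}(\Phi^{s_1,\dots,s_k}_{i_1,\dots,i_k})$ for any pairwise distinct $i_1,\dots,i_k$ (independent of the choice). $\varepsilon:\mathcal H\to\mathbb Q$ is linear with $\varepsilon(\mathbf 1)=1$ and $\varepsilon([s_1,\dots,s_k])=0$ for $k\ge1$. -}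

module Defs where

open import Data.Nat as ℕ using (ℕ; zero; suc)
open import Data.Bool using (Bool; true; false; if_then_else_)
open import Data.List using (List; []; _∷_; _++_; map; replicate; length; upTo; foldr)
open import Data.Bool.ListAction using (any)
open import Data.Product using (_×_; _,_; proj₁; proj₂; Σ)
open import Data.Maybe using (Maybe; just; nothing)
open import Data.Rational using (ℚ; 0ℚ; 1ℚ; _+_; _*_; -_; _/_)
open import Data.Integer using (+_)
open import Relation.Binary.Definitions using (DecidableEquality)
open import Relation.Nullary using (does; ¬_)
open import Relation.Binary.PropositionalEquality using (_≡_)
import Data.List.Properties as LP
import Data.Product.Properties as PP

-- Free ℚ-vector spaces: formal finite sums Σ cᵢ bᵢ, compared through
-- their coefficient functions (so B is a basis).

FS : Set → Set
FS B = List (ℚ × B)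

basis : ∀ {B : Set} → B → FS B
basis b = (1ℚ , b) ∷ []

_⊕_ : ∀ {B : Set} → FS B → FS B → FS B
_⊕_ = _++_

_·_ : ∀ {B : Set} → ℚ → FS B → FS B
c · v = map (λ p → (c * proj₁ p , proj₂ p)) v

ext : ∀ {A B : Set} → (A → FS B) → FS A → FS B
ext f [] = []
ext f ((c , a) ∷ v) = (c · f a) ⊕ ext f v

ext2 : ∀ {A B C : Set} → (A → B → FS C) → FS A → FS B → FS C
ext2 f u v = ext (λ a → ext (λ b → f a b) v) u

extℚ : ∀ {A : Set} → (A → ℚ) → FS A → ℚ
extℚ f [] = 0ℚ
extℚ f ((c , a) ∷ v) = c * f a + extℚ f v

coeff : ∀ {B : Set} → DecidableEquality B → FS B → B → ℚ
coeff eq [] b = 0ℚ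
coeff eq ((c , b') ∷ v) b = if does (eq b' b) then c + coeff eq v b else coeff eq v b

EqV : ∀ {B : Set} → DecidableEquality B → FS B → FS B → Set
EqV eq u v = ∀ b → coeff eq u b ≡ coeff eq v b

_⊗ᵥ_ : ∀ {A B : Set} → FS A → FS B → FS (A × B)
u ⊗ᵥ v = ext2 (λ a b → basis (a , b)) u v

_⊗ₗ_ : ∀ {A A' B B' : Set} → (FS A → FS A') → (FS B → FS B') → FS (A × B) → FS (A' × B')
(f ⊗ₗ g) = ext (λ p → f (basis (proj₁ p)) ⊗ᵥ g (basis (proj₂ p)))

idV : ∀ {A : Set} → FS A → FS A
idV v = v

reassoc : ∀ {A B C : Set} → FS ((A × B) × C) → FS (A × (B × C))
reassoc = map (λ p → (proj₁ p , (proj₁ (proj₁ (proj₂ p)) , (proj₂ (proj₁ (proj₂ p)) , proj₂ (proj₂ p)))))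

-- Connected graded bialgebra / Hopf algebra structure on the free
-- vector space over a basis C, with product, coproduct and counit
-- given on basis elements and extended (bi)linearly, unit 1 = basis e,
-- and grading given by a weight of basis elements.

module _ {C : Set} (eq : DecidableEquality C) where

  eq2 : DecidableEquality (C × C)
  eq2 = PP.≡-dec eq eq

  eq3 : DecidableEquality (C × (C × C))
  eq3 = PP.≡-dec eq eq2

  record IsConnectedGradedBialgebra
         (m : C → C → FS C) (e : C) (Δ₀ : C → FS (C × C)) (ε₀ : C → ℚ)
         (wt : C → ℕ) : Set where
    mulV : FS C → FS C → FS C
    mulV = ext2 m
    one : FS C
    one = basis e
    ΔV : FS C → FS (C × C)
    ΔV = ext Δ₀
    εV : FS C → ℚ
    εV = extℚ ε₀
    -- ε ⊗ id and id ⊗ ε, composed with Q ⊗ H ≅ H ≅ H ⊗ Q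
    εid : FS (C × C) → FS C
    εid = ext (λ p → ε₀ (proj₁ p) · basis (proj₂ p))
    idε : FS (C × C) → FS C
    idε = ext (λ p → ε₀ (proj₂ p) · basis (proj₁ p))
    mulT : FS (C × C) → FS (C × C) → FS (C × C)
    mulT = ext2 (λ p q → m (proj₁ p) (proj₁ q) ⊗ᵥ m (proj₂ p) (proj₂ q))
    field
      assoc   : ∀ x y z → EqV eq (mulV (mulV x y) z) (mulV x (mulV y z))
      unitˡ   : ∀ x → EqV eq (mulV one x) x
      unitʳ   : ∀ x → EqV eq (mulV x one) x
      coassoc : ∀ x → EqV eq3 (reassoc ((ΔV ⊗ₗ idV) (ΔV x))) ((idV ⊗ₗ ΔV) (ΔV x))
      counitˡ : ∀ x → EqV eq (εid (ΔV x)) x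
      counitʳ : ∀ x → EqV eq (idε (ΔV x)) x
      Δ-mul   : ∀ x y → EqV eq2 (ΔV (mulV x y)) (mulT (ΔV x) (ΔV y))
      Δ-one   : EqV eq2 (ΔV one) (one ⊗ᵥ one)
      ε-mul   : ∀ x y → εV (mulV x y) ≡ εV x * εV y
      ε-one   : εV one ≡ 1ℚ
      gr-mul  : ∀ a b c → ¬ (coeff eq (m a b) c ≡ 0ℚ) → wt c ≡ wt a ℕ.+ wt b
      gr-one  : wt e ≡ 0
      gr-Δ    : ∀ a b c → ¬ (coeff eq2 (Δ₀ a) (b , c) ≡ 0ℚ) → wt b ℕ.+ wt c ≡ wt a
      gr-ε    : ∀ a → ¬ (ε₀ a ≡ 0ℚ) → wt a ≡ 0
      connected : ∀ a → wt a ≡ 0 → a ≡ e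

  HasAntipode : (m : C → C → FS C) (e : C) (Δ₀ : C → FS (C × C)) (ε₀ : C → ℚ) → Set
  HasAntipode m e Δ₀ ε₀ =
    Σ (C → FS C) λ S₀ →
      let S   = ext S₀
          μ   = ext (λ p → m (proj₁ p) (proj₂ p))
          ΔV  = ext Δ₀
          ηε  = λ x → extℚ ε₀ x · basis e
      in (∀ x → EqV eq (μ ((S ⊗ₗ idV) (ΔV x))) (ηε x))
       × (∀ x → EqV eq (μ ((idV ⊗ₗ S) (ΔV x))) (ηε x))

-- The space 𝓗.  The basis symbol [s₁,…,sₖ] is encoded as the list
-- (s₁ - 1) ∷ … ∷ (sₖ - 1) ∷ []  (entry n stands for s = n + 1 ≥ 1);
-- the symbol 𝟏 is the empty list.

Comp : Set
Comp = List ℕ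

_≟C_ : DecidableEquality Comp
_≟C_ = LP.≡-dec ℕ._≟_

weight : Comp → ℕ
weight [] = 0
weight (n ∷ w) = suc n ℕ.+ weight w

-- Shuffle product on ℚ⟨x₀,x₁⟩ (false = x₀, true = x₁)

Word : Set
Word = List Bool

prefix : Bool → FS Word → FS Word
prefix a = map (λ p → (proj₁ p , a ∷ proj₂ p))

sh : Word → Word → FS Word
sh [] v = basis v
sh u@(_ ∷ _) [] = basis u
sh u@(a ∷ u') v@(b ∷ v') = prefix a (sh u' v) ⊕ prefix b (sh u v')

ρ : Comp → Word
ρ [] = []
ρ (n ∷ w) = replicate n false ++ (true ∷ ρ w)

-- inverse of ρ on its image (words ending in x₁, or empty)
ρ⁻¹-word : ℕ → Word → Maybe Comp
ρ⁻¹-word zero [] = just []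
ρ⁻¹-word (suc _) [] = nothing
ρ⁻¹-word n (false ∷ w) = ρ⁻¹-word (suc n) w
ρ⁻¹-word n (true ∷ w) with ρ⁻¹-word 0 w
... | just c = just (n ∷ c)
... | nothing = nothing

-- ρ⁻¹ extended linearly; it is only applied to elements of the image
-- of ρ (closed under ш), on which it is the inverse of ρ.
ρ⁻¹ : FS Word → FS Comp
ρ⁻¹ [] = []
ρ⁻¹ ((c , w) ∷ v) with ρ⁻¹-word 0 w
... | just u = (c , u) ∷ ρ⁻¹ v
... | nothing = ρ⁻¹ v

_ш*_ : Comp → Comp → FS Comp
u ш* v = ρ⁻¹ (sh (ρ u) (ρ v))

𝟏 : Comp
𝟏 = []

-- Chen fractions Φ^{s₁,…,sₖ}_{i₁,…,iₖ}, encoded as the list of pairs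
-- (iⱼ , sⱼ - 1);  the empty list is the fraction 1.

CF : Set
CF = List (ℕ × ℕ)

occurs : ℕ → CF → Bool
occurs i L = any (λ p → does (proj₁ p ℕ.≟ i)) L

ℕtoℚ : ℕ → ℚ
ℕtoℚ n = + n / 1

-- ∂ᵢ = -∂/∂xᵢ on a Chen fraction: the factor (x_{iₘ}+⋯+x_{iₖ})^{-sₘ}
-- contributes sₘ·Φ^{…,sₘ+1,…} whenever i ∈ {iₘ,…,iₖ}.
∂ : ℕ → CF → FS CF
∂ i [] = []
∂ i (p ∷ rest) =
  (if occurs i (p ∷ rest)
     then (ℕtoℚ (suc (proj₂ p)) , (proj₁ p , suc (proj₂ p)) ∷ rest) ∷ []
     else [])
  ⊕ map (λ q → (proj₁ q , p ∷ proj₂ q)) (∂ i rest)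

d : ℕ → ℕ → CF → FS CF
d i j Φ = ∂ i Φ ⊕ ((- 1ℚ) · ∂ j Φ)

dOps : List ℕ → List (CF → FS CF)
dOps [] = []
dOps (i ∷ I) = ∂ i ∷ go i I
  where
  go : ℕ → List ℕ → List (CF → FS CF)
  go prev [] = []
  go prev (j ∷ J) = d j prev ∷ go j J

lift : (CF → FS CF) → FS (CF × CF) → FS (CF × CF)
lift D = ext (λ p → (basis (proj₁ p) ⊗ᵥ D (proj₂ p)) ⊕ (D (proj₁ p) ⊗ᵥ basis (proj₂ p)))

splits : ∀ {A : Set} → List A → List (List A × List A)
splits [] = ([] , []) ∷ []
splits (x ∷ xs) = ([] , x ∷ xs) ∷ map (λ p → (x ∷ proj₁ p , proj₂ p)) (splits xs)

ones : List ℕ → CF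
ones = map (λ i → (i , 0))

Δch-ones : List ℕ → FS (CF × CF)
Δch-ones I = map (λ p → (1ℚ , (ones (proj₁ p) , ones (proj₂ p)))) (splits I)

-- raising sⱼ from 1 to n+1 along the recursion
-- Δᶜʰ(Φ^{…,s+1,…}) = (1/s)(id ⊗ d + d ⊗ id) Δᶜʰ(Φ^{…,s,…})
raise : (CF → FS CF) → ℕ → FS (CF × CF) → FS (CF × CF)
raise D zero t = t
raise D (suc n) t = (+ 1 / suc n) · lift D (raise D n t)

raiseAll : List (CF → FS CF) → List ℕ → FS (CF × CF) → FS (CF × CF)
raiseAll (D ∷ Ds) (n ∷ ns) t = raiseAll Ds ns (raise D n t)
raiseAll _ _ t = t

-- Δᶜʰ(Φ^{s₁,…,sₖ}_{i₁,…,iₖ}), with es = (s₁-1,…,sₖ-1)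
Δch : (I : List ℕ) → (es : List ℕ) → FS (CF × CF)
Δch I es = raiseAll (dOps I) es (Δch-ones I)

π : CF → Comp
π = map proj₂

Δdesc : Comp → FS (Comp × Comp)
Δdesc w = map (λ q → (proj₁ q , (π (proj₁ (proj₂ q)) , π (proj₂ (proj₂ q)))))
              (Δch (map suc (upTo (length w))) w)

ε : Comp → ℚ
ε [] = 1ℚ
ε (_ ∷ _) = 0ℚ

{-# OPTIONS --safe #-}
module Submission where

-- For k ≥ 0 let G(u₁,…,uₖ) = Σ u^{s-1} [s₁,…,sₖ], and put uⱼ = vⱼ + ⋯ + vₖ.  Expanding in the v's,
-- G = Σ vᵃ eₐ for a second basis (eₐ) of 𝓗, indexed by words a in the letters 0, 1, 2, … .  In this
-- basis ш* is the shuffle of words and Δdesc is deconcatenation, so everything reduces to the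
-- shuffle Hopf algebra, whose antipode sends a word a to (-1)^{|a|} times its reversal.
--   * Product: removing a leading x₀ from eₐ (read as a word in x₀, x₁) is Σᵢ lowering of the i-th
--     letter, and removing a leading x₁ deletes a first letter 0.  These operations are derivations
--     both for the shuffle of words in x₀, x₁ and for the shuffle of letters.
--   * Coproduct: ∂ᵢ multiplies by (aᵢ + 1) and raises the letter aᵢ in the basis (eₐ), hence is
--     compatible with deconcatenation, and on Φ^{1,…,1} the map Δᶜʰ is deconcatenation.
-- θ expresses eₐ in the symbols [s] and ψ is its inverse; both are products of the elementary
-- substitutions uⱼ = vⱼ + uⱼ₊₁.  Identities between formal sums are proved after pairing with an
-- arbitrary functional f on the basis, written ∑[ a ∈ u ] f a.

open import Defs
open import Data.Bool using (Bool; true; false; if_then_else_)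
open import Data.Integer as ℤ using (+_)
open import Data.Integer.Tactic.RingSolver using () renaming (solve-∀ to solveℤ-∀)
open import Data.List using (List; []; _∷_; _∷ʳ_; _++_; _ʳ++_; applyUpTo; drop; length; map; replicate; reverse; upTo; zip)
import Data.List.Properties as LP
open import Data.List.Relation.Binary.Pointwise using (Pointwise; []; _∷_; Pointwise-length)
open import Data.List.Relation.Unary.All as All using (All; []; _∷_)
import Data.List.Relation.Unary.All.Properties as AllP
open import Data.List.Relation.Unary.AllPairs using ([]; _∷_)
open import Data.List.Relation.Unary.Unique.Propositional using (Unique)
open import Data.Maybe using (Maybe; just; nothing; maybe′)
open import Data.Nat as ℕ using (ℕ; zero; suc; s≤s)
open import Data.Nat.ListAction using (sum)
import Data.Nat.Properties as ℕP
open import Data.Product using (_×_; _,_; proj₁; proj₂)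
open import Data.Rational as ℚ using (ℚ; 0ℚ; 1ℚ; _+_; _*_; -_; _/_)
import Data.Rational.Properties as ℚP
import Data.Rational.Unnormalised as ℚᵘ
import Data.Rational.Unnormalised.Properties as ℚᵘP
open import Function using (_∘_)
open import Relation.Binary.Definitions using (DecidableEquality)
open import Relation.Binary.PropositionalEquality hiding (J)
open import Relation.Nullary using (does; yes; no; ¬_; contradiction)
open import Relation.Nullary.Decidable using (dec-false; dec-true; dec⇒maybe)
open import Tactic.RingSolver using (solve-∀)
open import Tactic.RingSolver.Core.AlmostCommutativeRing using (AlmostCommutativeRing; fromCommutativeRing)

open ≡-Reasoning

-- Formal sums

-- Why these coordinates: multiplying by s_j and raising s_j is ∂/∂u_j on G. The operator ∂ of the
-- j-th label raises each of s_1, ..., s_j, so it acts as ∂/∂u_1 + ⋯ + ∂/∂u_j = ∂/∂v_j, and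
-- d_{i_j,i_{j-1}} acts as ∂/∂u_j alone. Likewise, lowering the first entry multiplies G by u_1 =
-- v_1 + ⋯ + v_k, which treats all letters alike. Thus both structures act letter by letter in the
-- v's. The obstacle is that Δᶜʰ is given by a recursion on labelled fractions and not by a formula.
-- The recursion is therefore replayed, with the same operators, on labelled words in the basis
-- (eₐ). This produces a preimage of the given Chen fraction whose coproduct is deconcatenation by
-- construction; labels are erased only afterwards. Since `∂` tests whether a label occurs, it is
-- linear in the label only for fractions with distinct labels, so distinctness within each tensor
-- factor is carried along the recursion as an invariant.

private variable
  A B C : Set

ℚ-ring : AlmostCommutativeRing _ _
ℚ-ring = fromCommutativeRing ℚP.+-*-commutativeRing (λ x → dec⇒maybe (0ℚ ℚP.≟ x))

infixr 8 ∑
∑ : FS A → (A → ℚ) → ℚ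
∑ u f = extℚ f u
syntax ∑ u (λ a → e) = ∑[ a ∈ u ] e

∑-cong : ∀ (u : FS A) {f g : A → ℚ} → (∀ a → f a ≡ g a) → ∑ u f ≡ ∑ u g
∑-cong [] eq = refl
∑-cong ((c , a) ∷ u) eq = cong₂ (λ x y → c * x + y) (eq a) (∑-cong u eq)

∑-congAll : ∀ {P : A → Set} {u : FS A} {f g : A → ℚ} → All (λ p → P (proj₂ p)) u →
            (∀ a → P a → f a ≡ g a) → ∑ u f ≡ ∑ u g
∑-congAll [] eq = refl
∑-congAll {u = (c , a) ∷ u} (p ∷ ps) eq = cong₂ (λ x y → c * x + y) (eq a p) (∑-congAll ps eq)

∑-0 : ∀ (u : FS A) → ∑[ _ ∈ u ] 0ℚ ≡ 0ℚ
∑-0 [] = refl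
∑-0 ((c , a) ∷ u) = trans (cong (_+_ (c * 0ℚ)) (∑-0 u)) (trans (ℚP.+-identityʳ _) (ℚP.*-zeroʳ c))

∑-+ : ∀ (u : FS A) (f g : A → ℚ) → ∑[ a ∈ u ] (f a + g a) ≡ ∑ u f + ∑ u g
∑-+ [] f g = refl
∑-+ ((c , a) ∷ u) f g = trans (cong (_+_ (c * (f a + g a))) (∑-+ u f g)) (ring c (f a) (g a) (∑ u f) (∑ u g))
  where
  ring : ∀ c x y s t → c * (x + y) + (s + t) ≡ c * x + s + (c * y + t)
  ring = solve-∀ ℚ-ring

∑-* : ∀ (u : FS A) (k : ℚ) (f : A → ℚ) → ∑[ a ∈ u ] (k * f a) ≡ k * ∑ u f
∑-* [] k f = sym (ℚP.*-zeroʳ k)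
∑-* ((c , a) ∷ u) k f = trans (cong (_+_ (c * (k * f a))) (∑-* u k f)) (ring c k (f a) (∑ u f))
  where
  ring : ∀ c k x s → c * (k * x) + k * s ≡ k * (c * x + s)
  ring = solve-∀ ℚ-ring

∑-⊕ : ∀ (u v : FS A) (f : A → ℚ) → ∑ (u ⊕ v) f ≡ ∑ u f + ∑ v f
∑-⊕ [] v f = sym (ℚP.+-identityˡ _)
∑-⊕ ((c , a) ∷ u) v f = trans (cong (_+_ (c * f a)) (∑-⊕ u v f)) (sym (ℚP.+-assoc (c * f a) _ _))

∑-· : ∀ k (u : FS A) (f : A → ℚ) → ∑ (k · u) f ≡ k * ∑ u f
∑-· k [] f = sym (ℚP.*-zeroʳ k)
∑-· k ((c , a) ∷ u) f = trans (cong (_+_ (k * c * f a)) (∑-· k u f)) (ring k c (f a) (∑ u f))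
  where
  ring : ∀ k c x s → k * c * x + k * s ≡ k * (c * x + s)
  ring = solve-∀ ℚ-ring

∑-map : ∀ (g : A → B) (u : FS A) (f : B → ℚ) →
        ∑ (map (λ p → (proj₁ p , g (proj₂ p))) u) f ≡ ∑[ a ∈ u ] f (g a)
∑-map g [] f = refl
∑-map g ((c , a) ∷ u) f = cong (_+_ (c * f (g a))) (∑-map g u f)

∑-basis : ∀ (b : B) (f : B → ℚ) → ∑ (basis b) f ≡ f b
∑-basis b f = trans (ℚP.+-identityʳ _) (ℚP.*-identityˡ (f b))

∑-ext : ∀ (g : A → FS B) (u : FS A) (f : B → ℚ) → ∑ (ext g u) f ≡ ∑[ a ∈ u ] ∑[ b ∈ g a ] f b
∑-ext g [] f = refl
∑-ext g ((c , a) ∷ u) f = trans (∑-⊕ (c · g a) (ext g u) f) (cong₂ _+_ (∑-· c (g a) f) (∑-ext g u f))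

∑-swap : ∀ (u : FS A) (v : FS B) (f : A → B → ℚ) →
         ∑[ a ∈ u ] ∑[ b ∈ v ] f a b ≡ ∑[ b ∈ v ] ∑[ a ∈ u ] f a b
∑-swap [] v f = sym (∑-0 v)
∑-swap ((c , a) ∷ u) v f = begin
  c * ∑ v (f a) + ∑[ a ∈ u ] ∑ v (f a)           ≡⟨ cong₂ _+_ (sym (∑-* v c (f a))) (∑-swap u v f) ⟩
  ∑[ b ∈ v ] (c * f a b) + ∑[ b ∈ v ] ∑[ a ∈ u ] f a b  ≡⟨ sym (∑-+ v _ _) ⟩
  ∑[ b ∈ v ] (c * f a b + ∑[ a ∈ u ] f a b)      ∎

∑-⊗ : ∀ (u : FS A) (v : FS B) (f : A × B → ℚ) → ∑ (u ⊗ᵥ v) f ≡ ∑[ a ∈ u ] ∑[ b ∈ v ] f (a , b)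
∑-⊗ u v f = trans (∑-ext _ u f) (∑-cong u λ a → trans (∑-ext _ v f) (∑-cong v λ b → ∑-basis (a , b) f))

coeff-∑ : (eq : DecidableEquality A) (u : FS A) (b : A) →
          coeff eq u b ≡ ∑[ a ∈ u ] (if does (eq a b) then 1ℚ else 0ℚ)
coeff-∑ eq [] b = refl
coeff-∑ eq ((c , a) ∷ u) b with eq a b
... | yes _ = cong₂ _+_ (sym (ℚP.*-identityʳ c)) (coeff-∑ eq u b)
... | no _ = trans (coeff-∑ eq u b) (sym (trans (cong (_+ _) (ℚP.*-zeroʳ c)) (ℚP.+-identityˡ _)))

-- A coefficient is itself the pairing with an indicator function.
fromFunctionals : (eq : DecidableEquality A) (u v : FS A) → (∀ f → ∑ u f ≡ ∑ v f) → EqV eq u v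
fromFunctionals eq u v h b = trans (coeff-∑ eq u b) (trans (h _) (sym (coeff-∑ eq v b)))

-- Natural numbers as rationals

open ℚᵘP.≃-Reasoning using (step-≈-⟩; step-≈-⟨) renaming (begin_ to begin≃_; _∎ to _∎≃)

-- `_/_` normalises by a gcd, which does not compute for a variable numerator. Among unnormalised
-- rationals the identity is a cross multiplication of integers.
ℕtoℚ-suc : ∀ n → ℕtoℚ (suc n) ≡ 1ℚ + ℕtoℚ n
ℕtoℚ-suc n = ℚP.toℚᵘ-injective (begin≃
  ℚ.toℚᵘ (ℚ.fromℚᵘ (ℚᵘ.mkℚᵘ (+ suc n) 0))  ≈⟨ ℚP.toℚᵘ-fromℚᵘ _ ⟩
  ℚᵘ.mkℚᵘ (+ suc n) 0                      ≈⟨ ℚᵘ.*≡* (lem (+ n)) ⟩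
  ℚᵘ.1ℚᵘ ℚᵘ.+ ℚᵘ.mkℚᵘ (+ n) 0              ≈⟨ ℚᵘP.+-congʳ ℚᵘ.1ℚᵘ (ℚP.toℚᵘ-fromℚᵘ (ℚᵘ.mkℚᵘ (+ n) 0)) ⟨
  ℚᵘ.1ℚᵘ ℚᵘ.+ ℚ.toℚᵘ (ℕtoℚ n)              ≈⟨ ℚP.toℚᵘ-homo-+ 1ℚ (ℕtoℚ n) ⟨
  ℚ.toℚᵘ (1ℚ + ℕtoℚ n)                     ∎≃)
  where
  lem : ∀ m → (+ 1 ℤ.+ m) ℤ.* + 1 ≡ (+ 1 ℤ.+ m ℤ.* + 1) ℤ.* + 1
  lem = solveℤ-∀

1/suc-inverse : ∀ n → + 1 / suc n * ℕtoℚ (suc n) ≡ 1ℚ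
1/suc-inverse n = ℚP.toℚᵘ-injective (begin≃
  ℚ.toℚᵘ (+ 1 / suc n * ℕtoℚ (suc n))
    ≈⟨ ℚP.toℚᵘ-homo-* (+ 1 / suc n) (ℕtoℚ (suc n)) ⟩
  ℚ.toℚᵘ (ℚ.fromℚᵘ (ℚᵘ.mkℚᵘ (+ 1) n)) ℚᵘ.* ℚ.toℚᵘ (ℚ.fromℚᵘ (ℚᵘ.mkℚᵘ (+ suc n) 0))
    ≈⟨ ℚᵘP.*-cong (ℚP.toℚᵘ-fromℚᵘ (ℚᵘ.mkℚᵘ (+ 1) n)) (ℚP.toℚᵘ-fromℚᵘ (ℚᵘ.mkℚᵘ (+ suc n) 0)) ⟩
  ℚᵘ.mkℚᵘ (+ 1) n ℚᵘ.* ℚᵘ.mkℚᵘ (+ suc n) 0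
    ≈⟨ ℚᵘ.*≡* (lem (+ suc n)) ⟩
  ℚᵘ.1ℚᵘ ∎≃)
  where
  lem : ∀ m → (+ 1 ℤ.* m) ℤ.* + 1 ≡ + 1 ℤ.* (m ℤ.* + 1)
  lem = solveℤ-∀

-- The substitution u = v + t w

-- On the coefficients of a power series this is multiplication by the variable; `ifZero` below is
-- the coefficient sequence of a constant.
lowered : (ℕ → ℚ) → ℕ → ℚ
lowered f zero = 0ℚ
lowered f (suc n) = f n

ifZero : ℕ → ℚ → ℚ
ifZero zero q = q
ifZero (suc _) q = 0ℚ

incr : ℕ × ℕ → ℕ × ℕ
incr p = suc (proj₁ p) , proj₂ p

incrFS : FS (ℕ × ℕ) → FS (ℕ × ℕ)
incrFS = map (λ p → (proj₁ p , incr (proj₂ p)))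

-- The coefficient of vᵃ wⁿ in Σ (v + t w)ⁱ wʲ (i , j).
transvect : ℚ → ℕ → ℕ → FS (ℕ × ℕ)
transvect t zero zero = basis (0 , 0)
transvect t zero (suc n) = basis (0 , suc n) ⊕ (t · incrFS (transvect t zero n))
transvect t (suc a) zero = incrFS (transvect t a zero)
transvect t (suc a) (suc n) = incrFS (transvect t a (suc n)) ⊕ (t · incrFS (transvect t (suc a) n))

-- With F = Σ (v + t w)ⁱ wʲ (i , j), separating the terms with i = 0 gives F = Σ wʲ (0 , j) + (v + t
-- w) · `incr` F. This is that equation at vᵃ wⁿ, in one form for all four clauses of `transvect`.
transvect-rec : ∀ t a n (f : ℕ × ℕ → ℚ) →
  ∑ (transvect t a n) f ≡ ifZero a (f (0 , n))
    + (lowered (λ a → ∑ (transvect t a n) (f ∘ incr)) a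
       + t * lowered (λ n → ∑ (transvect t a n) (f ∘ incr)) n)
transvect-rec t zero zero f = trans (∑-basis _ f) (ring (f (0 , 0)) t)
  where ring : ∀ x t → x ≡ x + (0ℚ + t * 0ℚ)
        ring = solve-∀ ℚ-ring
transvect-rec t zero (suc n) f =
  trans (∑-⊕ (basis (0 , suc n)) (t · incrFS (transvect t zero n)) f)
    (cong₂ _+_ (∑-basis (0 , suc n) f)
      (trans (trans (∑-· t (incrFS (transvect t zero n)) f) (cong (t *_) (∑-map incr (transvect t zero n) f)))
             (sym (ℚP.+-identityˡ _))))
transvect-rec t (suc a) zero f =
  trans (∑-map incr (transvect t a zero) f) (ring (∑ (transvect t a 0) (f ∘ incr)) t)
  where ring : ∀ x t → x ≡ 0ℚ + (x + t * 0ℚ)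
        ring = solve-∀ ℚ-ring
transvect-rec t (suc a) (suc n) f =
  trans (∑-⊕ (incrFS (transvect t a (suc n))) _ f)
    (trans (cong₂ _+_ (∑-map incr (transvect t a (suc n)) f)
                   (trans (∑-· t (incrFS (transvect t (suc a) n)) f) (cong (t *_) (∑-map incr (transvect t (suc a) n) f))))
           (sym (ℚP.+-identityˡ _)))

lowered-cong : ∀ {f g : ℕ → ℚ} n → (∀ m → f m ≡ g m) → lowered f n ≡ lowered g n
lowered-cong zero eq = refl
lowered-cong (suc n) eq = eq n

∑-lowered : ∀ (u : FS A) (f : A → ℕ → ℚ) n →
  ∑[ a ∈ u ] lowered (f a) n ≡ lowered (λ n → ∑[ a ∈ u ] f a n) n
∑-lowered u f zero = ∑-0 u
∑-lowered u f (suc n) = refl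

∑-ifZero : ∀ (u : FS A) (f : A → ℚ) n → ∑[ a ∈ u ] ifZero n (f a) ≡ ifZero n (∑ u f)
∑-ifZero u f zero = refl
∑-ifZero u f (suc n) = ∑-0 u

lowered-0 : ∀ n → lowered (λ _ → 0ℚ) n ≡ 0ℚ
lowered-0 zero = refl
lowered-0 (suc n) = refl

ifZero-0 : ∀ n → ifZero n 0ℚ ≡ 0ℚ
ifZero-0 zero = refl
ifZero-0 (suc n) = refl

-- Lowering i multiplies F by v + t w. The functional vanishes at i = 0 and becomes `f` after
-- `incr`, so `transvect-rec` gives the claim at once.
transvect-lowered₁ : ∀ t a n (f : ℕ × ℕ → ℚ) →
  ∑[ p ∈ transvect t a n ] lowered (λ i → f (i , proj₂ p)) (proj₁ p)
    ≡ lowered (λ a → ∑ (transvect t a n) f) a + t * lowered (λ n → ∑ (transvect t a n) f) n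
transvect-lowered₁ t a n f =
  trans (transvect-rec t a n (λ p → lowered (λ i → f (i , proj₂ p)) (proj₁ p)))
    (trans (cong (_+ (lowered (λ a → ∑ (transvect t a n) f) a + t * lowered (λ n → ∑ (transvect t a n) f) n)) (ifZero-0 a))
           (ℚP.+-identityˡ _))

transvect-ifZero : ∀ t a n (f : ℕ → ℚ) →
  ∑[ p ∈ transvect t a n ] ifZero (proj₁ p) (f (proj₂ p)) ≡ ifZero a (f n)
transvect-ifZero t a n f = trans (transvect-rec t a n (λ p → ifZero (proj₁ p) (f (proj₂ p))))
  (trans (cong (_+_ (ifZero a (f n)))
     (cong₂ (λ x y → x + t * y) (lowered-∑0 (λ a → transvect t a n) a) (lowered-∑0 (λ n → transvect t a n) n)))
   (ring (ifZero a (f n)) t))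
  where
  lowered-∑0 : ∀ (v : ℕ → FS (ℕ × ℕ)) a → lowered (λ a → ∑[ _ ∈ v a ] 0ℚ) a ≡ 0ℚ
  lowered-∑0 v zero = refl
  lowered-∑0 v (suc a) = ∑-0 (v a)
  ring : ∀ x t → x + (0ℚ + t * 0ℚ) ≡ x
  ring = solve-∀ ℚ-ring

lower₂ : (ℕ × ℕ → ℚ) → ℕ × ℕ → ℚ
lower₂ f p = lowered (λ j → f (proj₁ p , j)) (proj₂ p)

-- Lowering j multiplies F by w. As `incr` changes only i, this follows by induction along the
-- recursion for F.
transvect-lowered₂ : ∀ t a n (f : ℕ × ℕ → ℚ) →
  ∑ (transvect t a n) (lower₂ f)
    ≡ lowered (λ n → ∑ (transvect t a n) f) n
transvect-lowered₂ t zero zero f = trans (transvect-rec t 0 0 (lower₂ f)) (ring t)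
  where ring : ∀ t → 0ℚ + (0ℚ + t * 0ℚ) ≡ 0ℚ
        ring = solve-∀ ℚ-ring
transvect-lowered₂ t (suc a) zero f =
  trans (transvect-rec t (suc a) 0 (lower₂ f))
    (trans (cong (λ x → 0ℚ + (x + t * 0ℚ)) (transvect-lowered₂ t a 0 (f ∘ incr))) (ring t))
  where ring : ∀ t → 0ℚ + (0ℚ + t * 0ℚ) ≡ 0ℚ
        ring = solve-∀ ℚ-ring
transvect-lowered₂ t zero (suc n) f =
  trans (transvect-rec t zero (suc n) (lower₂ f))
    (trans (cong (λ x → f (0 , n) + (0ℚ + t * x)) (transvect-lowered₂ t zero n (f ∘ incr)))
      (sym (transvect-rec t zero n f)))
transvect-lowered₂ t (suc a) (suc n) f =
  trans (transvect-rec t (suc a) (suc n) (lower₂ f))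
    (trans (cong₂ (λ x y → 0ℚ + (x + t * y)) (transvect-lowered₂ t a (suc n) (f ∘ incr)) (transvect-lowered₂ t (suc a) n (f ∘ incr)))
      (sym (transvect-rec t (suc a) n f)))

-- The two substitutions compose to v + (s + t) w, which is v.
transvect-inverse : ∀ {s t} → s + t ≡ 0ℚ → ∀ a n (f : ℕ × ℕ → ℚ) →
  ∑[ p ∈ transvect t a n ] ∑ (transvect s (proj₁ p) (proj₂ p)) f ≡ f (a , n)
transvect-inverse {s} {t} s+t≡0 a n f = begin
  ∑[ p ∈ T a n ] ∑ (transvect s (proj₁ p) (proj₂ p)) f
    ≡⟨ ∑-cong (T a n) (λ p → transvect-rec s (proj₁ p) (proj₂ p) f) ⟩
  ∑[ p ∈ T a n ] (Z p + (L₁ p + s * L₂ p))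
    ≡⟨ trans (∑-+ (T a n) Z (λ p → L₁ p + s * L₂ p)) (cong (_+_ (∑ (T a n) Z))
         (trans (∑-+ (T a n) L₁ (λ p → s * L₂ p)) (cong (_+_ (∑ (T a n) L₁)) (∑-* (T a n) s L₂)))) ⟩
  ∑ (T a n) Z + (∑ (T a n) L₁ + s * ∑ (T a n) L₂)
    ≡⟨ cong₂ _+_ (transvect-ifZero t a n (λ j → f (0 , j)))
         (cong₂ (λ x y → x + s * y) (transvect-lowered₁ t a n K) (transvect-lowered₂ t a n K)) ⟩
  ifZero a (f (0 , n)) + (X + t * Y + s * Y)
    -- `t * Y` comes from the outer substitution and `s * Y` from the inner one. They cancel,
    -- leaving an induction on `a` alone.
    ≡⟨ cong (_+_ (ifZero a (f (0 , n)))) (trans (ring X Y s t) (trans (cong (λ r → X + r * Y) s+t≡0) (ring₀ X Y))) ⟩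
  ifZero a (f (0 , n)) + X
    ≡⟨ descend a ⟩
  f (a , n) ∎
  where
  T = transvect t
  K : ℕ × ℕ → ℚ
  K p = ∑ (transvect s (proj₁ p) (proj₂ p)) (f ∘ incr)
  Z L₁ L₂ : ℕ × ℕ → ℚ
  Z p = ifZero (proj₁ p) (f (0 , proj₂ p))
  L₁ p = lowered (λ i → K (i , proj₂ p)) (proj₁ p)
  L₂ p = lowered (λ j → K (proj₁ p , j)) (proj₂ p)
  X = lowered (λ a → ∑ (T a n) K) a
  Y = lowered (λ n → ∑ (T a n) K) n
  ring : ∀ X Y s t → X + t * Y + s * Y ≡ X + (s + t) * Y
  ring = solve-∀ ℚ-ring
  ring₀ : ∀ X Y → X + 0ℚ * Y ≡ X
  ring₀ = solve-∀ ℚ-ring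
  descend : ∀ a → ifZero a (f (0 , n)) + lowered (λ a → ∑ (T a n) K) a ≡ f (a , n)
  descend zero = ℚP.+-identityʳ _
  descend (suc a) = trans (ℚP.+-identityˡ _) (transvect-inverse s+t≡0 a n (f ∘ incr))

ifZero-* : ∀ a k x → ifZero a (k * x) ≡ k * ifZero a x
ifZero-* zero k x = refl
ifZero-* (suc a) k x = sym (ℚP.*-zeroʳ k)

-- Raising i with weight i + 1 is ∂/∂v applied to F, whose coefficient at vᵃ wⁿ is a + 1 times that
-- of F at vᵃ⁺¹ wⁿ.
transvect-raise₁ : ∀ t a n (f : ℕ × ℕ → ℚ) →
  ∑[ p ∈ transvect t a n ] (ℕtoℚ (suc (proj₁ p)) * f (suc (proj₁ p) , proj₂ p))
    ≡ ℕtoℚ (suc a) * ∑ (transvect t (suc a) n) f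
transvect-raise₁ t a n f = begin
  ∑ (T a n) (raised f)
    ≡⟨ transvect-rec t a n (raised f) ⟩
  ifZero a (1ℚ * f (1 , n)) + (lowered (λ a → ∑ (T a n) (raised f ∘ incr)) a + t * lowered (λ n → ∑ (T a n) (raised f ∘ incr)) n)
    ≡⟨ cong₂ _+_ (ifZero-* a 1ℚ _) (cong₂ (λ x y → x + t * y) (L₁ a) (L₂ n)) ⟩
  1ℚ * Z + (R₁ + ℕtoℚ a * M + t * (R₂ + ℕtoℚ (suc a) * Q))
    ≡⟨ cong (λ b → 1ℚ * Z + (R₁ + ℕtoℚ a * b + t * (R₂ + ℕtoℚ (suc a) * Q))) M-rec ⟩
  1ℚ * Z + (R₁ + ℕtoℚ a * (Z + (R₁ + t * R₂)) + t * (R₂ + ℕtoℚ (suc a) * Q))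
    ≡⟨ cong (λ k → 1ℚ * Z + (R₁ + ℕtoℚ a * (Z + (R₁ + t * R₂)) + t * (R₂ + k * Q))) (ℕtoℚ-suc a) ⟩
  1ℚ * Z + (R₁ + ℕtoℚ a * (Z + (R₁ + t * R₂)) + t * (R₂ + (1ℚ + ℕtoℚ a) * Q))
    ≡⟨ ring Z R₁ R₂ Q (ℕtoℚ a) t ⟩
  (1ℚ + ℕtoℚ a) * ((Z + (R₁ + t * R₂)) + t * Q)
    ≡⟨ cong₂ (λ k b → k * (b + t * Q)) (ℕtoℚ-suc a) M-rec ⟨
  ℕtoℚ (suc a) * (M + t * Q)
    ≡⟨ cong (ℕtoℚ (suc a) *_) (sym (trans (transvect-rec t (suc a) n f) (ℚP.+-identityˡ _))) ⟩
  ℕtoℚ (suc a) * ∑ (T (suc a) n) f ∎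
  where
  T = transvect t
  f⁺ f⁺⁺ : ℕ × ℕ → ℚ
  f⁺ = f ∘ incr
  f⁺⁺ = f⁺ ∘ incr
  raised : (ℕ × ℕ → ℚ) → ℕ × ℕ → ℚ
  raised f p = ℕtoℚ (suc (proj₁ p)) * f (suc (proj₁ p) , proj₂ p)
  Z = ifZero a (f (1 , n))
  M = ∑ (T a n) f⁺
  R₁ = lowered (λ a → ∑ (T a n) f⁺⁺) a
  R₂ = lowered (λ n → ∑ (T a n) f⁺⁺) n
  Q = lowered (λ n → ∑ (T (suc a) n) f⁺) n
  M-rec : M ≡ Z + (R₁ + t * R₂)
  M-rec = transvect-rec t a n f⁺
  split : ∀ a n → ∑ (T a n) (raised f ∘ incr) ≡ ∑ (T a n) f⁺⁺ + ℕtoℚ (suc a) * ∑ (T (suc a) n) f⁺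
  split a n = trans (∑-cong (T a n) λ p → trans (cong (_* f⁺⁺ p) (ℕtoℚ-suc (suc (proj₁ p)))) (expand (f⁺⁺ p) (ℕtoℚ (suc (proj₁ p)))))
             (trans (∑-+ (T a n) f⁺⁺ (raised f⁺)) (cong (_+_ (∑ (T a n) f⁺⁺)) (transvect-raise₁ t a n f⁺)))
    where
    expand : ∀ x k → (1ℚ + k) * x ≡ x + k * x
    expand = solve-∀ ℚ-ring
  zeros : ∀ k → 0ℚ ≡ 0ℚ + k * 0ℚ
  zeros = solve-∀ ℚ-ring
  zeros′ : ∀ b → 0ℚ ≡ 0ℚ + 0ℚ * b
  zeros′ = solve-∀ ℚ-ring
  L₁ : ∀ a → lowered (λ a → ∑ (T a n) (raised f ∘ incr)) a
           ≡ lowered (λ a → ∑ (T a n) f⁺⁺) a + ℕtoℚ a * ∑ (T a n) f⁺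
  L₁ zero = zeros′ (∑ (T 0 n) f⁺)
  L₁ (suc a) = split a n
  L₂ : ∀ n → lowered (λ n → ∑ (T a n) (raised f ∘ incr)) n
           ≡ lowered (λ n → ∑ (T a n) f⁺⁺) n + ℕtoℚ (suc a) * lowered (λ n → ∑ (T (suc a) n) f⁺) n
  L₂ zero = zeros (ℕtoℚ (suc a))
  L₂ (suc n) = split a n
  ring : ∀ Z R₁ R₂ Q k t → 1ℚ * Z + (R₁ + k * (Z + (R₁ + t * R₂)) + t * (R₂ + (1ℚ + k) * Q)) ≡ (1ℚ + k) * ((Z + (R₁ + t * R₂)) + t * Q)
  ring = solve-∀ ℚ-ring

-- The chain rule for ∂F/∂w: the variable w occurs both in wʲ, giving the weighted raising of j, and
-- in v + t w, giving t ∂F/∂v.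
transvect-raise₂ : ∀ t a n (f : ℕ × ℕ → ℚ) →
  ∑[ p ∈ transvect t a n ] (ℕtoℚ (suc (proj₂ p)) * f (proj₁ p , suc (proj₂ p)))
    + t * (ℕtoℚ (suc a) * ∑ (transvect t (suc a) n) f)
    ≡ ℕtoℚ (suc n) * ∑ (transvect t a (suc n)) f
transvect-raise₂ t a n f = begin
  ∑ (T a n) (raised f) + t * (ℕtoℚ (suc a) * ∑ (T (suc a) n) f)
    ≡⟨ cong₂ (λ x y → x + t * (ℕtoℚ (suc a) * y)) (trans (transvect-rec t a n (raised f)) (cong (_+ (M₁ + t * M₂)) (ifZero-* a k _)))
             (trans (transvect-rec t (suc a) n f) (ℚP.+-identityˡ _)) ⟩
  k * Z + (M₁ + t * M₂) + t * (ℕtoℚ (suc a) * (M + t * Q))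
    ≡⟨ cong (λ l → k * Z + (M₁ + t * M₂) + t * l) (trans (cong (_* (M + t * Q)) (ℕtoℚ-suc a))
         (trans (ring₁ (ℕtoℚ a) M t Q) (cong (λ l → M + ℕtoℚ a * M + t * (l * Q)) (sym (ℕtoℚ-suc a))))) ⟩
  k * Z + (M₁ + t * M₂) + t * (M + ℕtoℚ a * M + t * (ℕtoℚ (suc a) * Q))
    ≡⟨ ring₂ (k * Z) M₁ M₂ M (ℕtoℚ a * M) t (ℕtoℚ (suc a) * Q) ⟩
  k * Z + ((M₁ + t * (ℕtoℚ a * M)) + (t * M + t * (M₂ + t * (ℕtoℚ (suc a) * Q))))
    ≡⟨ cong₂ (λ x y → k * Z + (x + (t * M + t * y))) (L₁ a) (L₂ n) ⟩
  k * Z + (k * R + (t * M + t * (ℕtoℚ n * M)))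
    ≡⟨ cong (λ k → k * Z + (k * R + (t * M + t * (ℕtoℚ n * M)))) (ℕtoℚ-suc n) ⟩
  (1ℚ + ℕtoℚ n) * Z + ((1ℚ + ℕtoℚ n) * R + (t * M + t * (ℕtoℚ n * M)))
    ≡⟨ ring₃ (ℕtoℚ n) Z R M t ⟩
  (1ℚ + ℕtoℚ n) * (Z + (R + t * M))
    ≡⟨ cong₂ _*_ (ℕtoℚ-suc n) (transvect-rec t a (suc n) f) ⟨
  ℕtoℚ (suc n) * ∑ (T a (suc n)) f ∎
  where
  T = transvect t
  f⁺ : ℕ × ℕ → ℚ
  f⁺ = f ∘ incr
  raised : (ℕ × ℕ → ℚ) → ℕ × ℕ → ℚ
  raised f p = ℕtoℚ (suc (proj₂ p)) * f (proj₁ p , suc (proj₂ p))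
  k = ℕtoℚ (suc n)
  Z = ifZero a (f (0 , suc n))
  M = ∑ (T a n) f⁺
  R = lowered (λ a → ∑ (T a (suc n)) f⁺) a
  M₁ = lowered (λ a → ∑ (T a n) (raised f⁺)) a
  M₂ = lowered (λ n → ∑ (T a n) (raised f⁺)) n
  Q = lowered (λ n → ∑ (T (suc a) n) f⁺) n
  zeros : ∀ t x k → 0ℚ + t * (0ℚ * x) ≡ k * 0ℚ
  zeros = solve-∀ ℚ-ring
  zeros′ : ∀ t l b → 0ℚ + t * (l * 0ℚ) ≡ 0ℚ * b
  zeros′ = solve-∀ ℚ-ring
  L₁ : ∀ a → lowered (λ a → ∑ (T a n) (raised f⁺)) a + t * (ℕtoℚ a * ∑ (T a n) f⁺)
           ≡ k * lowered (λ a → ∑ (T a (suc n)) f⁺) a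
  L₁ zero = zeros t (∑ (T 0 n) f⁺) k
  L₁ (suc a) = transvect-raise₂ t a n f⁺
  L₂ : ∀ n → lowered (λ n → ∑ (T a n) (raised f⁺)) n + t * (ℕtoℚ (suc a) * lowered (λ n → ∑ (T (suc a) n) f⁺) n)
           ≡ ℕtoℚ n * ∑ (T a n) f⁺
  L₂ zero = zeros′ t (ℕtoℚ (suc a)) (∑ (T a 0) f⁺)
  L₂ (suc n) = transvect-raise₂ t a n f⁺
  ring₁ : ∀ a M t Q → (1ℚ + a) * (M + t * Q) ≡ M + a * M + t * ((1ℚ + a) * Q)
  ring₁ = solve-∀ ℚ-ring
  ring₂ : ∀ Z M₁ M₂ M aM t Q → Z + (M₁ + t * M₂) + t * (M + aM + t * Q) ≡ Z + ((M₁ + t * aM) + (t * M + t * (M₂ + t * Q)))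
  ring₂ = solve-∀ ℚ-ring
  ring₃ : ∀ n Z R M t → (1ℚ + n) * Z + ((1ℚ + n) * R + (t * M + t * (n * M))) ≡ (1ℚ + n) * (Z + (R + t * M))
  ring₃ = solve-∀ ℚ-ring

-- The change of basis

glue : Comp → ℕ × ℕ → Comp
glue w p = proj₁ p ∷ proj₂ p ∷ w

-- The single substitution u₁ = v₁ + u₂, with the tail already expressed in the u's. When there is
-- no second entry, u₁ = v₁.
spread : ℕ → Comp → FS Comp
spread a [] = basis (a ∷ [])
spread a (n ∷ w) = map (λ e → proj₁ e , glue w (proj₂ e)) (transvect 1ℚ a n)

θ : Comp → FS Comp
θ [] = basis []
θ (a ∷ as) = ext (spread a) (θ as)

-- Substitutes v₁ = u₁ - u₂ before treating the tail, whereas `θ` treats the tail first. The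
-- elementary substitutions then cancel in pairs in both composites.
ψ∷ : ℕ → Comp → FS Comp
ψ∷ n [] = basis (n ∷ [])
ψ∷ n (m ∷ w) = ext (λ p → map (λ e → proj₁ e , proj₁ p ∷ proj₂ e) (ψ∷ (proj₂ p) w)) (transvect (- 1ℚ) n m)

ψ : Comp → FS Comp
ψ [] = basis []
ψ (n ∷ w) = ψ∷ n w

∑-ψ∷ : ∀ n m w (f : Comp → ℚ) →
  ∑ (ψ∷ n (m ∷ w)) f ≡ ∑[ p ∈ transvect (- 1ℚ) n m ] ∑[ v ∈ ψ∷ (proj₂ p) w ] f (proj₁ p ∷ v)
∑-ψ∷ n m w f = trans (∑-ext _ (transvect (- 1ℚ) n m) f)
  (∑-cong (transvect (- 1ℚ) n m) λ p → ∑-map (proj₁ p ∷_) (ψ∷ (proj₂ p) w) f)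

∑-spread : ∀ a n w (f : Comp → ℚ) → ∑ (spread a (n ∷ w)) f ≡ ∑[ p ∈ transvect 1ℚ a n ] f (glue w p)
∑-spread a n w f = ∑-map (glue w) (transvect 1ℚ a n) f

θ-[-] : ∀ n (f : Comp → ℚ) → ∑ (θ (n ∷ [])) f ≡ f (n ∷ [])
θ-[-] n f = trans (∑-ext (spread n) (basis []) f) (trans (∑-basis [] (λ w → ∑ (spread n w) f)) (∑-basis (n ∷ []) f))

ψ∘θ : ∀ a (f : Comp → ℚ) → ∑[ w ∈ θ a ] ∑ (ψ w) f ≡ f a
ψ∘θ [] f = trans (∑-basis [] (λ w → ∑ (ψ w) f)) (∑-basis [] f)
ψ∘θ (a ∷ as) f = begin
  ∑[ w ∈ θ (a ∷ as) ] ∑ (ψ w) f                     ≡⟨ ∑-ext (spread a) (θ as) (λ w → ∑ (ψ w) f) ⟩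
  ∑[ w ∈ θ as ] ∑[ v ∈ spread a w ] ∑ (ψ v) f       ≡⟨ ∑-cong (θ as) step ⟩
  ∑[ w ∈ θ as ] ∑[ v ∈ ψ w ] f (a ∷ v)              ≡⟨ ψ∘θ as (λ v → f (a ∷ v)) ⟩
  f (a ∷ as)                                        ∎
  where
  step : ∀ w → ∑[ v ∈ spread a w ] ∑ (ψ v) f ≡ ∑[ v ∈ ψ w ] f (a ∷ v)
  step [] = trans (∑-basis (a ∷ []) (λ v → ∑ (ψ v) f))
                  (trans (∑-basis (a ∷ []) f) (sym (∑-basis [] (λ v → f (a ∷ v)))))
  step (n ∷ w) = trans (∑-spread a n w (λ v → ∑ (ψ v) f))
    (trans (∑-cong (transvect 1ℚ a n) (λ p → ∑-ψ∷ (proj₁ p) (proj₂ p) w f))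
           (transvect-inverse refl a n (λ q → ∑[ v ∈ ψ∷ (proj₂ q) w ] f (proj₁ q ∷ v))))

θ∘ψ∷ : ∀ n w (f : Comp → ℚ) → ∑[ a ∈ ψ∷ n w ] ∑ (θ a) f ≡ f (n ∷ w)
θ∘ψ∷ n [] f = trans (∑-basis (n ∷ []) (λ a → ∑ (θ a) f)) (θ-[-] n f)
θ∘ψ∷ n (m ∷ w) f = begin
  ∑[ a ∈ ψ∷ n (m ∷ w) ] ∑ (θ a) f
    ≡⟨ ∑-ψ∷ n m w (λ a → ∑ (θ a) f) ⟩
  ∑[ p ∈ T ] ∑[ v ∈ ψ∷ (proj₂ p) w ] ∑ (θ (proj₁ p ∷ v)) f
    ≡⟨ ∑-cong T (λ p → ∑-cong (ψ∷ (proj₂ p) w) λ v → ∑-ext (spread (proj₁ p)) (θ v) f) ⟩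
  ∑[ p ∈ T ] ∑[ v ∈ ψ∷ (proj₂ p) w ] ∑[ u ∈ θ v ] ∑ (spread (proj₁ p) u) f
    ≡⟨ ∑-cong T (λ p → θ∘ψ∷ (proj₂ p) w (λ u → ∑ (spread (proj₁ p) u) f)) ⟩
  ∑[ p ∈ T ] ∑ (spread (proj₁ p) (proj₂ p ∷ w)) f
    ≡⟨ ∑-cong T (λ p → ∑-spread (proj₁ p) (proj₂ p) w f) ⟩
  ∑[ p ∈ T ] ∑[ q ∈ transvect 1ℚ (proj₁ p) (proj₂ p) ] f (glue w q)
    ≡⟨ transvect-inverse refl n m (λ q → f (glue w q)) ⟩
  f (n ∷ m ∷ w) ∎
  where T = transvect (- 1ℚ) n m

θ∘ψ : ∀ w (f : Comp → ℚ) → ∑[ a ∈ ψ w ] ∑ (θ a) f ≡ f w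
θ∘ψ [] f = trans (∑-basis [] (λ a → ∑ (θ a) f)) (∑-basis [] f)
θ∘ψ (n ∷ w) f = θ∘ψ∷ n w f

-- Every substitution keeps the number of entries, so `[]` does not occur in `θ (a ∷ as)`.
θ-cong-∷ : ∀ a as {f g : Comp → ℚ} → (∀ n w → f (n ∷ w) ≡ g (n ∷ w)) → ∑ (θ (a ∷ as)) f ≡ ∑ (θ (a ∷ as)) g
θ-cong-∷ a as {f} {g} eq = trans (∑-ext (spread a) (θ as) f)
  (trans (∑-cong (θ as) step) (sym (∑-ext (spread a) (θ as) g)))
  where
  step : ∀ w → ∑ (spread a w) f ≡ ∑ (spread a w) g
  step [] = trans (∑-basis (a ∷ []) f) (trans (eq a []) (sym (∑-basis (a ∷ []) g)))
  step (n ∷ w) = trans (∑-spread a n w f)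
    (trans (∑-cong (transvect 1ℚ a n) (λ p → eq (proj₁ p) (proj₂ p ∷ w))) (sym (∑-spread a n w g)))

low : Comp → FS Comp
low [] = []
low (zero ∷ w) = map (λ e → proj₁ e , zero ∷ proj₂ e) (low w)
low (suc n ∷ w) = basis (n ∷ w) ⊕ map (λ e → proj₁ e , suc n ∷ proj₂ e) (low w)

∑-low : ∀ n w (f : Comp → ℚ) →
  ∑ (low (n ∷ w)) f ≡ lowered (λ n → f (n ∷ w)) n + ∑[ v ∈ low w ] f (n ∷ v)
∑-low zero w f = trans (∑-map (zero ∷_) (low w) f) (sym (ℚP.+-identityˡ _))
∑-low (suc n) w f = trans (∑-⊕ (basis (n ∷ w)) (map (λ e → proj₁ e , suc n ∷ proj₂ e) (low w)) f)
  (cong₂ _+_ (∑-basis (n ∷ w) f) (∑-map (suc n ∷_) (low w) f))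

-- Here `p` and `q` stand for what `f` sees after a leading x₀, respectively x₁, has been removed.
-- Removing x₀ multiplies the generating series by u₁ = v₁ + ⋯ + vₖ, which in the basis (eₐ) is
-- `low`. Removing x₁ keeps the terms free of u₁, hence free of v₁, which forces x = 0.
θ-rec : ∀ x as (f p q : Comp → ℚ) →
  (∀ n w → f (n ∷ w) ≡ ifZero n (q w) + lowered (λ n → p (n ∷ w)) n) →
  ∑ (θ (x ∷ as)) f ≡ ifZero x (∑ (θ as) q) + ∑[ b ∈ low (x ∷ as) ] ∑ (θ b) p
θ-rec x as f p q f-rec = begin
  ∑ (θ (x ∷ as)) f
    ≡⟨ ∑-ext (spread x) (θ as) f ⟩
  ∑[ w ∈ θ as ] ∑ (spread x w) f
    ≡⟨ ∑-cong (θ as) step ⟩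
  ∑[ w ∈ θ as ] (ifZero x (q w) + (lowered (λ x → ∑ (spread x w) p) x + down w))
    ≡⟨ trans (∑-+ (θ as) (λ w → ifZero x (q w)) (λ w → lowered (λ x → ∑ (spread x w) p) x + down w))
         (cong₂ _+_ (∑-ifZero (θ as) q x)
           (trans (∑-+ (θ as) (λ w → lowered (λ x → ∑ (spread x w) p) x) down)
             (cong (_+ ∑ (θ as) down) (trans (∑-lowered (θ as) (λ w x → ∑ (spread x w) p) x)
                 (lowered-cong x λ x → sym (∑-ext (spread x) (θ as) p)))))) ⟩
  ifZero x (∑ (θ as) q) + (lowered (λ x → ∑ (θ (x ∷ as)) p) x + ∑ (θ as) down)
    ≡⟨ cong (λ s → ifZero x (∑ (θ as) q) + (lowered (λ x → ∑ (θ (x ∷ as)) p) x + s)) (rest as) ⟩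
  ifZero x (∑ (θ as) q) + (lowered (λ x → ∑ (θ (x ∷ as)) p) x + ∑[ b ∈ low as ] ∑ (θ (x ∷ b)) p)
    ≡⟨ cong (_+_ (ifZero x (∑ (θ as) q))) (∑-low x as (λ b → ∑ (θ b) p)) ⟨
  ifZero x (∑ (θ as) q) + ∑[ b ∈ low (x ∷ as) ] ∑ (θ b) p ∎
  where
  -- Multiplication by u₂, the second summand of u₁ = v₁ + u₂; it is zero when there is no u₂.
  down : Comp → ℚ
  down [] = 0ℚ
  down (n ∷ w) = lowered (λ n → ∑ (spread x (n ∷ w)) p) n

  step : ∀ w → ∑ (spread x w) f ≡ ifZero x (q w) + (lowered (λ x → ∑ (spread x w) p) x + down w)
  step [] = trans (∑-basis (x ∷ []) f) (trans (f-rec x []) (cong (_+_ (ifZero x (q [])))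
    (trans (lowered-cong x λ x → sym (∑-basis (x ∷ []) p)) (sym (ℚP.+-identityʳ _)))))
  step (n ∷ w) = begin
    ∑ (spread x (n ∷ w)) f
      ≡⟨ ∑-spread x n w f ⟩
    ∑[ e ∈ T ] f (glue w e)
      ≡⟨ ∑-cong T (λ e → f-rec (proj₁ e) (proj₂ e ∷ w)) ⟩
    ∑[ e ∈ T ] (ifZero (proj₁ e) (q (proj₂ e ∷ w)) + lowered (λ i → p (glue w (i , proj₂ e))) (proj₁ e))
      ≡⟨ ∑-+ T (λ e → ifZero (proj₁ e) (q (proj₂ e ∷ w))) (λ e → lowered (λ i → p (glue w (i , proj₂ e))) (proj₁ e)) ⟩
    _ ≡⟨ cong₂ _+_ (transvect-ifZero 1ℚ x n (λ j → q (j ∷ w))) (transvect-lowered₁ 1ℚ x n (λ e → p (glue w e))) ⟩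
    ifZero x (q (n ∷ w)) + (lowered (λ x → ∑[ e ∈ transvect 1ℚ x n ] p (glue w e)) x + 1ℚ * lowered (λ n → ∑[ e ∈ transvect 1ℚ x n ] p (glue w e)) n)
      ≡⟨ cong (_+_ (ifZero x (q (n ∷ w)))) (cong₂ _+_ (lowered-cong x λ x → sym (∑-spread x n w p))
           (trans (ℚP.*-identityˡ _) (lowered-cong n λ n → sym (∑-spread x n w p)))) ⟩
    ifZero x (q (n ∷ w)) + (lowered (λ x → ∑ (spread x (n ∷ w)) p) x + down (n ∷ w)) ∎
    where T = transvect 1ℚ x n

  rest : ∀ as → ∑ (θ as) down ≡ ∑[ b ∈ low as ] ∑ (θ (x ∷ b)) p
  rest [] = ∑-basis [] down
  rest (b ∷ bs) = begin
    ∑ (θ (b ∷ bs)) down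
      -- The lemma itself for the shorter word, as u₂ = v₂ + ⋯ + vₖ. Pure lowering has no x₁ part,
      -- so the second functional is 0.
      ≡⟨ θ-rec b bs down (λ w → ∑ (spread x w) p) (λ _ → 0ℚ)
           (λ n w → sym (trans (cong (_+ lowered (λ n → ∑ (spread x (n ∷ w)) p) n) (ifZero-0 n)) (ℚP.+-identityˡ _))) ⟩
    ifZero b (∑ (θ bs) (λ _ → 0ℚ)) + ∑[ c ∈ low (b ∷ bs) ] ∑[ w ∈ θ c ] ∑ (spread x w) p
      ≡⟨ cong₂ _+_ (trans (cong (ifZero b) (∑-0 (θ bs))) (ifZero-0 b))
          (∑-cong (low (b ∷ bs)) λ c → sym (∑-ext (spread x) (θ c) p)) ⟩
    0ℚ + ∑[ c ∈ low (b ∷ bs) ] ∑ (θ (x ∷ c)) p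
      ≡⟨ ℚP.+-identityˡ _ ⟩
    ∑[ c ∈ low (b ∷ bs) ] ∑ (θ (x ∷ c)) p ∎

-- Shuffles

shuffle : List A → List A → FS (List A)
shuffle [] v = basis v
shuffle (x ∷ u) [] = basis (x ∷ u)
shuffle (x ∷ u) (y ∷ v) = map (λ e → proj₁ e , x ∷ proj₂ e) (shuffle u (y ∷ v))
                        ⊕ map (λ e → proj₁ e , y ∷ proj₂ e) (shuffle (x ∷ u) v)

∑-shuffle-[]ʳ : ∀ (u : List A) (f : List A → ℚ) → ∑ (shuffle u []) f ≡ f u
∑-shuffle-[]ʳ [] f = ∑-basis [] f
∑-shuffle-[]ʳ (x ∷ u) f = ∑-basis (x ∷ u) f

∑-shuffle-∷ : ∀ (x : A) u y v (f : List A → ℚ) →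
  ∑ (shuffle (x ∷ u) (y ∷ v)) f ≡ ∑[ w ∈ shuffle u (y ∷ v) ] f (x ∷ w) + ∑[ w ∈ shuffle (x ∷ u) v ] f (y ∷ w)
∑-shuffle-∷ x u y v f =
  trans (∑-⊕ (map (λ e → proj₁ e , x ∷ proj₂ e) (shuffle u (y ∷ v))) (map (λ e → proj₁ e , y ∷ proj₂ e) (shuffle (x ∷ u) v)) f)
        (cong₂ _+_ (∑-map (x ∷_) (shuffle u (y ∷ v)) f) (∑-map (y ∷_) (shuffle (x ∷ u) v) f))

lowered-+ : ∀ (f g : ℕ → ℚ) n → lowered (λ n → f n + g n) n ≡ lowered f n + lowered g n
lowered-+ f g zero = refl
lowered-+ f g (suc n) = refl

-- Each letter of a shuffle comes from exactly one of the two words, and `low` changes one letter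
-- while leaving the positions of all letters alone. Hence `low` is a derivation.
low-shuffle : ∀ a b (f : Comp → ℚ) →
  ∑[ c ∈ shuffle a b ] ∑ (low c) f
    ≡ ∑[ a′ ∈ low a ] ∑ (shuffle a′ b) f + ∑[ b′ ∈ low b ] ∑ (shuffle a b′) f
low-shuffle [] b f = trans (∑-basis b (λ c → ∑ (low c) f))
  (trans (∑-cong (low b) λ b′ → sym (∑-basis b′ f)) (sym (ℚP.+-identityˡ _)))
low-shuffle a@(x ∷ a⁻) [] f = trans (∑-basis a (λ c → ∑ (low c) f))
  (trans (∑-cong (low a) λ a′ → sym (∑-shuffle-[]ʳ a′ f)) (sym (ℚP.+-identityʳ _)))
low-shuffle (x ∷ a) (y ∷ b) f = begin
  ∑[ c ∈ shuffle xa yb ] ∑ (low c) f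
    ≡⟨ ∑-shuffle-∷ x a y b (λ c → ∑ (low c) f) ⟩
  ∑[ c ∈ shuffle a yb ] ∑ (low (x ∷ c)) f + ∑[ c ∈ shuffle xa b ] ∑ (low (y ∷ c)) f
    ≡⟨ cong₂ _+_ (peel x a yb) (peel y xa b) ⟩
  (X₁ + ∑[ c ∈ shuffle a yb ] ∑ (low c) (f ∘ (x ∷_))) + (Y₂ + ∑[ c ∈ shuffle xa b ] ∑ (low c) (f ∘ (y ∷_)))
    ≡⟨ cong₂ (λ s t → (X₁ + s) + (Y₂ + t)) (low-shuffle a (y ∷ b) (f ∘ (x ∷_))) (low-shuffle (x ∷ a) b (f ∘ (y ∷_))) ⟩
  (X₁ + (P + ∑[ b′ ∈ low yb ] ∑ (shuffle a b′) (f ∘ (x ∷_)))) + (Y₂ + (∑[ a′ ∈ low xa ] ∑ (shuffle a′ b) (f ∘ (y ∷_)) + Q))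
    ≡⟨ cong₂ (λ s t → (X₁ + (P + s)) + (Y₂ + (t + Q)))
          (∑-low y b (λ b′ → ∑ (shuffle a b′) (f ∘ (x ∷_)))) (∑-low x a (λ a′ → ∑ (shuffle a′ b) (f ∘ (y ∷_)))) ⟩
  (X₁ + (P + (Y₁ + R))) + (Y₂ + ((X₂ + S) + Q))
    ≡⟨ ring X₁ X₂ Y₁ Y₂ P Q R S ⟩
  ((X₁ + X₂) + (P + S)) + ((Y₁ + Y₂) + (R + Q))
    ≡⟨ cong₂ _+_ left right ⟨
  ∑[ a′ ∈ low xa ] ∑ (shuffle a′ yb) f + ∑[ b′ ∈ low yb ] ∑ (shuffle xa b′) f ∎
  where
  xa = x ∷ a
  yb = y ∷ b
  X₁ = lowered (λ x → ∑[ c ∈ shuffle a yb ] f (x ∷ c)) x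
  X₂ = lowered (λ x → ∑[ c ∈ shuffle (x ∷ a) b ] f (y ∷ c)) x
  Y₁ = lowered (λ y → ∑[ c ∈ shuffle a (y ∷ b) ] f (x ∷ c)) y
  Y₂ = lowered (λ y → ∑[ c ∈ shuffle xa b ] f (y ∷ c)) y
  P = ∑[ a′ ∈ low a ] ∑[ c ∈ shuffle a′ yb ] f (x ∷ c)
  Q = ∑[ b′ ∈ low b ] ∑[ c ∈ shuffle xa b′ ] f (y ∷ c)
  R = ∑[ b′ ∈ low b ] ∑[ c ∈ shuffle a (y ∷ b′) ] f (x ∷ c)
  S = ∑[ a′ ∈ low a ] ∑[ c ∈ shuffle (x ∷ a′) b ] f (y ∷ c)
  peel : ∀ z u v → ∑[ c ∈ shuffle u v ] ∑ (low (z ∷ c)) f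
                 ≡ lowered (λ z → ∑[ c ∈ shuffle u v ] f (z ∷ c)) z + ∑[ c ∈ shuffle u v ] ∑ (low c) (f ∘ (z ∷_))
  peel z u v = trans (∑-cong (shuffle u v) λ c → ∑-low z c f)
    (trans (∑-+ (shuffle u v) (λ c → lowered (λ z → f (z ∷ c)) z) (λ c → ∑ (low c) (f ∘ (z ∷_))))
           (cong (_+ ∑[ c ∈ shuffle u v ] ∑ (low c) (f ∘ (z ∷_))) (∑-lowered (shuffle u v) (λ c z → f (z ∷ c)) z)))
  left : ∑[ a′ ∈ low xa ] ∑ (shuffle a′ yb) f ≡ (X₁ + X₂) + (P + S)
  left = trans (∑-low x a (λ a′ → ∑ (shuffle a′ yb) f))
    (cong₂ _+_ (trans (lowered-cong x λ x → ∑-shuffle-∷ x a y b f)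
                      (lowered-+ (λ x → ∑[ c ∈ shuffle a yb ] f (x ∷ c)) (λ x → ∑[ c ∈ shuffle (x ∷ a) b ] f (y ∷ c)) x))
               (trans (∑-cong (low a) λ a′ → ∑-shuffle-∷ x a′ y b f)
                      (∑-+ (low a) (λ a′ → ∑[ c ∈ shuffle a′ yb ] f (x ∷ c)) (λ a′ → ∑[ c ∈ shuffle (x ∷ a′) b ] f (y ∷ c)))))
  right : ∑[ b′ ∈ low yb ] ∑ (shuffle xa b′) f ≡ (Y₁ + Y₂) + (R + Q)
  right = trans (∑-low y b (λ b′ → ∑ (shuffle xa b′) f))
    (cong₂ _+_ (trans (lowered-cong y λ y → ∑-shuffle-∷ x a y b f)
                      (lowered-+ (λ y → ∑[ c ∈ shuffle a (y ∷ b) ] f (x ∷ c)) (λ y → ∑[ c ∈ shuffle xa b ] f (y ∷ c)) y))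
               (trans (∑-cong (low b) λ b′ → ∑-shuffle-∷ x a y b′ f)
                      (∑-+ (low b) (λ b′ → ∑[ c ∈ shuffle a (y ∷ b′) ] f (x ∷ c)) (λ b′ → ∑[ c ∈ shuffle xa b′ ] f (y ∷ c)))))
  ring : ∀ X₁ X₂ Y₁ Y₂ P Q R S → (X₁ + (P + (Y₁ + R))) + (Y₂ + ((X₂ + S) + Q)) ≡ ((X₁ + X₂) + (P + S)) + ((Y₁ + Y₂) + (R + Q))
  ring = solve-∀ ℚ-ring

-- The product on symbols, by leading letter

onImage : (Comp → ℚ) → Maybe Comp → ℚ
onImage f = maybe′ f 0ℚ

∑-ρ⁻¹ : ∀ (z : FS Word) (f : Comp → ℚ) → ∑ (ρ⁻¹ z) f ≡ ∑[ w ∈ z ] onImage f (ρ⁻¹-word 0 w)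
∑-ρ⁻¹ [] f = refl
∑-ρ⁻¹ ((c , w) ∷ z) f with ρ⁻¹-word 0 w
... | just u = cong (_+_ (c * f u)) (∑-ρ⁻¹ z f)
... | nothing = trans (∑-ρ⁻¹ z f) (sym (trans (cong (_+ rest) (ℚP.*-zeroʳ c)) (ℚP.+-identityˡ rest)))
  where rest = ∑[ w ∈ z ] onImage f (ρ⁻¹-word 0 w)

ρ⁻¹-ρ : ∀ k n w → ρ⁻¹-word k (replicate n false ++ (true ∷ ρ w)) ≡ just (k ℕ.+ n ∷ w)
ρ⁻¹-ρ zero (suc n) w = ρ⁻¹-ρ 1 n w
ρ⁻¹-ρ (suc k) (suc n) w = trans (ρ⁻¹-ρ (suc (suc k)) n w) (cong (λ m → just (suc m ∷ w)) (sym (ℕP.+-suc k n)))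
ρ⁻¹-ρ zero zero [] = refl
ρ⁻¹-ρ (suc k) zero [] = cong (λ m → just (suc m ∷ [])) (sym (ℕP.+-identityʳ k))
ρ⁻¹-ρ zero zero (n ∷ w) rewrite ρ⁻¹-ρ 0 n w = refl
ρ⁻¹-ρ (suc k) zero (n ∷ w) rewrite ρ⁻¹-ρ 0 n w = cong (λ m → just (suc m ∷ n ∷ w)) (sym (ℕP.+-identityʳ k))

onImage-ρ : ∀ (f : Comp → ℚ) w → onImage f (ρ⁻¹-word 0 (ρ w)) ≡ f w
onImage-ρ f [] = refl
onImage-ρ f (n ∷ w) = cong (onImage f) (ρ⁻¹-ρ 0 n w)

-- The transpose of prefixing x₀. At `[]` the prefixed word is x₀, which lies outside the image of
-- `ρ`, so the value is 0.
onRaised : (Comp → ℚ) → Comp → ℚ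
onRaised f [] = 0ℚ
onRaised f (n ∷ w) = f (suc n ∷ w)

-- Starting the decoder with one more pending x₀ raises the first entry it produces; a word that
-- ends before any x₁ contributes 0 on both sides.
onImage-false : ∀ (f : Comp → ℚ) k w → onImage f (ρ⁻¹-word (suc k) w) ≡ onImage (onRaised f) (ρ⁻¹-word k w)
onImage-false f zero [] = refl
onImage-false f (suc k) [] = refl
onImage-false f zero (false ∷ w) = onImage-false f 1 w
onImage-false f (suc k) (false ∷ w) = onImage-false f (suc (suc k)) w
onImage-false f zero (true ∷ w) with ρ⁻¹-word 0 w
... | just _ = refl
... | nothing = refl
onImage-false f (suc k) (true ∷ w) with ρ⁻¹-word 0 w
... | just _ = refl
... | nothing = refl

onImage-true : ∀ (f : Comp → ℚ) w → onImage f (ρ⁻¹-word 0 (true ∷ w)) ≡ onImage (f ∘ (0 ∷_)) (ρ⁻¹-word 0 w)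
onImage-true f w with ρ⁻¹-word 0 w
... | just _ = refl
... | nothing = refl

∑-ρ⁻¹-prefix-false : ∀ z (f : Comp → ℚ) → ∑ (ρ⁻¹ (prefix false z)) f ≡ ∑ (ρ⁻¹ z) (onRaised f)
∑-ρ⁻¹-prefix-false z f = begin
  ∑ (ρ⁻¹ (prefix false z)) f                           ≡⟨ ∑-ρ⁻¹ (prefix false z) f ⟩
  ∑[ w ∈ prefix false z ] onImage f (ρ⁻¹-word 0 w)     ≡⟨ ∑-map (false ∷_) z (λ w → onImage f (ρ⁻¹-word 0 w)) ⟩
  ∑[ w ∈ z ] onImage f (ρ⁻¹-word 1 w)                  ≡⟨ ∑-cong z (onImage-false f 0) ⟩
  ∑[ w ∈ z ] onImage (onRaised f) (ρ⁻¹-word 0 w)       ≡⟨ ∑-ρ⁻¹ z (onRaised f) ⟨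
  ∑ (ρ⁻¹ z) (onRaised f)                               ∎

∑-ρ⁻¹-prefix-true : ∀ z (f : Comp → ℚ) → ∑ (ρ⁻¹ (prefix true z)) f ≡ ∑[ w ∈ ρ⁻¹ z ] f (0 ∷ w)
∑-ρ⁻¹-prefix-true z f = begin
  ∑ (ρ⁻¹ (prefix true z)) f                            ≡⟨ ∑-ρ⁻¹ (prefix true z) f ⟩
  ∑[ w ∈ prefix true z ] onImage f (ρ⁻¹-word 0 w)      ≡⟨ ∑-map (true ∷_) z (λ w → onImage f (ρ⁻¹-word 0 w)) ⟩
  ∑[ w ∈ z ] onImage f (ρ⁻¹-word 0 (true ∷ w))         ≡⟨ ∑-cong z (onImage-true f) ⟩
  ∑[ w ∈ z ] onImage (f ∘ (0 ∷_)) (ρ⁻¹-word 0 w)       ≡⟨ ∑-ρ⁻¹ z (f ∘ (0 ∷_)) ⟨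
  ∑[ w ∈ ρ⁻¹ z ] f (0 ∷ w)                             ∎

∑-ρ⁻¹-⊕ : ∀ y z (f : Comp → ℚ) → ∑ (ρ⁻¹ (y ⊕ z)) f ≡ ∑ (ρ⁻¹ y) f + ∑ (ρ⁻¹ z) f
∑-ρ⁻¹-⊕ y z f = trans (∑-ρ⁻¹ (y ⊕ z) f)
  (trans (∑-⊕ y z (λ w → onImage f (ρ⁻¹-word 0 w))) (sym (cong₂ _+_ (∑-ρ⁻¹ y f) (∑-ρ⁻¹ z f))))

∑-ш*-[]ˡ : ∀ v (f : Comp → ℚ) → ∑ ([] ш* v) f ≡ f v
∑-ш*-[]ˡ v f = trans (∑-ρ⁻¹ (basis (ρ v)) f) (trans (∑-basis (ρ v) (λ w → onImage f (ρ⁻¹-word 0 w))) (onImage-ρ f v))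

∑-ш*-[]ʳ : ∀ u (f : Comp → ℚ) → ∑ (u ш* []) f ≡ f u
∑-ш*-[]ʳ [] f = ∑-ш*-[]ˡ [] f
∑-ш*-[]ʳ u@(zero ∷ _) f = trans (∑-ρ⁻¹ (basis (ρ u)) f) (trans (∑-basis (ρ u) (λ w → onImage f (ρ⁻¹-word 0 w))) (onImage-ρ f u))
∑-ш*-[]ʳ u@(suc _ ∷ _) f = trans (∑-ρ⁻¹ (basis (ρ u)) f) (trans (∑-basis (ρ u) (λ w → onImage f (ρ⁻¹-word 0 w))) (onImage-ρ f u))

-- For nonempty `v`, the part of `(n ∷ u) ш* v` whose first letter comes from the left factor: that
-- letter is x₁ when n = 0 and x₀ otherwise.
headˡ : ℕ → Comp → Comp → (Comp → ℚ) → ℚ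
headˡ n u v f = ifZero n (∑[ w ∈ u ш* v ] f (0 ∷ w)) + lowered (λ n → ∑ ((n ∷ u) ш* v) (onRaised f)) n

headʳ : Comp → ℕ → Comp → (Comp → ℚ) → ℚ
headʳ u m v f = ifZero m (∑[ w ∈ u ш* v ] f (0 ∷ w)) + lowered (λ m → ∑ (u ш* (m ∷ v)) (onRaised f)) m

∑-ш*-∷ : ∀ n u m v (f : Comp → ℚ) → ∑ ((n ∷ u) ш* (m ∷ v)) f ≡ headˡ n u (m ∷ v) f + headʳ (n ∷ u) m v f
∑-ш*-∷ zero u zero v f =
  trans (∑-ρ⁻¹-⊕ (prefix true (sh (ρ u) (ρ (0 ∷ v)))) (prefix true (sh (ρ (0 ∷ u)) (ρ v))) f)
    (cong₂ _+_ (trans (∑-ρ⁻¹-prefix-true (sh (ρ u) (ρ (0 ∷ v))) f) (sym (ℚP.+-identityʳ _)))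
               (trans (∑-ρ⁻¹-prefix-true (sh (ρ (0 ∷ u)) (ρ v)) f) (sym (ℚP.+-identityʳ _))))
∑-ш*-∷ zero u (suc m) v f =
  trans (∑-ρ⁻¹-⊕ (prefix true (sh (ρ u) (ρ (suc m ∷ v)))) (prefix false (sh (ρ (0 ∷ u)) (ρ (m ∷ v)))) f)
    (cong₂ _+_ (trans (∑-ρ⁻¹-prefix-true (sh (ρ u) (ρ (suc m ∷ v))) f) (sym (ℚP.+-identityʳ _)))
               (trans (∑-ρ⁻¹-prefix-false (sh (ρ (0 ∷ u)) (ρ (m ∷ v))) f) (sym (ℚP.+-identityˡ _))))
∑-ш*-∷ (suc n) u zero v f =
  trans (∑-ρ⁻¹-⊕ (prefix false (sh (ρ (n ∷ u)) (ρ (0 ∷ v)))) (prefix true (sh (ρ (suc n ∷ u)) (ρ v))) f)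
    (cong₂ _+_ (trans (∑-ρ⁻¹-prefix-false (sh (ρ (n ∷ u)) (ρ (0 ∷ v))) f) (sym (ℚP.+-identityˡ _)))
               (trans (∑-ρ⁻¹-prefix-true (sh (ρ (suc n ∷ u)) (ρ v)) f) (sym (ℚP.+-identityʳ _))))
∑-ш*-∷ (suc n) u (suc m) v f =
  trans (∑-ρ⁻¹-⊕ (prefix false (sh (ρ (n ∷ u)) (ρ (suc m ∷ v)))) (prefix false (sh (ρ (suc n ∷ u)) (ρ (m ∷ v)))) f)
    (cong₂ _+_ (trans (∑-ρ⁻¹-prefix-false (sh (ρ (n ∷ u)) (ρ (suc m ∷ v))) f) (sym (ℚP.+-identityˡ _)))
               (trans (∑-ρ⁻¹-prefix-false (sh (ρ (suc n ∷ u)) (ρ (m ∷ v))) f) (sym (ℚP.+-identityˡ _))))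

-- The product in the basis (eₐ)

∑-low-cong : ∀ w {f g : Comp → ℚ} → (∀ v → suc (weight v) ≡ weight w → f v ≡ g v) → ∑ (low w) f ≡ ∑ (low w) g
∑-low-cong [] eq = refl
∑-low-cong (n ∷ w) {f} {g} eq = trans (∑-low n w f) (trans (cong₂ _+_ (head n eq)
    (∑-low-cong w λ v h → eq (n ∷ v) (cong suc (trans (sym (ℕP.+-suc n (weight v))) (cong (n ℕ.+_) h)))))
    (sym (∑-low n w g)))
  where
  head : ∀ n → (∀ v → suc (weight v) ≡ weight (n ∷ w) → f v ≡ g v) →
         lowered (λ n → f (n ∷ w)) n ≡ lowered (λ n → g (n ∷ w)) n
  head zero eq = refl
  head (suc n) eq = eq (n ∷ w) refl

onRaised-rec : ∀ (f : Comp → ℚ) n w → f (n ∷ w) ≡ ifZero n (f (0 ∷ w)) + lowered (λ n → onRaised f (n ∷ w)) n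
onRaised-rec f zero w = sym (ℚP.+-identityʳ _)
onRaised-rec f (suc n) w = sym (ℚP.+-identityˡ _)

Hˡ : (Comp → ℚ) → Comp → Comp → ℚ
Hˡ f [] v = 0ℚ
Hˡ f (n ∷ u) v = headˡ n u v f

Hʳ : (Comp → ℚ) → Comp → Comp → ℚ
Hʳ f u [] = 0ℚ
Hʳ f u (m ∷ v) = headʳ u m v f

∑-Hˡ : ∀ x a (V : FS Comp) f → ∑[ u ∈ θ (x ∷ a) ] ∑[ v ∈ V ] Hˡ f u v
  ≡ ifZero x (∑[ u ∈ θ a ] ∑[ v ∈ V ] ∑[ w ∈ u ш* v ] f (0 ∷ w))
    + ∑[ a′ ∈ low (x ∷ a) ] ∑[ u ∈ θ a′ ] ∑[ v ∈ V ] ∑ (u ш* v) (onRaised f)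
∑-Hˡ x a V f = θ-rec x a (λ u → ∑[ v ∈ V ] Hˡ f u v) (λ u → ∑[ v ∈ V ] ∑ (u ш* v) (onRaised f)) (λ u → ∑[ v ∈ V ] ∑[ w ∈ u ш* v ] f (0 ∷ w))
  λ n u → trans (∑-+ V (λ v → ifZero n (∑[ w ∈ u ш* v ] f (0 ∷ w))) (λ v → lowered (λ n → ∑ ((n ∷ u) ш* v) (onRaised f)) n))
     (cong₂ _+_ (∑-ifZero V (λ v → ∑[ w ∈ u ш* v ] f (0 ∷ w)) n) (∑-lowered V (λ v n → ∑ ((n ∷ u) ш* v) (onRaised f)) n))

∑-Hʳ : ∀ y b (U : FS Comp) f → ∑[ u ∈ U ] ∑[ v ∈ θ (y ∷ b) ] Hʳ f u v
  ≡ ifZero y (∑[ u ∈ U ] ∑[ v ∈ θ b ] ∑[ w ∈ u ш* v ] f (0 ∷ w))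
    + ∑[ b′ ∈ low (y ∷ b) ] ∑[ u ∈ U ] ∑[ v ∈ θ b′ ] ∑ (u ш* v) (onRaised f)
∑-Hʳ y b U f = begin
  ∑[ u ∈ U ] ∑[ v ∈ θ (y ∷ b) ] Hʳ f u v
    ≡⟨ ∑-cong U (λ u → θ-rec y b (Hʳ f u) (λ v → ∑ (u ш* v) (onRaised f)) (λ v → ∑[ w ∈ u ш* v ] f (0 ∷ w)) λ _ _ → refl) ⟩
  ∑[ u ∈ U ] (ifZero y (∑[ v ∈ θ b ] ∑[ w ∈ u ш* v ] f (0 ∷ w)) + ∑[ b′ ∈ low (y ∷ b) ] ∑[ v ∈ θ b′ ] ∑ (u ш* v) (onRaised f))
    ≡⟨ ∑-+ U (λ u → ifZero y (∑[ v ∈ θ b ] ∑[ w ∈ u ш* v ] f (0 ∷ w))) (λ u → ∑[ b′ ∈ low (y ∷ b) ] ∑[ v ∈ θ b′ ] ∑ (u ш* v) (onRaised f)) ⟩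
  _ ≡⟨ cong₂ _+_ (∑-ifZero U (λ u → ∑[ v ∈ θ b ] ∑[ w ∈ u ш* v ] f (0 ∷ w)) y)
         (∑-swap U (low (y ∷ b)) (λ u b′ → ∑[ v ∈ θ b′ ] ∑ (u ш* v) (onRaised f))) ⟩
  ifZero y (∑[ u ∈ U ] ∑[ v ∈ θ b ] ∑[ w ∈ u ш* v ] f (0 ∷ w))
    + ∑[ b′ ∈ low (y ∷ b) ] ∑[ u ∈ U ] ∑[ v ∈ θ b′ ] ∑ (u ш* v) (onRaised f) ∎

∑∑-+ : ∀ (U : FS A) (V : FS B) (f g : A → B → ℚ) →
  ∑[ u ∈ U ] ∑[ v ∈ V ] (f u v + g u v) ≡ ∑[ u ∈ U ] ∑ V (f u) + ∑[ u ∈ U ] ∑ V (g u)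
∑∑-+ U V f g = trans (∑-cong U λ u → ∑-+ V (f u) (g u)) (∑-+ U (λ u → ∑ V (f u)) (λ u → ∑ V (g u)))

-- Both sides satisfy the same recursion under removal of the leading x₀ or x₁. The induction cannot
-- be structural, because removing x₀ lowers a letter anywhere in the word, but each removal costs
-- one unit of the total weight.
θ-shuffle-below : ∀ N a b → weight a ℕ.+ weight b ℕ.< N → ∀ (f : Comp → ℚ) →
  ∑[ c ∈ shuffle a b ] ∑ (θ c) f ≡ ∑[ u ∈ θ a ] ∑[ v ∈ θ b ] ∑ (u ш* v) f
θ-shuffle-below N [] b _ f = trans (∑-basis b (λ c → ∑ (θ c) f))
  (sym (trans (∑-basis [] (λ u → ∑[ v ∈ θ b ] ∑ (u ш* v) f)) (∑-cong (θ b) λ v → ∑-ш*-[]ˡ v f)))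
θ-shuffle-below N a@(_ ∷ _) [] _ f = trans (∑-basis a (λ c → ∑ (θ c) f))
  (sym (∑-cong (θ a) λ u → trans (∑-basis [] (λ v → ∑ (u ш* v) f)) (∑-ш*-[]ʳ u f)))
θ-shuffle-below (suc N) xa@(x ∷ a) yb@(y ∷ b) (s≤s bound) f = begin
  ∑[ c ∈ shuffle xa yb ] ∑ (θ c) f
    ≡⟨ trans (∑-shuffle-∷ x a y b (λ c → ∑ (θ c) f))
         (trans (cong₂ _+_ (∑-cong (shuffle a yb) (rec x)) (∑-cong (shuffle xa b) (rec y)))
         (sym (∑-shuffle-∷ x a y b (λ c → pop c + fall c)))) ⟩
  ∑[ c ∈ shuffle xa yb ] (pop c + fall c)
    ≡⟨ trans (∑-+ (shuffle xa yb) pop fall) (cong₂ _+_ (∑-shuffle-∷ x a y b pop) (low-shuffle xa yb (λ d → ∑ (θ d) f⁺))) ⟩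
  (∑[ c ∈ shuffle a yb ] ifZero x (∑ (θ c) f₀) + ∑[ c ∈ shuffle xa b ] ifZero y (∑ (θ c) f₀))
    + (∑[ a′ ∈ low xa ] ∑[ c ∈ shuffle a′ yb ] ∑ (θ c) f⁺ + ∑[ b′ ∈ low yb ] ∑[ c ∈ shuffle xa b′ ] ∑ (θ c) f⁺)
    ≡⟨ cong₂ _+_
        (cong₂ _+_ (trans (∑-ifZero (shuffle a yb) (λ c → ∑ (θ c) f₀) x)
            (cong (ifZero x) (θ-shuffle-below N a yb (ℕP.<-≤-trans (ℕP.+-monoˡ-< (weight yb) (s≤s (ℕP.m≤n+m (weight a) x))) bound) f₀)))
                   (trans (∑-ifZero (shuffle xa b) (λ c → ∑ (θ c) f₀) y)
                       (cong (ifZero y) (θ-shuffle-below N xa b (ℕP.<-≤-trans (ℕP.+-monoʳ-< (weight xa) (s≤s (ℕP.m≤n+m (weight b) y))) bound) f₀))))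
        (cong₂ _+_ (∑-low-cong xa λ a′ h → θ-shuffle-below N a′ yb (ℕP.<-≤-trans (ℕP.+-monoˡ-< (weight yb) (ℕP.≤-reflexive h)) bound) f⁺)
                   (∑-low-cong yb λ b′ h → θ-shuffle-below N xa b′ (ℕP.<-≤-trans (ℕP.+-monoʳ-< (weight xa) (ℕP.≤-reflexive h)) bound) f⁺)) ⟩
  (X₀ + Y₀) + (X⁺ + Y⁺)
    ≡⟨ ring X₀ Y₀ X⁺ Y⁺ ⟩
  (X₀ + X⁺) + (Y₀ + Y⁺)
    ≡⟨ cong₂ _+_ (∑-Hˡ x a (θ yb) f) (∑-Hʳ y b (θ xa) f) ⟨
  ∑[ u ∈ θ xa ] ∑[ v ∈ θ yb ] Hˡ f u v + ∑[ u ∈ θ xa ] ∑[ v ∈ θ yb ] Hʳ f u v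
    ≡⟨ ∑∑-+ (θ xa) (θ yb) (Hˡ f) (Hʳ f) ⟨
  ∑[ u ∈ θ xa ] ∑[ v ∈ θ yb ] (Hˡ f u v + Hʳ f u v)
    -- Splitting a product by its leading letter takes two nonempty compositions, and these are the
    -- only ones occurring in `θ xa` and `θ yb`.
    ≡⟨ θ-cong-∷ x a (λ n u → θ-cong-∷ y b λ m v → ∑-ш*-∷ n u m v f) ⟨
  ∑[ u ∈ θ xa ] ∑[ v ∈ θ yb ] ∑ (u ш* v) f ∎
  where
  f⁺ f₀ pop fall : Comp → ℚ
  f⁺ = onRaised f
  f₀ = f ∘ (0 ∷_)
  pop [] = 0ℚ
  pop (z ∷ c) = ifZero z (∑ (θ c) f₀)
  fall c = ∑[ d ∈ low c ] ∑ (θ d) f⁺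
  rec : ∀ z c → ∑ (θ (z ∷ c)) f ≡ pop (z ∷ c) + fall (z ∷ c)
  rec z c = θ-rec z c f f⁺ f₀ (onRaised-rec f)
  X₀ = ifZero x (∑[ u ∈ θ a ] ∑[ v ∈ θ yb ] ∑ (u ш* v) f₀)
  Y₀ = ifZero y (∑[ u ∈ θ xa ] ∑[ v ∈ θ b ] ∑ (u ш* v) f₀)
  X⁺ = ∑[ a′ ∈ low xa ] ∑[ u ∈ θ a′ ] ∑[ v ∈ θ yb ] ∑ (u ш* v) f⁺
  Y⁺ = ∑[ b′ ∈ low yb ] ∑[ u ∈ θ xa ] ∑[ v ∈ θ b′ ] ∑ (u ш* v) f⁺
  ring : ∀ a b c d → (a + b) + (c + d) ≡ (a + c) + (b + d)
  ring = solve-∀ ℚ-ring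

θ-shuffle : ∀ a b (f : Comp → ℚ) →
  ∑[ c ∈ shuffle a b ] ∑ (θ c) f ≡ ∑[ u ∈ θ a ] ∑[ v ∈ θ b ] ∑ (u ш* v) f
θ-shuffle a b = θ-shuffle-below _ a b ℕP.≤-refl

-- The shuffle Hopf algebra

-- Both sides enumerate the shuffles of three words, sorted here by the word that supplies the first
-- letter.
shuffle-assoc : ∀ (a b c : List A) (f : List A → ℚ) →
  ∑[ d ∈ shuffle a b ] ∑ (shuffle d c) f ≡ ∑[ d ∈ shuffle b c ] ∑ (shuffle a d) f
shuffle-assoc [] b c f = trans (∑-basis b (λ d → ∑ (shuffle d c) f)) (∑-cong (shuffle b c) λ d → sym (∑-basis d f))
shuffle-assoc (x ∷ a) [] c f = trans (∑-basis (x ∷ a) (λ d → ∑ (shuffle d c) f)) (sym (∑-basis c (λ d → ∑ (shuffle (x ∷ a) d) f)))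
shuffle-assoc (x ∷ a) (y ∷ b) [] f = trans (∑-cong (shuffle (x ∷ a) (y ∷ b)) λ d → ∑-shuffle-[]ʳ d f)
  (sym (∑-basis (y ∷ b) (λ d → ∑ (shuffle (x ∷ a) d) f)))
shuffle-assoc (x ∷ a) (y ∷ b) (z ∷ c) f = begin
  ∑[ d ∈ shuffle xa yb ] ∑ (shuffle d zc) f
    ≡⟨ ∑-shuffle-∷ x a y b (λ d → ∑ (shuffle d zc) f) ⟩
  ∑[ d ∈ shuffle a yb ] ∑ (shuffle (x ∷ d) zc) f + ∑[ d ∈ shuffle xa b ] ∑ (shuffle (y ∷ d) zc) f
    ≡⟨ cong₂ _+_ (splitˡ (shuffle a yb) x) (splitˡ (shuffle xa b) y) ⟩
  (∑[ d ∈ shuffle a yb ] ∑ (shuffle d zc) fx + ∑[ d ∈ shuffle a yb ] ∑ (shuffle (x ∷ d) c) fz)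
    + (∑[ d ∈ shuffle xa b ] ∑ (shuffle d zc) fy + ∑[ d ∈ shuffle xa b ] ∑ (shuffle (y ∷ d) c) fz)
    ≡⟨ ring₁ (∑[ d ∈ shuffle a yb ] ∑ (shuffle d zc) fx) (∑[ d ∈ shuffle a yb ] ∑ (shuffle (x ∷ d) c) fz)
             (∑[ d ∈ shuffle xa b ] ∑ (shuffle d zc) fy) (∑[ d ∈ shuffle xa b ] ∑ (shuffle (y ∷ d) c) fz) ⟩
  ∑[ d ∈ shuffle a yb ] ∑ (shuffle d zc) fx + ∑[ d ∈ shuffle xa b ] ∑ (shuffle d zc) fy
    + (∑[ d ∈ shuffle a yb ] ∑ (shuffle (x ∷ d) c) fz + ∑[ d ∈ shuffle xa b ] ∑ (shuffle (y ∷ d) c) fz)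
    ≡⟨ cong₂ _+_ (cong₂ _+_ (shuffle-assoc a (y ∷ b) (z ∷ c) fx) (shuffle-assoc (x ∷ a) b (z ∷ c) fy))
         (trans (sym (∑-shuffle-∷ x a y b (λ d → ∑ (shuffle d c) fz))) (shuffle-assoc (x ∷ a) (y ∷ b) c fz)) ⟩
  ∑[ d ∈ shuffle yb zc ] ∑ (shuffle a d) fx + ∑[ d ∈ shuffle b zc ] ∑ (shuffle xa d) fy + ∑[ d ∈ shuffle yb c ] ∑ (shuffle xa d) fz
    ≡⟨ cong (λ s → s + ∑[ d ∈ shuffle b zc ] ∑ (shuffle xa d) fy + ∑[ d ∈ shuffle yb c ] ∑ (shuffle xa d) fz)
         (∑-shuffle-∷ y b z c (λ d → ∑ (shuffle a d) fx)) ⟩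
  (∑[ d ∈ shuffle b zc ] ∑ (shuffle a (y ∷ d)) fx + ∑[ d ∈ shuffle yb c ] ∑ (shuffle a (z ∷ d)) fx)
    + ∑[ d ∈ shuffle b zc ] ∑ (shuffle xa d) fy + ∑[ d ∈ shuffle yb c ] ∑ (shuffle xa d) fz
    ≡⟨ ring₂ (∑[ d ∈ shuffle b zc ] ∑ (shuffle a (y ∷ d)) fx) (∑[ d ∈ shuffle yb c ] ∑ (shuffle a (z ∷ d)) fx)
             (∑[ d ∈ shuffle b zc ] ∑ (shuffle xa d) fy) (∑[ d ∈ shuffle yb c ] ∑ (shuffle xa d) fz) ⟩
  (∑[ d ∈ shuffle b zc ] ∑ (shuffle a (y ∷ d)) fx + ∑[ d ∈ shuffle b zc ] ∑ (shuffle xa d) fy)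
    + (∑[ d ∈ shuffle yb c ] ∑ (shuffle a (z ∷ d)) fx + ∑[ d ∈ shuffle yb c ] ∑ (shuffle xa d) fz)
    ≡⟨ cong₂ _+_ (splitʳ (shuffle b zc) y) (splitʳ (shuffle yb c) z) ⟨
  ∑[ d ∈ shuffle b zc ] ∑ (shuffle xa (y ∷ d)) f + ∑[ d ∈ shuffle yb c ] ∑ (shuffle xa (z ∷ d)) f
    ≡⟨ ∑-shuffle-∷ y b z c (λ d → ∑ (shuffle xa d) f) ⟨
  ∑[ d ∈ shuffle yb zc ] ∑ (shuffle xa d) f ∎
  where
  xa = x ∷ a
  yb = y ∷ b
  zc = z ∷ c
  fx = f ∘ (x ∷_)
  fy = f ∘ (y ∷_)
  fz = f ∘ (z ∷_)
  splitˡ : ∀ u t → ∑[ d ∈ u ] ∑ (shuffle (t ∷ d) zc) f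
       ≡ ∑[ d ∈ u ] ∑[ e ∈ shuffle d zc ] f (t ∷ e) + ∑[ d ∈ u ] ∑ (shuffle (t ∷ d) c) fz
  splitˡ u t = trans (∑-cong u λ d → ∑-shuffle-∷ t d z c f) (∑-+ u (λ d → ∑[ e ∈ shuffle d zc ] f (t ∷ e)) (λ d → ∑ (shuffle (t ∷ d) c) fz))
  splitʳ : ∀ u t → ∑[ d ∈ u ] ∑ (shuffle xa (t ∷ d)) f
       ≡ ∑[ d ∈ u ] ∑ (shuffle a (t ∷ d)) fx + ∑[ d ∈ u ] ∑[ e ∈ shuffle xa d ] f (t ∷ e)
  splitʳ u t = trans (∑-cong u λ d → ∑-shuffle-∷ x a t d f) (∑-+ u (λ d → ∑ (shuffle a (t ∷ d)) fx) (λ d → ∑[ e ∈ shuffle xa d ] f (t ∷ e)))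
  ring₁ : ∀ a b c d → (a + b) + (c + d) ≡ a + c + (b + d)
  ring₁ = solve-∀ ℚ-ring
  ring₂ : ∀ a b c d → (a + b) + c + d ≡ (a + c) + (b + d)
  ring₂ = solve-∀ ℚ-ring

-- Deconcatenation

consˡ : A → List A × List A → List A × List A
consˡ x p = x ∷ proj₁ p , proj₂ p

dec : List A → FS (List A × List A)
dec [] = basis ([] , [])
dec (x ∷ w) = basis ([] , x ∷ w) ⊕ map (λ e → proj₁ e , consˡ x (proj₂ e)) (dec w)

∑-dec-∷ : ∀ (x : A) w (f : List A × List A → ℚ) → ∑ (dec (x ∷ w)) f ≡ f ([] , x ∷ w) + ∑[ p ∈ dec w ] f (consˡ x p)
∑-dec-∷ x w f = trans (∑-⊕ (basis ([] , x ∷ w)) (map (λ e → proj₁ e , consˡ x (proj₂ e)) (dec w)) f)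
  (cong₂ _+_ (∑-basis ([] , x ∷ w) f) (∑-map (consˡ x) (dec w) f))

∑-dec-[]ˡ : ∀ (w : List A) (f : List A × List A → ℚ) → (∀ x u v → f (x ∷ u , v) ≡ 0ℚ) → ∑ (dec w) f ≡ f ([] , w)
∑-dec-[]ˡ [] f f∷ = ∑-basis ([] , []) f
∑-dec-[]ˡ (x ∷ w) f f∷ = trans (∑-dec-∷ x w f) (trans (cong (_+_ (f ([] , x ∷ w)))
  (trans (∑-cong (dec w) λ p → f∷ x (proj₁ p) (proj₂ p)) (∑-0 (dec w)))) (ℚP.+-identityʳ _))

∑-dec-[]ʳ : ∀ (w : List A) (f : List A × List A → ℚ) → (∀ u x v → f (u , x ∷ v) ≡ 0ℚ) → ∑ (dec w) f ≡ f (w , [])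
∑-dec-[]ʳ [] f f∷ = ∑-basis ([] , []) f
∑-dec-[]ʳ (x ∷ w) f f∷ = trans (∑-dec-∷ x w f) (trans (cong₂ _+_ (f∷ [] x w)
  (∑-dec-[]ʳ w (f ∘ consˡ x) λ u → f∷ (x ∷ u))) (ℚP.+-identityˡ _))

dec-coassoc : ∀ (w : List A) (f : List A → List A → List A → ℚ) →
  ∑[ p ∈ dec w ] ∑[ q ∈ dec (proj₁ p) ] f (proj₁ q) (proj₂ q) (proj₂ p)
    ≡ ∑[ p ∈ dec w ] ∑[ q ∈ dec (proj₂ p) ] f (proj₁ p) (proj₁ q) (proj₂ q)
dec-coassoc [] f = refl
dec-coassoc (x ∷ w) f = begin
  ∑[ p ∈ dec (x ∷ w) ] ∑[ q ∈ dec (proj₁ p) ] f (proj₁ q) (proj₂ q) (proj₂ p)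
    ≡⟨ ∑-dec-∷ x w (λ p → ∑[ q ∈ dec (proj₁ p) ] f (proj₁ q) (proj₂ q) (proj₂ p)) ⟩
  ∑[ q ∈ dec [] ] f (proj₁ q) (proj₂ q) (x ∷ w) + ∑[ p ∈ dec w ] ∑[ q ∈ dec (x ∷ proj₁ p) ] f (proj₁ q) (proj₂ q) (proj₂ p)
    ≡⟨ cong₂ _+_ (∑-basis ([] , []) (λ q → f (proj₁ q) (proj₂ q) (x ∷ w)))
        (trans (∑-cong (dec w) λ p → ∑-dec-∷ x (proj₁ p) (λ q → f (proj₁ q) (proj₂ q) (proj₂ p)))
               (∑-+ (dec w) (λ p → f [] (x ∷ proj₁ p) (proj₂ p)) (λ p → ∑[ q ∈ dec (proj₁ p) ] f (x ∷ proj₁ q) (proj₂ q) (proj₂ p)))) ⟩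
  f [] [] (x ∷ w) + (∑[ p ∈ dec w ] f [] (x ∷ proj₁ p) (proj₂ p) + ∑[ p ∈ dec w ] ∑[ q ∈ dec (proj₁ p) ] f (x ∷ proj₁ q) (proj₂ q) (proj₂ p))
    ≡⟨ ℚP.+-assoc (f [] [] (x ∷ w)) _ _ ⟨
  f [] [] (x ∷ w) + ∑[ p ∈ dec w ] f [] (x ∷ proj₁ p) (proj₂ p) + ∑[ p ∈ dec w ] ∑[ q ∈ dec (proj₁ p) ] f (x ∷ proj₁ q) (proj₂ q) (proj₂ p)
    ≡⟨ cong₂ _+_ (sym (∑-dec-∷ x w (λ q → f [] (proj₁ q) (proj₂ q)))) (dec-coassoc w (f ∘ (x ∷_))) ⟩
  ∑[ q ∈ dec (x ∷ w) ] f [] (proj₁ q) (proj₂ q) + ∑[ p ∈ dec w ] ∑[ q ∈ dec (proj₂ p) ] f (x ∷ proj₁ p) (proj₁ q) (proj₂ q)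
    ≡⟨ ∑-dec-∷ x w (λ p → ∑[ q ∈ dec (proj₂ p) ] f (proj₁ p) (proj₁ q) (proj₂ q)) ⟨
  ∑[ p ∈ dec (x ∷ w) ] ∑[ q ∈ dec (proj₂ p) ] f (proj₁ p) (proj₁ q) (proj₂ q) ∎

shuffle₂ : List A × List A → List A × List A → FS (List A × List A)
shuffle₂ p q = shuffle (proj₁ p) (proj₁ q) ⊗ᵥ shuffle (proj₂ p) (proj₂ q)

-- Cutting a shuffle cuts both words, and the two sides of the cut are shuffles of the respective
-- pieces. The induction sorts by the first letter of the left piece, with the empty left piece
-- apart.
dec-shuffle : ∀ (a b : List A) (f : List A × List A → ℚ) →
  ∑[ c ∈ shuffle a b ] ∑ (dec c) f ≡ ∑[ p ∈ dec a ] ∑[ q ∈ dec b ] ∑ (shuffle₂ p q) f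
dec-shuffle [] b f = trans (∑-basis b (λ c → ∑ (dec c) f))
  (sym (trans (∑-basis ([] , []) (λ p → ∑[ q ∈ dec b ] ∑ (shuffle₂ p q) f))
     (∑-cong (dec b) λ q → trans (∑-⊗ (basis (proj₁ q)) (basis (proj₂ q)) f)
        (trans (∑-basis (proj₁ q) (λ u → ∑[ v ∈ basis (proj₂ q) ] f (u , v))) (∑-basis (proj₂ q) (λ v → f (proj₁ q , v)))))))
dec-shuffle a@(_ ∷ _) [] f = trans (∑-basis a (λ c → ∑ (dec c) f))
  (∑-cong (dec a) λ p → sym (trans (∑-basis ([] , []) (λ q → ∑ (shuffle₂ p q) f))
    (trans (∑-⊗ (shuffle (proj₁ p) []) (shuffle (proj₂ p) []) f)
      (trans (∑-shuffle-[]ʳ (proj₁ p) (λ u → ∑[ v ∈ shuffle (proj₂ p) [] ] f (u , v))) (∑-shuffle-[]ʳ (proj₂ p) (λ v → f (proj₁ p , v)))))))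
dec-shuffle {A = A} (x ∷ a) (y ∷ b) f = begin
  ∑[ c ∈ shuffle xa yb ] ∑ (dec c) f
    ≡⟨ ∑-shuffle-∷ x a y b (λ c → ∑ (dec c) f) ⟩
  ∑[ c ∈ shuffle a yb ] ∑ (dec (x ∷ c)) f + ∑[ c ∈ shuffle xa b ] ∑ (dec (y ∷ c)) f
    ≡⟨ cong₂ _+_ (peel x (shuffle a yb)) (peel y (shuffle xa b)) ⟩
  (∑[ c ∈ shuffle a yb ] f ([] , x ∷ c) + ∑[ c ∈ shuffle a yb ] ∑ (dec c) fx)
    + (∑[ c ∈ shuffle xa b ] f ([] , y ∷ c) + ∑[ c ∈ shuffle xa b ] ∑ (dec c) fy)
    ≡⟨ ring₁ (∑[ c ∈ shuffle a yb ] f ([] , x ∷ c)) (∑[ c ∈ shuffle a yb ] ∑ (dec c) fx)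
         (∑[ c ∈ shuffle xa b ] f ([] , y ∷ c)) (∑[ c ∈ shuffle xa b ] ∑ (dec c) fy) ⟩
  (∑[ c ∈ shuffle a yb ] f ([] , x ∷ c) + ∑[ c ∈ shuffle xa b ] f ([] , y ∷ c))
    + (∑[ c ∈ shuffle a yb ] ∑ (dec c) fx + ∑[ c ∈ shuffle xa b ] ∑ (dec c) fy)
    ≡⟨ cong₂ _+_ (sym (∑-shuffle-∷ x a y b (λ c → f ([] , c)))) (cong₂ _+_ (dec-shuffle a (y ∷ b) fx) (dec-shuffle (x ∷ a) b fy)) ⟩
  ∑[ c ∈ shuffle xa yb ] f ([] , c) + (∑[ p ∈ dec a ] ∑[ q ∈ dec yb ] G fx p q + ∑[ p ∈ dec xa ] ∑[ q ∈ dec b ] G fy p q)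
    ≡⟨ cong₂ (λ s t → ∑[ c ∈ shuffle xa yb ] f ([] , c) + (s + t))
         (trans (∑-cong (dec a) λ p → ∑-dec-∷ y b (G fx p)) (∑-+ (dec a) (λ p → G fx p ([] , yb)) (λ p → ∑[ q ∈ dec b ] G fx p (consˡ y q))))
         (∑-dec-∷ x a (λ p → ∑[ q ∈ dec b ] G fy p q)) ⟩
  M + ((P + ∑[ p ∈ dec a ] ∑[ q ∈ dec b ] G fx p (consˡ y q)) + (Q + ∑[ p ∈ dec a ] ∑[ q ∈ dec b ] G fy (consˡ x p) q))
    ≡⟨ ring₂ M P (∑[ p ∈ dec a ] ∑[ q ∈ dec b ] G fx p (consˡ y q)) Q (∑[ p ∈ dec a ] ∑[ q ∈ dec b ] G fy (consˡ x p) q) ⟩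
  (M + Q) + (P + (∑[ p ∈ dec a ] ∑[ q ∈ dec b ] G fx p (consˡ y q) + ∑[ p ∈ dec a ] ∑[ q ∈ dec b ] G fy (consˡ x p) q))
    ≡⟨ cong₂ (λ s t → s + (P + t))
         (cong₂ _+_ (sym (trans (∑-⊗ (basis []) (shuffle xa yb) f) (∑-basis [] (λ u → ∑[ v ∈ shuffle xa yb ] f (u , v)))))
                    (∑-cong (dec b) λ q → sym (G-[]ˡ q)))
         (trans (sym (∑∑-+ (dec a) (dec b) (λ p q → G fx p (consˡ y q)) (λ p q → G fy (consˡ x p) q)))
                (∑-cong (dec a) λ p → ∑-cong (dec b) λ q → sym (G-∷ p q))) ⟩
  (G f ([] , xa) ([] , yb) + ∑[ q ∈ dec b ] G f ([] , xa) (consˡ y q)) + (P + ∑[ p ∈ dec a ] ∑[ q ∈ dec b ] G f (consˡ x p) (consˡ y q))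
    ≡⟨ cong₂ _+_ (sym (∑-dec-∷ y b (G f ([] , xa))))
         (trans (cong (_+ ∑[ p ∈ dec a ] ∑[ q ∈ dec b ] G f (consˡ x p) (consˡ y q)) (∑-cong (dec a) λ p → sym (G-[]ʳ p)))
           (trans (sym (∑-+ (dec a) (λ p → G f (consˡ x p) ([] , yb)) (λ p → ∑[ q ∈ dec b ] G f (consˡ x p) (consˡ y q))))
             (∑-cong (dec a) λ p → sym (∑-dec-∷ y b (G f (consˡ x p)))))) ⟩
  ∑[ q ∈ dec yb ] G f ([] , xa) q + ∑[ p ∈ dec a ] ∑[ q ∈ dec yb ] G f (consˡ x p) q
    ≡⟨ ∑-dec-∷ x a (λ p → ∑[ q ∈ dec yb ] G f p q) ⟨
  ∑[ p ∈ dec xa ] ∑[ q ∈ dec yb ] G f p q ∎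
  where
  xa = x ∷ a
  yb = y ∷ b
  fx fy : List A × List A → ℚ
  fx = f ∘ consˡ x
  fy = f ∘ consˡ y
  G : (List A × List A → ℚ) → List A × List A → List A × List A → ℚ
  G f p q = ∑ (shuffle₂ p q) f
  M = ∑[ c ∈ shuffle xa yb ] f ([] , c)
  P = ∑[ p ∈ dec a ] G fx p ([] , yb)
  Q = ∑[ q ∈ dec b ] G fy ([] , xa) q
  peel : ∀ z u → ∑[ c ∈ u ] ∑ (dec (z ∷ c)) f ≡ ∑[ c ∈ u ] f ([] , z ∷ c) + ∑[ c ∈ u ] ∑ (dec c) (f ∘ consˡ z)
  peel z u = trans (∑-cong u λ c → ∑-dec-∷ z c f) (∑-+ u (λ c → f ([] , z ∷ c)) (λ c → ∑ (dec c) (f ∘ consˡ z)))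
  G-∷ : ∀ p q → G f (consˡ x p) (consˡ y q) ≡ G fx p (consˡ y q) + G fy (consˡ x p) q
  G-∷ p q = trans (∑-⊗ (shuffle (x ∷ proj₁ p) (y ∷ proj₁ q)) W f)
    (trans (∑-shuffle-∷ x (proj₁ p) y (proj₁ q) (λ u → ∑[ v ∈ W ] f (u , v)))
      (cong₂ _+_ (sym (∑-⊗ (shuffle (proj₁ p) (y ∷ proj₁ q)) W fx)) (sym (∑-⊗ (shuffle (x ∷ proj₁ p) (proj₁ q)) W fy))))
    where W = shuffle (proj₂ p) (proj₂ q)
  G-[]ˡ : ∀ q → G f ([] , xa) (consˡ y q) ≡ G fy ([] , xa) q
  G-[]ˡ q = trans (∑-⊗ (basis (y ∷ proj₁ q)) W f)
    (trans (∑-basis (y ∷ proj₁ q) (λ u → ∑[ v ∈ W ] f (u , v)))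
      (sym (trans (∑-⊗ (basis (proj₁ q)) W fy) (∑-basis (proj₁ q) (λ u → ∑[ v ∈ W ] fy (u , v))))))
    where W = shuffle xa (proj₂ q)
  G-[]ʳ : ∀ p → G f (consˡ x p) ([] , yb) ≡ G fx p ([] , yb)
  G-[]ʳ p = trans (∑-⊗ (basis (x ∷ proj₁ p)) W f)
    (trans (∑-basis (x ∷ proj₁ p) (λ u → ∑[ v ∈ W ] f (u , v)))
      (sym (trans (∑-⊗ (shuffle (proj₁ p) []) W fx) (∑-shuffle-[]ʳ (proj₁ p) (λ u → ∑[ v ∈ W ] fx (u , v))))))
    where W = shuffle (proj₂ p) yb
  ring₁ : ∀ a b c d → (a + b) + (c + d) ≡ (a + c) + (b + d)
  ring₁ = solve-∀ ℚ-ring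
  ring₂ : ∀ m p s q t → m + ((p + s) + (q + t)) ≡ (m + q) + (p + (s + t))
  ring₂ = solve-∀ ℚ-ring

-- The antipode of the shuffle Hopf algebra

sign : ℕ → ℚ
sign zero = 1ℚ
sign (suc n) = - sign n

-- Sign-reversing cancellation. The first letter of a shuffle is either the last letter of the
-- reversed piece or the first letter of the other piece, and moving it across the cut changes the
-- sign. What survives has an empty left piece and first letter `x`. The form with `ʳ++` lets each
-- moved letter join the accumulated prefix definitionally.
antipode-accˡ : ∀ (w : List A) x r (f : List A → ℚ) →
  ∑[ p ∈ dec w ] (sign (length (proj₁ p)) * ∑ (shuffle (proj₁ p ʳ++ (x ∷ r)) (proj₂ p)) f) ≡ ∑[ c ∈ shuffle r w ] f (x ∷ c)
antipode-accˡ [] x r f = trans (∑-basis ([] , []) (λ p → sign (length (proj₁ p)) * ∑ (shuffle (proj₁ p ʳ++ (x ∷ r)) (proj₂ p)) f))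
  (trans (ℚP.*-identityˡ _) (trans (∑-shuffle-[]ʳ (x ∷ r) f) (sym (∑-shuffle-[]ʳ r (f ∘ (x ∷_))))))
antipode-accˡ (y ∷ w) x r f = begin
  ∑ (dec (y ∷ w)) g
    ≡⟨ ∑-dec-∷ y w g ⟩
  1ℚ * ∑ (shuffle (x ∷ r) (y ∷ w)) f + ∑[ p ∈ dec w ] (- sign (length (proj₁ p)) * ∑ (shuffle (proj₁ p ʳ++ (y ∷ x ∷ r)) (proj₂ p)) f)
    ≡⟨ cong₂ _+_ (cong (1ℚ *_) (∑-shuffle-∷ x r y w f))
         (trans (∑-cong (dec w) λ p → negate (sign (length (proj₁ p))) (∑ (shuffle (proj₁ p ʳ++ (y ∷ x ∷ r)) (proj₂ p)) f))
           (trans (∑-* (dec w) (- 1ℚ) (λ p → sign (length (proj₁ p)) * ∑ (shuffle (proj₁ p ʳ++ (y ∷ x ∷ r)) (proj₂ p)) f))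
             (cong (- 1ℚ *_) (antipode-accˡ w y (x ∷ r) f)))) ⟩
  1ℚ * (S + T) + - 1ℚ * T
    ≡⟨ cancel S T ⟩
  S ∎
  where
  g : _ → ℚ
  g p = sign (length (proj₁ p)) * ∑ (shuffle (proj₁ p ʳ++ (x ∷ r)) (proj₂ p)) f
  S = ∑[ c ∈ shuffle r (y ∷ w) ] f (x ∷ c)
  T = ∑[ c ∈ shuffle (x ∷ r) w ] f (y ∷ c)
  negate : ∀ s t → - s * t ≡ - 1ℚ * (s * t)
  negate = solve-∀ ℚ-ring
  cancel : ∀ s t → 1ℚ * (s + t) + - 1ℚ * t ≡ s
  cancel = solve-∀ ℚ-ring

-- The recursion for `shuffle` read from the right end. When the right piece of a cut is reversed,
-- the letter next to the cut stands last in both words.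
∑-shuffle-∷ʳ : ∀ (a : List A) x b y (f : List A → ℚ) →
  ∑ (shuffle (a ∷ʳ x) (b ∷ʳ y)) f ≡ ∑[ c ∈ shuffle a (b ∷ʳ y) ] f (c ∷ʳ x) + ∑[ c ∈ shuffle (a ∷ʳ x) b ] f (c ∷ʳ y)
∑-shuffle-∷ʳ [] x [] y f = trans (∑-shuffle-∷ x [] y [] f) (trans (cong₂ _+_
  (trans (∑-basis (y ∷ []) (f ∘ (x ∷_))) (sym (∑-basis (x ∷ []) (f ∘ (_∷ʳ y)))))
  (trans (∑-basis (x ∷ []) (f ∘ (y ∷_))) (sym (∑-basis (y ∷ []) (f ∘ (_∷ʳ x))))))
  (ℚP.+-comm _ (∑[ c ∈ basis (y ∷ []) ] f (c ∷ʳ x))))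
∑-shuffle-∷ʳ [] x (z ∷ b) y f = begin
  ∑ (shuffle (x ∷ []) (z ∷ b ∷ʳ y)) f
    ≡⟨ ∑-shuffle-∷ x [] z (b ∷ʳ y) f ⟩
  ∑[ c ∈ basis (z ∷ b ∷ʳ y) ] f (x ∷ c) + ∑[ c ∈ shuffle (x ∷ []) (b ∷ʳ y) ] f (z ∷ c)
    ≡⟨ cong₂ _+_ (trans (∑-basis (z ∷ b ∷ʳ y) (f ∘ (x ∷_))) (sym (∑-basis (z ∷ b) (λ c → f (x ∷ c ∷ʳ y))))) (∑-shuffle-∷ʳ [] x b y (f ∘ (z ∷_))) ⟩
  P + (∑[ c ∈ basis (b ∷ʳ y) ] f (z ∷ c ∷ʳ x) + Q)
    ≡⟨ cong (λ s → P + (s + Q)) (trans (∑-basis (b ∷ʳ y) (λ c → f (z ∷ c ∷ʳ x))) (sym (∑-basis (z ∷ b ∷ʳ y) (λ c → f (c ∷ʳ x))))) ⟩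
  P + (R + Q)
    ≡⟨ ring P R Q ⟩
  R + (P + Q)
    ≡⟨ cong (_+_ R) (∑-shuffle-∷ x [] z b (λ c → f (c ∷ʳ y))) ⟨
  R + ∑[ c ∈ shuffle (x ∷ []) (z ∷ b) ] f (c ∷ʳ y) ∎
  where
  P = ∑[ c ∈ basis (z ∷ b) ] f (x ∷ c ∷ʳ y)
  Q = ∑[ c ∈ shuffle (x ∷ []) b ] f (z ∷ c ∷ʳ y)
  R = ∑[ c ∈ basis (z ∷ b ∷ʳ y) ] f (c ∷ʳ x)
  ring : ∀ p r q → p + (r + q) ≡ r + (p + q)
  ring = solve-∀ ℚ-ring
∑-shuffle-∷ʳ (z ∷ a) x [] y f = begin
  ∑ (shuffle (z ∷ a ∷ʳ x) (y ∷ [])) f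
    ≡⟨ ∑-shuffle-∷ z (a ∷ʳ x) y [] f ⟩
  ∑[ c ∈ shuffle (a ∷ʳ x) (y ∷ []) ] f (z ∷ c) + ∑[ c ∈ basis (z ∷ a ∷ʳ x) ] f (y ∷ c)
    ≡⟨ cong₂ _+_ (∑-shuffle-∷ʳ a x [] y (f ∘ (z ∷_))) (trans (∑-basis (z ∷ a ∷ʳ x) (f ∘ (y ∷_))) (sym (∑-basis (z ∷ a) (λ c → f (y ∷ c ∷ʳ x))))) ⟩
  (P + ∑[ c ∈ shuffle (a ∷ʳ x) [] ] f (z ∷ c ∷ʳ y)) + Q
    ≡⟨ cong (λ s → (P + s) + Q) (trans (∑-shuffle-[]ʳ (a ∷ʳ x) (λ c → f (z ∷ c ∷ʳ y))) (sym (∑-basis (z ∷ a ∷ʳ x) (λ c → f (c ∷ʳ y))))) ⟩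
  (P + R) + Q
    ≡⟨ ring P R Q ⟩
  (P + Q) + R
    ≡⟨ cong (_+ R) (∑-shuffle-∷ z a y [] (λ c → f (c ∷ʳ x))) ⟨
  ∑[ c ∈ shuffle (z ∷ a) (y ∷ []) ] f (c ∷ʳ x) + R ∎
  where
  P = ∑[ c ∈ shuffle a (y ∷ []) ] f (z ∷ c ∷ʳ x)
  Q = ∑[ c ∈ basis (z ∷ a) ] f (y ∷ c ∷ʳ x)
  R = ∑[ c ∈ basis (z ∷ a ∷ʳ x) ] f (c ∷ʳ y)
  ring : ∀ p r q → (p + r) + q ≡ (p + q) + r
  ring = solve-∀ ℚ-ring
∑-shuffle-∷ʳ (w ∷ a) x (z ∷ b) y f = begin
  ∑ (shuffle (w ∷ a ∷ʳ x) (z ∷ b ∷ʳ y)) f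
    ≡⟨ ∑-shuffle-∷ w (a ∷ʳ x) z (b ∷ʳ y) f ⟩
  ∑[ c ∈ shuffle (a ∷ʳ x) (z ∷ b ∷ʳ y) ] f (w ∷ c) + ∑[ c ∈ shuffle (w ∷ a ∷ʳ x) (b ∷ʳ y) ] f (z ∷ c)
    ≡⟨ cong₂ _+_ (∑-shuffle-∷ʳ a x (z ∷ b) y (f ∘ (w ∷_))) (∑-shuffle-∷ʳ (w ∷ a) x b y (f ∘ (z ∷_))) ⟩
  (P + Q) + (R + S)
    ≡⟨ ring P Q R S ⟩
  (P + R) + (Q + S)
    ≡⟨ cong₂ _+_ (∑-shuffle-∷ w a z (b ∷ʳ y) (λ c → f (c ∷ʳ x))) (∑-shuffle-∷ w (a ∷ʳ x) z b (λ c → f (c ∷ʳ y))) ⟨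
  ∑[ c ∈ shuffle (w ∷ a) (z ∷ b ∷ʳ y) ] f (c ∷ʳ x) + ∑[ c ∈ shuffle (w ∷ a ∷ʳ x) (z ∷ b) ] f (c ∷ʳ y) ∎
  where
  P = ∑[ c ∈ shuffle a (z ∷ b ∷ʳ y) ] f (w ∷ c ∷ʳ x)
  Q = ∑[ c ∈ shuffle (a ∷ʳ x) (z ∷ b) ] f (w ∷ c ∷ʳ y)
  R = ∑[ c ∈ shuffle (w ∷ a) (b ∷ʳ y) ] f (z ∷ c ∷ʳ x)
  S = ∑[ c ∈ shuffle (w ∷ a ∷ʳ x) b ] f (z ∷ c ∷ʳ y)
  ring : ∀ p q r s → (p + q) + (r + s) ≡ (p + r) + (q + s)
  ring = solve-∀ ℚ-ring

-- The same cancellation at the last letter: the surviving shuffles have `w` entirely in the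
-- reversed piece and end in `x`.
antipode-accʳ : ∀ (w c : List A) x (f : List A → ℚ) →
  ∑[ p ∈ dec w ] (sign (length (proj₂ p)) * ∑ (shuffle ((c ∷ʳ x) ++ proj₁ p) (reverse (proj₂ p))) f)
    ≡ sign (length w) * ∑[ d ∈ shuffle c (reverse w) ] f (d ∷ʳ x)
antipode-accʳ [] c x f = trans (∑-basis ([] , []) (λ p → sign (length (proj₂ p)) * ∑ (shuffle ((c ∷ʳ x) ++ proj₁ p) (reverse (proj₂ p))) f))
  (cong (1ℚ *_) (trans (∑-shuffle-[]ʳ ((c ∷ʳ x) ++ []) f) (trans (cong f (LP.++-identityʳ (c ∷ʳ x))) (sym (∑-shuffle-[]ʳ c (λ d → f (d ∷ʳ x)))))))
antipode-accʳ (y ∷ w) c x f = begin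
  ∑ (dec (y ∷ w)) (g c x)
    ≡⟨ ∑-dec-∷ y w (g c x) ⟩
  - s * ∑ (shuffle ((c ∷ʳ x) ++ []) (reverse (y ∷ w))) f + ∑[ p ∈ dec w ] g c x (consˡ y p)
    ≡⟨ cong₂ _+_ (cong₂ (λ u v → - s * ∑ (shuffle u v) f) (LP.++-identityʳ (c ∷ʳ x)) (LP.unfold-reverse y w))
         (trans (∑-cong (dec w) λ p → cong (λ u → sign (length (proj₂ p)) * ∑ (shuffle u (reverse (proj₂ p))) f)
             (sym (LP.++-assoc (c ∷ʳ x) (y ∷ []) (proj₁ p))))
                (antipode-accʳ w (c ∷ʳ x) y f)) ⟩
  - s * ∑ (shuffle (c ∷ʳ x) (reverse w ∷ʳ y)) f + s * T
    ≡⟨ cong (λ u → - s * u + s * T) (∑-shuffle-∷ʳ c x (reverse w) y f) ⟩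
  - s * (S + T) + s * T
    ≡⟨ cancel s S T ⟩
  - s * S
    ≡⟨ cong (λ u → - s * ∑[ d ∈ shuffle c u ] f (d ∷ʳ x)) (LP.unfold-reverse y w) ⟨
  - s * ∑[ d ∈ shuffle c (reverse (y ∷ w)) ] f (d ∷ʳ x) ∎
  where
  g : ∀ c x → _ → ℚ
  g c x p = sign (length (proj₂ p)) * ∑ (shuffle ((c ∷ʳ x) ++ proj₁ p) (reverse (proj₂ p))) f
  s = sign (length w)
  S = ∑[ d ∈ shuffle c (reverse w ∷ʳ y) ] f (d ∷ʳ x)
  T = ∑[ d ∈ shuffle (c ∷ʳ x) (reverse w) ] f (d ∷ʳ y)
  cancel : ∀ s S T → - s * (S + T) + s * T ≡ - s * S
  cancel = solve-∀ ℚ-ring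

ifEmpty : List A → ℚ
ifEmpty [] = 1ℚ
ifEmpty (_ ∷ _) = 0ℚ

-- For nonempty `w`, the cut with empty left piece contributes `w`. The remaining cuts add up to
-- minus `w` by `antipode-accˡ`, as `reverse (y ∷ p)` unfolds to `p ʳ++ (y ∷ [])`.
antipodeˡ : ∀ (w : List A) (f : List A → ℚ) →
  ∑[ p ∈ dec w ] (sign (length (proj₁ p)) * ∑ (shuffle (reverse (proj₁ p)) (proj₂ p)) f) ≡ ifEmpty w * f []
antipodeˡ [] f = trans (∑-basis ([] , []) (λ p → sign (length (proj₁ p)) * ∑ (shuffle (reverse (proj₁ p)) (proj₂ p)) f)) (cong (1ℚ *_) (∑-basis [] f))
antipodeˡ (y ∷ w) f = begin
  ∑ (dec (y ∷ w)) g
    ≡⟨ ∑-dec-∷ y w g ⟩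
  1ℚ * ∑ (basis (y ∷ w)) f + ∑[ p ∈ dec w ] (- sign (length (proj₁ p)) * ∑ (shuffle (proj₁ p ʳ++ (y ∷ [])) (proj₂ p)) f)
    ≡⟨ cong₂ _+_ (cong (1ℚ *_) (∑-basis (y ∷ w) f))
         (trans (∑-cong (dec w) λ p → negate (sign (length (proj₁ p))) (∑ (shuffle (proj₁ p ʳ++ (y ∷ [])) (proj₂ p)) f))
           (trans (∑-* (dec w) (- 1ℚ) (λ p → sign (length (proj₁ p)) * ∑ (shuffle (proj₁ p ʳ++ (y ∷ [])) (proj₂ p)) f))
             (cong (- 1ℚ *_) (trans (antipode-accˡ w y [] f) (∑-basis w (f ∘ (y ∷_))))))) ⟩
  1ℚ * f (y ∷ w) + - 1ℚ * f (y ∷ w)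
    ≡⟨ cancel (f (y ∷ w)) (f []) ⟩
  0ℚ * f [] ∎
  where
  g : _ → ℚ
  g p = sign (length (proj₁ p)) * ∑ (shuffle (reverse (proj₁ p)) (proj₂ p)) f
  negate : ∀ s t → - s * t ≡ - 1ℚ * (s * t)
  negate = solve-∀ ℚ-ring
  cancel : ∀ s t → 1ℚ * s + - 1ℚ * s ≡ 0ℚ * t
  cancel = solve-∀ ℚ-ring

antipodeʳ : ∀ (w : List A) (f : List A → ℚ) →
  ∑[ p ∈ dec w ] (sign (length (proj₂ p)) * ∑ (shuffle (proj₁ p) (reverse (proj₂ p))) f) ≡ ifEmpty w * f []
antipodeʳ [] f = trans (∑-basis ([] , []) (λ p → sign (length (proj₂ p)) * ∑ (shuffle (proj₁ p) (reverse (proj₂ p))) f)) (cong (1ℚ *_) (∑-basis [] f))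
antipodeʳ (y ∷ w) f = begin
  ∑ (dec (y ∷ w)) g
    ≡⟨ ∑-dec-∷ y w g ⟩
  - s * ∑ (basis (reverse (y ∷ w))) f + ∑[ p ∈ dec w ] g (consˡ y p)
    ≡⟨ cong₂ _+_ (cong (- s *_) (trans (∑-basis (reverse (y ∷ w)) f) (cong f (LP.unfold-reverse y w))))
         (trans (antipode-accʳ w [] y f) (cong (s *_) (∑-basis (reverse w) (λ d → f (d ∷ʳ y))))) ⟩
  - s * f (reverse w ∷ʳ y) + s * f (reverse w ∷ʳ y)
    ≡⟨ cancel s (f (reverse w ∷ʳ y)) (f []) ⟩
  0ℚ * f [] ∎
  where
  g : _ → ℚ
  g p = sign (length (proj₂ p)) * ∑ (shuffle (proj₁ p) (reverse (proj₂ p))) f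
  s = sign (length w)
  cancel : ∀ s x t → - s * x + s * x ≡ 0ℚ * t
  cancel = solve-∀ ℚ-ring

-- Chen fractions

glueᶜ : ℕ → ℕ → CF → ℕ × ℕ → CF
glueᶜ l l′ w p = (l , proj₁ p) ∷ (l′ , proj₂ p) ∷ w

spreadᶜ : ℕ → ℕ → CF → FS CF
spreadᶜ l a [] = basis ((l , a) ∷ [])
spreadᶜ l a ((l′ , n) ∷ w) = map (λ e → proj₁ e , glueᶜ l l′ w (proj₂ e)) (transvect 1ℚ a n)

-- `θ` with labels carried along: ∂ᵢ is addressed by label, and after a cut the labels still tell
-- which letter it acts on.
Θ : CF → FS CF
Θ [] = basis []
Θ ((l , a) ∷ as) = ext (spreadᶜ l a) (Θ as)

∑-spreadᶜ : ∀ l a l′ n w (f : CF → ℚ) → ∑ (spreadᶜ l a ((l′ , n) ∷ w)) f ≡ ∑[ p ∈ transvect 1ℚ a n ] f (glueᶜ l l′ w p)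
∑-spreadᶜ l a l′ n w f = ∑-map (glueᶜ l l′ w) (transvect 1ℚ a n) f

π-Θ : ∀ a (f : Comp → ℚ) → ∑[ u ∈ Θ a ] f (π u) ≡ ∑ (θ (π a)) f
π-Θ [] f = refl
π-Θ ((l , x) ∷ a) f = begin
  ∑[ u ∈ ext (spreadᶜ l x) (Θ a) ] f (π u)        ≡⟨ ∑-ext (spreadᶜ l x) (Θ a) (f ∘ π) ⟩
  ∑[ u ∈ Θ a ] ∑[ v ∈ spreadᶜ l x u ] f (π v)     ≡⟨ ∑-cong (Θ a) step ⟩
  ∑[ u ∈ Θ a ] ∑ (spread x (π u)) f               ≡⟨ π-Θ a (λ w → ∑ (spread x w) f) ⟩
  ∑[ w ∈ θ (π a) ] ∑ (spread x w) f               ≡⟨ ∑-ext (spread x) (θ (π a)) f ⟨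
  ∑ (θ (x ∷ π a)) f                               ∎
  where
  step : ∀ u → ∑[ v ∈ spreadᶜ l x u ] f (π v) ≡ ∑ (spread x (π u)) f
  step [] = trans (∑-basis ((l , x) ∷ []) (f ∘ π)) (sym (∑-basis (x ∷ []) f))
  step ((l′ , n) ∷ u) = trans (∑-spreadᶜ l x l′ n u (f ∘ π)) (sym (∑-spread x n (π u) f))

-- The constant term of G is the same in the u's and in the v's.
Θ-ones : ∀ I (f : CF → ℚ) → ∑ (Θ (ones I)) f ≡ f (ones I)
Θ-ones [] f = ∑-basis [] f
Θ-ones (i ∷ I) f = trans (∑-ext (spreadᶜ i 0) (Θ (ones I)) f) (trans (Θ-ones I (λ w → ∑ (spreadᶜ i 0 w) f)) (step I))
  where
  step : ∀ I → ∑ (spreadᶜ i 0 (ones I)) f ≡ f (ones (i ∷ I))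
  step [] = ∑-basis ((i , 0) ∷ []) f
  step (j ∷ J) = ∑-basis ((i , 0) ∷ (j , 0) ∷ ones J) f

total : (ℕ → ℚ) → CF → ℚ
total κ [] = 0ℚ
total κ ((l , _) ∷ w) = κ l + total κ w

-- The operator Σₗ κ(l) ∂ₗ, on Chen fractions (derivᵘ) and in the basis (eₐ) (derivᵛ).  Repeated labels
-- count with multiplicity, so derivᵘ and ∂ agree only on lists of distinct labels.
derivᵛ derivᵘ : (ℕ → ℚ) → CF → FS CF
derivᵛ κ [] = []
derivᵛ κ ((l , n) ∷ w) = (κ l * ℕtoℚ (suc n) , (l , suc n) ∷ w)
                       ∷ map (λ e → proj₁ e , (l , n) ∷ proj₂ e) (derivᵛ κ w)
derivᵘ κ [] = []
derivᵘ κ ((l , n) ∷ w) = (total κ ((l , n) ∷ w) * ℕtoℚ (suc n) , (l , suc n) ∷ w)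
                       ∷ map (λ e → proj₁ e , (l , n) ∷ proj₂ e) (derivᵘ κ w)

∑-derivᵛ : ∀ κ l n w (f : CF → ℚ) → ∑ (derivᵛ κ ((l , n) ∷ w)) f
  ≡ κ l * ℕtoℚ (suc n) * f ((l , suc n) ∷ w) + ∑[ v ∈ derivᵛ κ w ] f ((l , n) ∷ v)
∑-derivᵛ κ l n w f = cong (_+_ (κ l * ℕtoℚ (suc n) * f ((l , suc n) ∷ w))) (∑-map ((l , n) ∷_) (derivᵛ κ w) f)

∑-derivᵘ : ∀ κ l n w (f : CF → ℚ) → ∑ (derivᵘ κ ((l , n) ∷ w)) f
  ≡ (κ l + total κ w) * ℕtoℚ (suc n) * f ((l , suc n) ∷ w) + ∑[ v ∈ derivᵘ κ w ] f ((l , n) ∷ v)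
∑-derivᵘ κ l n w f = cong (_+_ ((κ l + total κ w) * ℕtoℚ (suc n) * f ((l , suc n) ∷ w))) (∑-map ((l , n) ∷_) (derivᵘ κ w) f)

-- The chain rule ∂/∂vⱼ = ∂/∂u₁ + ⋯ + ∂/∂uⱼ. The label in position j thus contributes to every entry
-- up to position j, so the coefficient at an entry of `derivᵘ` is the total over the suffix
-- starting there.
Θ-deriv : ∀ κ a (f : CF → ℚ) → ∑[ b ∈ derivᵛ κ a ] ∑ (Θ b) f ≡ ∑[ u ∈ Θ a ] ∑ (derivᵘ κ u) f
Θ-deriv κ [] f = sym (∑-basis [] (λ u → ∑ (derivᵘ κ u) f))
Θ-deriv κ ((l , x) ∷ a) f = begin
  ∑[ b ∈ derivᵛ κ ((l , x) ∷ a) ] ∑ (Θ b) f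
    ≡⟨ ∑-derivᵛ κ l x a (λ b → ∑ (Θ b) f) ⟩
  κ l * ℕtoℚ (suc x) * ∑ (Θ ((l , suc x) ∷ a)) f + ∑[ b ∈ derivᵛ κ a ] ∑ (Θ ((l , x) ∷ b)) f
    ≡⟨ cong₂ (λ s t → κ l * ℕtoℚ (suc x) * s + t) (∑-ext (spreadᶜ l (suc x)) (Θ a) f)
         (trans (∑-cong (derivᵛ κ a) λ b → ∑-ext (spreadᶜ l x) (Θ b) f) (Θ-deriv κ a (λ u → ∑ (spreadᶜ l x u) f))) ⟩
  κ l * ℕtoℚ (suc x) * ∑[ u ∈ Θ a ] ∑ (spreadᶜ l (suc x) u) f + ∑[ u ∈ Θ a ] ∑[ v ∈ derivᵘ κ u ] ∑ (spreadᶜ l x v) f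
    ≡⟨ cong (_+ ∑[ u ∈ Θ a ] ∑[ v ∈ derivᵘ κ u ] ∑ (spreadᶜ l x v) f) (∑-* (Θ a) (κ l * ℕtoℚ (suc x)) (λ u → ∑ (spreadᶜ l (suc x) u) f)) ⟨
  ∑[ u ∈ Θ a ] (κ l * ℕtoℚ (suc x) * ∑ (spreadᶜ l (suc x) u) f) + ∑[ u ∈ Θ a ] ∑[ v ∈ derivᵘ κ u ] ∑ (spreadᶜ l x v) f
    ≡⟨ ∑-+ (Θ a) (λ u → κ l * ℕtoℚ (suc x) * ∑ (spreadᶜ l (suc x) u) f) (λ u → ∑[ v ∈ derivᵘ κ u ] ∑ (spreadᶜ l x v) f) ⟨
  ∑[ u ∈ Θ a ] (κ l * ℕtoℚ (suc x) * ∑ (spreadᶜ l (suc x) u) f + ∑[ v ∈ derivᵘ κ u ] ∑ (spreadᶜ l x v) f)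
    ≡⟨ ∑-cong (Θ a) step ⟨
  ∑[ u ∈ Θ a ] ∑[ v ∈ spreadᶜ l x u ] ∑ (derivᵘ κ v) f
    ≡⟨ ∑-ext (spreadᶜ l x) (Θ a) (λ v → ∑ (derivᵘ κ v) f) ⟨
  ∑[ u ∈ Θ ((l , x) ∷ a) ] ∑ (derivᵘ κ u) f ∎
  where
  step : ∀ w → ∑[ v ∈ spreadᶜ l x w ] ∑ (derivᵘ κ v) f
             ≡ κ l * ℕtoℚ (suc x) * ∑ (spreadᶜ l (suc x) w) f + ∑[ v ∈ derivᵘ κ w ] ∑ (spreadᶜ l x v) f
  step [] = trans (∑-basis ((l , x) ∷ []) (λ v → ∑ (derivᵘ κ v) f))
    (trans (ring (κ l) (ℕtoℚ (suc x)) (f ((l , suc x) ∷ [])))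
           (cong (λ s → κ l * ℕtoℚ (suc x) * s + 0ℚ) (sym (∑-basis ((l , suc x) ∷ []) f))))
    where
    ring : ∀ k n y → (k + 0ℚ) * n * y + 0ℚ ≡ k * n * y + 0ℚ
    ring = solve-∀ ℚ-ring
  step ((l′ , n) ∷ w) = begin
    ∑[ v ∈ spreadᶜ l x ((l′ , n) ∷ w) ] ∑ (derivᵘ κ v) f
      ≡⟨ ∑-spreadᶜ l x l′ n w (λ v → ∑ (derivᵘ κ v) f) ⟩
    ∑[ p ∈ T ] ∑ (derivᵘ κ (glueᶜ l l′ w p)) f
      ≡⟨ ∑-cong T (λ p → trans (∑-derivᵘ κ l (proj₁ p) ((l′ , proj₂ p) ∷ w) f)
           (trans (cong (_+_ ((κ l + L) * ℕtoℚ (suc (proj₁ p)) * g (suc (proj₁ p) , proj₂ p)))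
                    (∑-derivᵘ κ l′ (proj₂ p) w (λ v → f ((l , proj₁ p) ∷ v))))
             (ring₁ (κ l + L) (ℕtoℚ (suc (proj₁ p))) (g (suc (proj₁ p) , proj₂ p)) L (ℕtoℚ (suc (proj₂ p))) (g (proj₁ p , suc (proj₂ p))) (h p)))) ⟩
    ∑[ p ∈ T ] ((κ l + L) * r₁ p + (L * r₂ p + h p))
      ≡⟨ trans (∑-+ T (λ p → (κ l + L) * r₁ p) (λ p → L * r₂ p + h p))
           (cong₂ _+_ (∑-* T (κ l + L) r₁) (trans (∑-+ T (λ p → L * r₂ p) h) (cong (_+ ∑ T h) (∑-* T L r₂)))) ⟩
    (κ l + L) * ∑ T r₁ + (L * ∑ T r₂ + ∑ T h)
      ≡⟨ cong (λ s → (κ l + L) * s + (L * ∑ T r₂ + ∑ T h)) (transvect-raise₁ 1ℚ x n g) ⟩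
    (κ l + L) * X + (L * ∑ T r₂ + ∑ T h)
      -- Regrouped so that the weighted raising of the second entry meets one copy of `X`; by
      -- `transvect-raise₂` with t = 1 the two together are the derivative in the second variable.
      ≡⟨ ring₂ (κ l) L X (∑ T r₂) (∑ T h) ⟩
    κ l * X + (L * (∑ T r₂ + 1ℚ * X) + ∑ T h)
      ≡⟨ cong (λ s → κ l * X + (L * s + ∑ T h)) (transvect-raise₂ 1ℚ x n g) ⟩
    κ l * (ℕtoℚ (suc x) * ∑ (transvect 1ℚ (suc x) n) g) + (L * (ℕtoℚ (suc n) * ∑ (transvect 1ℚ x (suc n)) g) + ∑ T h)
      ≡⟨ cong₂ _+_ (sym (ℚP.*-assoc (κ l) (ℕtoℚ (suc x)) (∑ (transvect 1ℚ (suc x) n) g)))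
          (cong₂ _+_ (sym (ℚP.*-assoc L (ℕtoℚ (suc n)) (∑ (transvect 1ℚ x (suc n)) g))) (∑-swap T (derivᵘ κ w) (λ p v → f (glueᶜ l l′ v p)))) ⟩
    κ l * ℕtoℚ (suc x) * ∑ (transvect 1ℚ (suc x) n) g
      + (L * ℕtoℚ (suc n) * ∑ (transvect 1ℚ x (suc n)) g + ∑[ v ∈ derivᵘ κ w ] ∑[ p ∈ T ] f (glueᶜ l l′ v p))
      ≡⟨ cong₂ _+_ (cong (κ l * ℕtoℚ (suc x) *_) (∑-spreadᶜ l (suc x) l′ n w f))
           (cong₂ _+_ (cong (L * ℕtoℚ (suc n) *_) (∑-spreadᶜ l x l′ (suc n) w f)) (∑-cong (derivᵘ κ w) λ v → ∑-spreadᶜ l x l′ n v f)) ⟨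
    κ l * ℕtoℚ (suc x) * ∑ (spreadᶜ l (suc x) ((l′ , n) ∷ w)) f
      + (L * ℕtoℚ (suc n) * ∑ (spreadᶜ l x ((l′ , suc n) ∷ w)) f + ∑[ v ∈ derivᵘ κ w ] ∑ (spreadᶜ l x ((l′ , n) ∷ v)) f)
      ≡⟨ cong (_+_ (κ l * ℕtoℚ (suc x) * ∑ (spreadᶜ l (suc x) ((l′ , n) ∷ w)) f)) (∑-derivᵘ κ l′ n w (λ v → ∑ (spreadᶜ l x v) f)) ⟨
    κ l * ℕtoℚ (suc x) * ∑ (spreadᶜ l (suc x) ((l′ , n) ∷ w)) f + ∑[ v ∈ derivᵘ κ ((l′ , n) ∷ w) ] ∑ (spreadᶜ l x v) f ∎
    where
    T = transvect 1ℚ x n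
    L = κ l′ + total κ w
    g h r₁ r₂ : ℕ × ℕ → ℚ
    g p = f (glueᶜ l l′ w p)
    h p = ∑[ v ∈ derivᵘ κ w ] f (glueᶜ l l′ v p)
    r₁ p = ℕtoℚ (suc (proj₁ p)) * g (suc (proj₁ p) , proj₂ p)
    r₂ p = ℕtoℚ (suc (proj₂ p)) * g (proj₁ p , suc (proj₂ p))
    X = ℕtoℚ (suc x) * ∑ (transvect 1ℚ (suc x) n) g
    ring₁ : ∀ K m a L n b h → K * m * a + (L * n * b + h) ≡ K * (m * a) + (L * (n * b) + h)
    ring₁ = solve-∀ ℚ-ring
    ring₂ : ∀ k L X R h → (k + L) * X + (L * R + h) ≡ k * X + (L * (R + 1ℚ * X) + h)
    ring₂ = solve-∀ ℚ-ring

-- The Leibniz rule for the coproduct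

leibniz : (CF → FS CF) → CF × CF → FS (CF × CF)
leibniz D p = (basis (proj₁ p) ⊗ᵥ D (proj₂ p)) ⊕ (D (proj₁ p) ⊗ᵥ basis (proj₂ p))

∑-leibniz : ∀ D p (f : CF × CF → ℚ) →
  ∑ (leibniz D p) f ≡ ∑[ v ∈ D (proj₂ p) ] f (proj₁ p , v) + ∑[ u ∈ D (proj₁ p) ] f (u , proj₂ p)
∑-leibniz D p f = trans (∑-⊕ (basis (proj₁ p) ⊗ᵥ D (proj₂ p)) (D (proj₁ p) ⊗ᵥ basis (proj₂ p)) f)
  (cong₂ _+_ (trans (∑-⊗ (basis (proj₁ p)) (D (proj₂ p)) f) (∑-basis (proj₁ p) (λ u → ∑[ v ∈ D (proj₂ p) ] f (u , v))))
             (trans (∑-⊗ (D (proj₁ p)) (basis (proj₂ p)) f) (∑-cong (D (proj₁ p)) λ u → ∑-basis (proj₂ p) (λ v → f (u , v)))))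

-- `derivᵛ` raises one letter with a coefficient depending on that letter alone, so it commutes with
-- cutting elsewhere. The coefficients of `derivᵘ`, by contrast, involve all later labels.
dec-deriv : ∀ κ a (f : CF × CF → ℚ) →
  ∑[ b ∈ derivᵛ κ a ] ∑ (dec b) f ≡ ∑[ p ∈ dec a ] ∑ (leibniz (derivᵛ κ) p) f
dec-deriv κ [] f = sym (trans (∑-basis ([] , []) (λ p → ∑ (leibniz (derivᵛ κ) p) f)) (∑-leibniz (derivᵛ κ) ([] , []) f))
dec-deriv κ ((l , n) ∷ w) f = begin
  ∑[ b ∈ derivᵛ κ ((l , n) ∷ w) ] ∑ (dec b) f
    ≡⟨ ∑-derivᵛ κ l n w (λ b → ∑ (dec b) f) ⟩
  k * ∑ (dec ((l , suc n) ∷ w)) f + ∑[ b ∈ derivᵛ κ w ] ∑ (dec ((l , n) ∷ b)) f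
    ≡⟨ cong₂ (λ s t → k * s + t) (∑-dec-∷ (l , suc n) w f)
         (trans (∑-cong (derivᵛ κ w) λ b → ∑-dec-∷ (l , n) b f)
           (trans (∑-+ (derivᵛ κ w) (λ b → f ([] , (l , n) ∷ b)) (λ b → ∑ (dec b) g))
             (cong (_+_ R) (dec-deriv κ w g)))) ⟩
  k * (P + Q) + (R + ∑[ p ∈ dec w ] ∑ (leibniz (derivᵛ κ) p) g)
    ≡⟨ ring k P Q R _ ⟩
  (k * P + R) + (k * Q + ∑[ p ∈ dec w ] ∑ (leibniz (derivᵛ κ) p) g)
    ≡⟨ cong (λ s → (k * P + R) + (s + ∑[ p ∈ dec w ] ∑ (leibniz (derivᵛ κ) p) g)) (∑-* (dec w) k (λ p → f (consˡ (l , suc n) p))) ⟨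
  (k * P + R) + (∑[ p ∈ dec w ] (k * f (consˡ (l , suc n) p)) + ∑[ p ∈ dec w ] ∑ (leibniz (derivᵛ κ) p) g)
    ≡⟨ cong₂ _+_ base (trans (sym (∑-+ (dec w) (λ p → k * f (consˡ (l , suc n) p)) (λ p → ∑ (leibniz (derivᵛ κ) p) g))) (∑-cong (dec w) step)) ⟩
  ∑ (leibniz (derivᵛ κ) ([] , (l , n) ∷ w)) f + ∑[ p ∈ dec w ] ∑ (leibniz (derivᵛ κ) (consˡ (l , n) p)) f
    ≡⟨ ∑-dec-∷ (l , n) w (λ p → ∑ (leibniz (derivᵛ κ) p) f) ⟨
  ∑[ p ∈ dec ((l , n) ∷ w) ] ∑ (leibniz (derivᵛ κ) p) f ∎
  where
  k = κ l * ℕtoℚ (suc n)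
  g : CF × CF → ℚ
  g = f ∘ consˡ (l , n)
  P = f ([] , (l , suc n) ∷ w)
  Q = ∑[ p ∈ dec w ] f (consˡ (l , suc n) p)
  R = ∑[ b ∈ derivᵛ κ w ] f ([] , (l , n) ∷ b)
  base : k * P + R ≡ ∑ (leibniz (derivᵛ κ) ([] , (l , n) ∷ w)) f
  base = sym (trans (∑-leibniz (derivᵛ κ) ([] , (l , n) ∷ w) f) (trans (ℚP.+-identityʳ _) (∑-derivᵛ κ l n w (λ v → f ([] , v)))))
  step : ∀ p → k * f (consˡ (l , suc n) p) + ∑ (leibniz (derivᵛ κ) p) g ≡ ∑ (leibniz (derivᵛ κ) (consˡ (l , n) p)) f
  step p = begin
    k * f (consˡ (l , suc n) p) + ∑ (leibniz (derivᵛ κ) p) g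
      ≡⟨ cong (_+_ (k * f (consˡ (l , suc n) p))) (∑-leibniz (derivᵛ κ) p g) ⟩
    k * f (consˡ (l , suc n) p) + (U + V)
      ≡⟨ ring′ (k * f (consˡ (l , suc n) p)) U V ⟩
    U + (k * f (consˡ (l , suc n) p) + V)
      ≡⟨ cong (_+_ U) (∑-derivᵛ κ l n (proj₁ p) (λ u → f (u , proj₂ p))) ⟨
    U + ∑[ u ∈ derivᵛ κ ((l , n) ∷ proj₁ p) ] f (u , proj₂ p)
      ≡⟨ ∑-leibniz (derivᵛ κ) (consˡ (l , n) p) f ⟨
    ∑ (leibniz (derivᵛ κ) (consˡ (l , n) p)) f ∎
    where
    U = ∑[ v ∈ derivᵛ κ (proj₂ p) ] g (proj₁ p , v)
    V = ∑[ u ∈ derivᵛ κ (proj₁ p) ] g (u , proj₂ p)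
    ring′ : ∀ a b c → a + (b + c) ≡ b + (a + c)
    ring′ = solve-∀ ℚ-ring
  ring : ∀ k P Q R S → k * (P + Q) + (R + S) ≡ (k * P + R) + (k * Q + S)
  ring = solve-∀ ℚ-ring

coproductᶜ : CF → FS (CF × CF)
coproductᶜ a = ext (λ p → Θ (proj₁ p) ⊗ᵥ Θ (proj₂ p)) (dec a)

∑-coproductᶜ : ∀ a (f : CF × CF → ℚ) →
  ∑ (coproductᶜ a) f ≡ ∑[ p ∈ dec a ] ∑[ u ∈ Θ (proj₁ p) ] ∑[ v ∈ Θ (proj₂ p) ] f (u , v)
∑-coproductᶜ a f = trans (∑-ext (λ p → Θ (proj₁ p) ⊗ᵥ Θ (proj₂ p)) (dec a) f)
  (∑-cong (dec a) λ p → ∑-⊗ (Θ (proj₁ p)) (Θ (proj₂ p)) f)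

-- Carries `dec-deriv` through Θ ⊗ Θ. The result is the Leibniz rule by which the recursion
-- determines Δᶜʰ.
coproductᶜ-deriv : ∀ κ a (f : CF × CF → ℚ) →
  ∑[ b ∈ derivᵛ κ a ] ∑ (coproductᶜ b) f ≡ ∑[ t ∈ coproductᶜ a ] ∑ (leibniz (derivᵘ κ) t) f
coproductᶜ-deriv κ a f = begin
  ∑[ b ∈ derivᵛ κ a ] ∑ (coproductᶜ b) f
    ≡⟨ ∑-cong (derivᵛ κ a) (λ b → ∑-coproductᶜ b f) ⟩
  ∑[ b ∈ derivᵛ κ a ] ∑ (dec b) ΘΘ
    ≡⟨ dec-deriv κ a ΘΘ ⟩
  ∑[ p ∈ dec a ] ∑ (leibniz (derivᵛ κ) p) ΘΘ
    ≡⟨ ∑-cong (dec a) step ⟩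
  ∑[ p ∈ dec a ] ∑[ u ∈ Θ (proj₁ p) ] ∑[ v ∈ Θ (proj₂ p) ] ∑ (leibniz (derivᵘ κ) (u , v)) f
    ≡⟨ ∑-coproductᶜ a (λ t → ∑ (leibniz (derivᵘ κ) t) f) ⟨
  ∑[ t ∈ coproductᶜ a ] ∑ (leibniz (derivᵘ κ) t) f ∎
  where
  ΘΘ : CF × CF → ℚ
  ΘΘ p = ∑[ u ∈ Θ (proj₁ p) ] ∑[ v ∈ Θ (proj₂ p) ] f (u , v)
  step : ∀ p → ∑ (leibniz (derivᵛ κ) p) ΘΘ ≡ ∑[ u ∈ Θ (proj₁ p) ] ∑[ v ∈ Θ (proj₂ p) ] ∑ (leibniz (derivᵘ κ) (u , v)) f
  step (p , q) = begin
    ∑ (leibniz (derivᵛ κ) (p , q)) ΘΘ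
      ≡⟨ ∑-leibniz (derivᵛ κ) (p , q) ΘΘ ⟩
    ∑[ q′ ∈ derivᵛ κ q ] ∑[ u ∈ Θ p ] ∑[ v ∈ Θ q′ ] f (u , v) + ∑[ p′ ∈ derivᵛ κ p ] ∑[ u ∈ Θ p′ ] ∑[ v ∈ Θ q ] f (u , v)
      ≡⟨ cong₂ _+_
           (trans (∑-swap (derivᵛ κ q) (Θ p) (λ q′ u → ∑[ v ∈ Θ q′ ] f (u , v)))
                  (∑-cong (Θ p) λ u → Θ-deriv κ q (λ v → f (u , v))))
           (trans (Θ-deriv κ p (λ u → ∑[ v ∈ Θ q ] f (u , v)))
                  (∑-cong (Θ p) λ u → ∑-swap (derivᵘ κ u) (Θ q) (λ u′ v → f (u′ , v)))) ⟩
    ∑[ u ∈ Θ p ] ∑[ v ∈ Θ q ] ∑[ v′ ∈ derivᵘ κ v ] f (u , v′) + ∑[ u ∈ Θ p ] ∑[ v ∈ Θ q ] ∑[ u′ ∈ derivᵘ κ u ] f (u′ , v)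
      ≡⟨ ∑∑-+ (Θ p) (Θ q) (λ u v → ∑[ v′ ∈ derivᵘ κ v ] f (u , v′)) (λ u v → ∑[ u′ ∈ derivᵘ κ u ] f (u′ , v)) ⟨
    ∑[ u ∈ Θ p ] ∑[ v ∈ Θ q ] (∑[ v′ ∈ derivᵘ κ v ] f (u , v′) + ∑[ u′ ∈ derivᵘ κ u ] f (u′ , v))
      ≡⟨ ∑-cong (Θ p) (λ u → ∑-cong (Θ q) λ v → ∑-leibniz (derivᵘ κ) (u , v) f) ⟨
    ∑[ u ∈ Θ p ] ∑[ v ∈ Θ q ] ∑ (leibniz (derivᵘ κ) (u , v)) f ∎

-- Supports, and ∂ on fractions with distinct labels

Supported : (A → Set) → FS A → Set
Supported P = All (P ∘ proj₂)

supported-· : ∀ {P : A → Set} k {u} → Supported P u → Supported P (k · u)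
supported-· k ps = AllP.map⁺ (All.map (λ p → p) ps)

supported-ext : ∀ {P : A → Set} {Q : B → Set} (g : A → FS B) {u} →
  Supported P u → (∀ a → P a → Supported Q (g a)) → Supported Q (ext g u)
supported-ext g [] h = []
supported-ext g {(c , a) ∷ u} (p ∷ ps) h = AllP.++⁺ (supported-· c (h a p)) (supported-ext g ps h)

supported-⊗ : ∀ {P : A → Set} {Q : B → Set} {u v} →
  Supported P u → Supported Q v → Supported (λ p → P (proj₁ p) × Q (proj₂ p)) (u ⊗ᵥ v)
supported-⊗ ps qs = supported-ext _ ps λ a p → supported-ext _ qs λ b q → (p , q) ∷ []

labels : CF → List ℕ
labels = map proj₁

δ : ℕ → ℕ → ℚ
δ i l = if does (l ℕ.≟ i) then 1ℚ else 0ℚ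

δ-diff : ℕ → ℕ → ℕ → ℚ
δ-diff j i l = δ j l + - 1ℚ * δ i l

δ-≡ : ∀ i → δ i i ≡ 1ℚ
δ-≡ i rewrite dec-true (i ℕ.≟ i) refl = refl

δ-≢ : ∀ {i l} → l ≢ i → δ i l ≡ 0ℚ
δ-≢ {i} {l} l≢i rewrite dec-false (l ℕ.≟ i) l≢i = refl

total-vanish : ∀ {κ w} → All (λ l → κ l ≡ 0ℚ) (labels w) → total κ w ≡ 0ℚ
total-vanish {w = []} [] = refl
total-vanish {w = _ ∷ w} (z ∷ zs) = cong₂ _+_ z (total-vanish zs)

-- The left side counts occurrences of `i`, the right side only detects one; distinct labels make
-- the count at most 1.
total-δ : ∀ i w → Unique (labels w) → total (δ i) w ≡ (if occurs i w then 1ℚ else 0ℚ)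
total-δ i [] _ = refl
total-δ i ((l , n) ∷ w) (l∉w ∷ unique) with l ℕ.≟ i
... | yes refl rewrite dec-true (l ℕ.≟ l) refl =
    trans (cong (_+_ 1ℚ) (total-vanish {δ l} {w} (All.map (λ l≢m → δ-≢ (l≢m ∘ sym)) l∉w)))
    (ℚP.+-identityʳ 1ℚ)
... | no l≢i rewrite dec-false (l ℕ.≟ i) l≢i = trans (ℚP.+-identityˡ _) (total-δ i w unique)

∂-derivᵘ : ∀ i w → Unique (labels w) → ∀ (f : CF → ℚ) → ∑ (∂ i w) f ≡ ∑ (derivᵘ (δ i) w) f
∂-derivᵘ i [] _ f = refl
∂-derivᵘ i ((l , n) ∷ w) uniq@(_ ∷ uniq′) f = begin
  ∑ (∂ i ((l , n) ∷ w)) f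
    ≡⟨ ∑-⊕ raisedHead (map (λ q → proj₁ q , (l , n) ∷ proj₂ q) (∂ i w)) f ⟩
  ∑ raisedHead f + ∑ (map (λ q → proj₁ q , (l , n) ∷ proj₂ q) (∂ i w)) f
    ≡⟨ cong₂ _+_ (head (occurs i ((l , n) ∷ w)))
         (trans (∑-map ((l , n) ∷_) (∂ i w) f) (∂-derivᵘ i w uniq′ (λ v → f ((l , n) ∷ v)))) ⟩
  (if occurs i ((l , n) ∷ w) then 1ℚ else 0ℚ) * ℕtoℚ (suc n) * f ((l , suc n) ∷ w) + ∑[ v ∈ derivᵘ (δ i) w ] f ((l , n) ∷ v)
    ≡⟨ cong (λ t → t * ℕtoℚ (suc n) * f ((l , suc n) ∷ w) + ∑[ v ∈ derivᵘ (δ i) w ] f ((l , n) ∷ v)) (total-δ i ((l , n) ∷ w) uniq) ⟨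
  total (δ i) ((l , n) ∷ w) * ℕtoℚ (suc n) * f ((l , suc n) ∷ w) + ∑[ v ∈ derivᵘ (δ i) w ] f ((l , n) ∷ v)
    ≡⟨ ∑-derivᵘ (δ i) l n w f ⟨
  ∑ (derivᵘ (δ i) ((l , n) ∷ w)) f ∎
  where
  raisedHead : FS CF
  raisedHead = if occurs i ((l , n) ∷ w) then (ℕtoℚ (suc n) , (l , suc n) ∷ w) ∷ [] else []
  head : ∀ b → ∑ (if b then (ℕtoℚ (suc n) , (l , suc n) ∷ w) ∷ [] else []) f
             ≡ (if b then 1ℚ else 0ℚ) * ℕtoℚ (suc n) * f ((l , suc n) ∷ w)
  head true = ring (ℕtoℚ (suc n)) (f ((l , suc n) ∷ w))
    where ring : ∀ k x → k * x + 0ℚ ≡ 1ℚ * k * x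
          ring = solve-∀ ℚ-ring
  head false = ring (ℕtoℚ (suc n)) (f ((l , suc n) ∷ w))
    where ring : ∀ k x → 0ℚ ≡ 0ℚ * k * x
          ring = solve-∀ ℚ-ring

total-diff : ∀ j i w → total (δ-diff j i) w ≡ total (δ j) w + - 1ℚ * total (δ i) w
total-diff j i [] = refl
total-diff j i ((l , _) ∷ w) = trans (cong (_+_ (δ-diff j i l)) (total-diff j i w)) (ring (δ j l) (δ i l) (total (δ j) w) (total (δ i) w))
  where ring : ∀ a b c d → a + - 1ℚ * b + (c + - 1ℚ * d) ≡ a + c + - 1ℚ * (b + d)
        ring = solve-∀ ℚ-ring

derivᵘ-diff : ∀ j i w (f : CF → ℚ) → ∑ (derivᵘ (δ-diff j i) w) f ≡ ∑ (derivᵘ (δ j) w) f + - 1ℚ * ∑ (derivᵘ (δ i) w) f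
derivᵘ-diff j i [] f = refl
derivᵘ-diff j i ((l , n) ∷ w) f = begin
  ∑ (derivᵘ (δ-diff j i) ((l , n) ∷ w)) f
    ≡⟨ ∑-derivᵘ (δ-diff j i) l n w f ⟩
  total (δ-diff j i) ((l , n) ∷ w) * k * x + ∑ (derivᵘ (δ-diff j i) w) g
    ≡⟨ cong₂ (λ s t → s * k * x + t) (total-diff j i ((l , n) ∷ w)) (derivᵘ-diff j i w g) ⟩
  (a + - 1ℚ * b) * k * x + (∑ (derivᵘ (δ j) w) g + - 1ℚ * ∑ (derivᵘ (δ i) w) g)
    ≡⟨ ring a b k x (∑ (derivᵘ (δ j) w) g) (∑ (derivᵘ (δ i) w) g) ⟩
  (a * k * x + ∑ (derivᵘ (δ j) w) g) + - 1ℚ * (b * k * x + ∑ (derivᵘ (δ i) w) g)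
    ≡⟨ cong₂ (λ s t → s + - 1ℚ * t) (∑-derivᵘ (δ j) l n w f) (∑-derivᵘ (δ i) l n w f) ⟨
  ∑ (derivᵘ (δ j) ((l , n) ∷ w)) f + - 1ℚ * ∑ (derivᵘ (δ i) ((l , n) ∷ w)) f ∎
  where
  k = ℕtoℚ (suc n)
  x = f ((l , suc n) ∷ w)
  g : CF → ℚ
  g v = f ((l , n) ∷ v)
  a = total (δ j) ((l , n) ∷ w)
  b = total (δ i) ((l , n) ∷ w)
  ring : ∀ a b k x y z → (a + - 1ℚ * b) * k * x + (y + - 1ℚ * z) ≡ (a * k * x + y) + - 1ℚ * (b * k * x + z)
  ring = solve-∀ ℚ-ring

d-derivᵘ : ∀ j i w → Unique (labels w) → ∀ (f : CF → ℚ) → ∑ (d j i w) f ≡ ∑ (derivᵘ (δ-diff j i) w) f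
d-derivᵘ j i w unique f = trans (∑-⊕ (∂ j w) ((- 1ℚ) · ∂ i w) f)
  (trans (cong₂ _+_ (∂-derivᵘ j w unique f) (trans (∑-· (- 1ℚ) (∂ i w) f) (cong (- 1ℚ *_) (∂-derivᵘ i w unique f))))
         (sym (derivᵘ-diff j i w f)))

RaisedFrom : CF → CF → Set
RaisedFrom w v = labels v ≡ labels w × weight (π v) ≡ suc (weight (π w))

∂-raises : ∀ i w → Supported (RaisedFrom w) (∂ i w)
∂-raises i [] = []
∂-raises i ((l , n) ∷ w) = AllP.++⁺ (head (occurs i ((l , n) ∷ w)))
  (AllP.map⁺ (All.map (λ (same , more) → cong (l ∷_) same ,
     cong suc (trans (cong (n ℕ.+_) more) (ℕP.+-suc n (weight (π w))))) (∂-raises i w)))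
  where
  head : ∀ b → Supported (RaisedFrom ((l , n) ∷ w)) (if b then (ℕtoℚ (suc n) , (l , suc n) ∷ w) ∷ [] else [])
  head true = (refl , refl) ∷ []
  head false = []

record Realises (D : CF → FS CF) (κ : ℕ → ℚ) : Set where
  field
    raises : ∀ w → Supported (RaisedFrom w) (D w)
    agrees : ∀ w → Unique (labels w) → ∀ (f : CF → ℚ) → ∑ (D w) f ≡ ∑ (derivᵘ κ w) f
open Realises

∂-realises : ∀ i → Realises (∂ i) (δ i)
∂-realises i = record { raises = ∂-raises i ; agrees = ∂-derivᵘ i }

d-realises : ∀ j i → Realises (d j i) (δ-diff j i)
d-realises j i = record
  { raises = λ w → AllP.++⁺ (∂-raises j w) (supported-· (- 1ℚ) (∂-raises i w))
  ; agrees = d-derivᵘ j i }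

-- The operators of the recursion and its invariant

diffs : ℕ → List ℕ → List (ℕ → ℚ)
diffs i [] = []
diffs i (j ∷ J) = δ-diff j i ∷ diffs j J

-- The local function go in dOps does not use the list it was started from, so the second clause holds
-- because drop 2 (dOps (i ∷ j ∷ J)) and drop 1 (dOps (j ∷ J)) are definitionally equal.
tail-dOps-realise : ∀ i I → Pointwise Realises (drop 1 (dOps (i ∷ I))) (diffs i I)
tail-dOps-realise i [] = []
tail-dOps-realise i (j ∷ J) = d-realises j i ∷ tail-dOps-realise j J

-- In the order of `dOps`. On fractions whose label list is this list of distinct labels, `derivᵘ`
-- along the j-th direction is ∂/∂uⱼ.
dirs : List ℕ → List (ℕ → ℚ)
dirs [] = []
dirs (i ∷ I) = δ i ∷ diffs i I

dOps-realise : ∀ I → Pointwise Realises (dOps I) (dirs I)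
dOps-realise [] = []
dOps-realise (i ∷ I) = ∂-realises i ∷ tail-dOps-realise i I

-- The distinctness clauses allow `agrees` to be applied in each tensor factor; the weight clause
-- yields the grading of `Δdesc`.
Balanced : ℕ → CF × CF → Set
Balanced N p = Unique (labels (proj₁ p)) × Unique (labels (proj₂ p)) × weight (π (proj₁ p)) ℕ.+ weight (π (proj₂ p)) ≡ N

lift-balanced : ∀ {D κ} → Realises D κ → ∀ {N t} → Supported (Balanced N) t → Supported (Balanced (suc N)) (lift D t)
lift-balanced {D} R = λ b → supported-ext (leibniz D) b λ (p , q) (p! , q! , wt) → AllP.++⁺
  (All.map (λ { {(_ , (p′ , q′))} (refl , (same , more)) → p! , subst Unique (sym same) q! ,
                 trans (cong (weight (π p) ℕ.+_) more) (trans (ℕP.+-suc (weight (π p)) (weight (π q))) (cong suc wt)) })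
           (supported-⊗ {P = _≡_ p} {u = basis p} (refl ∷ []) (raises R q)))
  (All.map (λ { {(_ , (p′ , q′))} ((same , more) , refl) → subst Unique (sym same) p! , q! ,
                 trans (cong (ℕ._+ weight (π q)) more) (cong suc wt) })
           (supported-⊗ {Q = _≡_ q} {v = basis q} (raises R p) (refl ∷ [])))

raise-balanced : ∀ {D κ} → Realises D κ → ∀ n {N t} → Supported (Balanced N) t → Supported (Balanced (n ℕ.+ N)) (raise D n t)
raise-balanced R zero b = b
raise-balanced R (suc n) b = supported-· (+ 1 / suc n) (lift-balanced R (raise-balanced R n b))

raiseAll-balanced : ∀ {Ds κs} → Pointwise Realises Ds κs → ∀ ns {N t} → length Ds ≡ length ns →
  Supported (Balanced N) t → Supported (Balanced (sum ns ℕ.+ N)) (raiseAll Ds ns t)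
raiseAll-balanced [] [] _ b = b
raiseAll-balanced {D ∷ Ds} (R ∷ Rs) (n ∷ ns) {N} {t} eq b =
  subst (λ M → Supported (Balanced M) (raiseAll Ds ns (raise D n t))) (trans (sym (ℕP.+-assoc (sum ns) n N)) (cong (ℕ._+ N) (ℕP.+-comm (sum ns) n)))
    (raiseAll-balanced Rs ns (ℕP.suc-injective eq) (raise-balanced R n b))

-- The recursion replayed in the basis (eₐ)

raiseᵛ : (ℕ → ℚ) → ℕ → FS CF → FS CF
raiseᵛ κ zero t = t
raiseᵛ κ (suc n) t = (+ 1 / suc n) · ext (derivᵛ κ) (raiseᵛ κ n t)

raiseAllᵛ : List (ℕ → ℚ) → List ℕ → FS CF → FS CF
raiseAllᵛ (κ ∷ κs) (n ∷ ns) t = raiseAllᵛ κs ns (raiseᵛ κ n t)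
raiseAllᵛ _ _ t = t

∑-raiseᵛ-suc : ∀ κ n t (f : CF → ℚ) →
  ∑ (raiseᵛ κ (suc n) t) f ≡ (+ 1 / suc n) * ∑[ a ∈ raiseᵛ κ n t ] ∑ (derivᵛ κ a) f
∑-raiseᵛ-suc κ n t f = trans (∑-· (+ 1 / suc n) (ext (derivᵛ κ) (raiseᵛ κ n t)) f)
  (cong (+ 1 / suc n *_) (∑-ext (derivᵛ κ) (raiseᵛ κ n t) f))

-- Each round multiplies by the same scalar on both sides, and `coproductᶜ-deriv` turns `derivᵛ` on
-- words into the Leibniz action of `derivᵘ` on tensors. That action agrees with the one of `D` as
-- long as the labels stay distinct.
coproductᶜ-raise : ∀ {D κ} → Realises D κ → ∀ n {N t s} → Supported (Balanced N) s →
  (∀ f → ∑[ a ∈ t ] ∑ (coproductᶜ a) f ≡ ∑ s f) →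
  ∀ f → ∑[ a ∈ raiseᵛ κ n t ] ∑ (coproductᶜ a) f ≡ ∑ (raise D n s) f
coproductᶜ-raise R zero b h f = h f
coproductᶜ-raise {D} {κ} R (suc n) {N} {t} {s} b h f = begin
  ∑[ a ∈ raiseᵛ κ (suc n) t ] ∑ (coproductᶜ a) f
    ≡⟨ ∑-raiseᵛ-suc κ n t (λ a → ∑ (coproductᶜ a) f) ⟩
  c * ∑[ a ∈ raiseᵛ κ n t ] ∑[ b ∈ derivᵛ κ a ] ∑ (coproductᶜ b) f
    ≡⟨ cong (c *_) (∑-cong (raiseᵛ κ n t) λ a → coproductᶜ-deriv κ a f) ⟩
  c * ∑[ a ∈ raiseᵛ κ n t ] ∑[ p ∈ coproductᶜ a ] ∑ (leibniz (derivᵘ κ) p) f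
    ≡⟨ cong (c *_) (coproductᶜ-raise R n b h (λ p → ∑ (leibniz (derivᵘ κ) p) f)) ⟩
  c * ∑[ p ∈ raise D n s ] ∑ (leibniz (derivᵘ κ) p) f
    ≡⟨ cong (c *_) (∑-congAll (raise-balanced R n b) agree) ⟨
  c * ∑[ p ∈ raise D n s ] ∑ (leibniz D p) f
    -- `lift D` is definitionally `ext (leibniz D)`.
    ≡⟨ trans (∑-· c (lift D (raise D n s)) f) (cong (c *_) (∑-ext (leibniz D) (raise D n s) f)) ⟨
  ∑ (raise D (suc n) s) f ∎
  where
  c = + 1 / suc n
  agree : ∀ p → Balanced (n ℕ.+ N) p → ∑ (leibniz D p) f ≡ ∑ (leibniz (derivᵘ κ) p) f
  agree p (p! , q! , _) = trans (∑-leibniz D p f)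
    (trans (cong₂ _+_ (agrees R (proj₂ p) q! (λ v → f (proj₁ p , v))) (agrees R (proj₁ p) p! (λ u → f (u , proj₂ p))))
           (sym (∑-leibniz (derivᵘ κ) p f)))

coproductᶜ-raiseAll : ∀ {Ds κs} → Pointwise Realises Ds κs → ∀ ns {N t s} → Supported (Balanced N) s →
  (∀ f → ∑[ a ∈ t ] ∑ (coproductᶜ a) f ≡ ∑ s f) →
  ∀ f → ∑[ a ∈ raiseAllᵛ κs ns t ] ∑ (coproductᶜ a) f ≡ ∑ (raiseAll Ds ns s) f
coproductᶜ-raiseAll [] _ b h = h
coproductᶜ-raiseAll (R ∷ Rs) [] b h = h
coproductᶜ-raiseAll (R ∷ Rs) (n ∷ ns) b h = coproductᶜ-raiseAll Rs ns (raise-balanced R n b) (coproductᶜ-raise R n b h)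

derivᵘ-vanish : ∀ {κ w} → All (λ l → κ l ≡ 0ℚ) (labels w) → ∀ (f : CF → ℚ) → ∑ (derivᵘ κ w) f ≡ 0ℚ
derivᵘ-vanish {w = []} [] f = refl
derivᵘ-vanish {κ} {(l , n) ∷ w} zs@(_ ∷ zs′) f = trans (∑-derivᵘ κ l n w f)
  (trans (cong₂ (λ s t → s * ℕtoℚ (suc n) * f ((l , suc n) ∷ w) + t) (total-vanish {κ} {(l , n) ∷ w} zs) (derivᵘ-vanish zs′ (λ v → f ((l , n) ∷ v))))
         (ring (ℕtoℚ (suc n)) (f ((l , suc n) ∷ w))))
  where ring : ∀ k x → 0ℚ * k * x + 0ℚ ≡ 0ℚ
        ring = solve-∀ ℚ-ring

total-prefix : ∀ {κ pre} w → All (λ l → κ l ≡ 0ℚ) (labels pre) → total κ (pre ++ w) ≡ total κ w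
total-prefix {pre = []} w [] = refl
total-prefix {pre = _ ∷ pre} w (z ∷ zs) = trans (cong₂ _+_ z (total-prefix {pre = pre} w zs)) (ℚP.+-identityˡ _)

-- At an entry of `pre` the suffix total is that of a piece of `pre` plus that of `w`, both zero.
derivᵘ-prefix : ∀ {κ pre w} → All (λ l → κ l ≡ 0ℚ) (labels pre) → total κ w ≡ 0ℚ →
  ∀ (f : CF → ℚ) → ∑ (derivᵘ κ (pre ++ w)) f ≡ ∑[ v ∈ derivᵘ κ w ] f (pre ++ v)
derivᵘ-prefix {pre = []} [] _ f = refl
derivᵘ-prefix {κ} {(l , n) ∷ pre} {w} zs@(_ ∷ zs′) t≡0 f = trans (∑-derivᵘ κ l n (pre ++ w) f)
  (trans (cong₂ (λ s t → s * ℕtoℚ (suc n) * f ((l , suc n) ∷ pre ++ w) + t) (trans (total-prefix {pre = (l , n) ∷ pre} w zs) t≡0)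
                (derivᵘ-prefix {pre = pre} zs′ t≡0 (λ v → f ((l , n) ∷ v))))
         (ring (ℕtoℚ (suc n)) (f ((l , suc n) ∷ pre ++ w)) (∑[ v ∈ derivᵘ κ w ] f ((l , n) ∷ pre ++ v))))
  where ring : ∀ k x y → 0ℚ * k * x + y ≡ y
        ring = solve-∀ ℚ-ring

derivᵘ-δ : ∀ i n w → All (i ℕ.<_) (labels w) → ∀ (f : CF → ℚ) →
  ∑ (derivᵘ (δ i) ((i , n) ∷ w)) f ≡ ℕtoℚ (suc n) * f ((i , suc n) ∷ w)
derivᵘ-δ i n w i<w f = trans (∑-derivᵘ (δ i) i n w f)
  (trans (cong₂ (λ s t → s * ℕtoℚ (suc n) * f ((i , suc n) ∷ w) + t)
            (cong₂ _+_ (δ-≡ i) (total-vanish {δ i} {w} vanish)) (derivᵘ-vanish vanish (λ v → f ((i , n) ∷ v))))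
         (ring (ℕtoℚ (suc n)) (f ((i , suc n) ∷ w))))
  where
  vanish : All (λ l → δ i l ≡ 0ℚ) (labels w)
  vanish = All.map (λ i<l → δ-≢ (ℕP.<⇒≢ i<l ∘ sym)) i<w
  ring : ∀ k x → (1ℚ + 0ℚ) * k * x + 0ℚ ≡ k * x
  ring = solve-∀ ℚ-ring

-- Suffixes starting at or before label `i` contain both `i` and `suc i`, so their totals cancel;
-- later suffixes contain neither. Only the suffix starting at `suc i` has a nonzero total, namely
-- 1.
derivᵘ-δ-diff : ∀ i pre m n w → All (ℕ._< i) (labels pre) → All (suc i ℕ.<_) (labels w) → ∀ (f : CF → ℚ) →
  ∑ (derivᵘ (δ-diff (suc i) i) (pre ++ (i , m) ∷ (suc i , n) ∷ w)) f
    ≡ ℕtoℚ (suc n) * f (pre ++ (i , m) ∷ (suc i , suc n) ∷ w)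
derivᵘ-δ-diff i pre m n w pre<i i<w f = begin
  ∑ (derivᵘ κ (pre ++ (i , m) ∷ (suc i , n) ∷ w)) f
    ≡⟨ derivᵘ-prefix {pre = pre} (All.map (λ l<i → κ-≢ (ℕP.<⇒≢ (ℕP.m<n⇒m<1+n l<i)) (ℕP.<⇒≢ l<i)) pre<i) total-0 f ⟩
  ∑ (derivᵘ κ ((i , m) ∷ (suc i , n) ∷ w)) g
    ≡⟨ trans (∑-derivᵘ κ i m ((suc i , n) ∷ w) g)
         (cong (_+_ (total κ ((i , m) ∷ (suc i , n) ∷ w) * ℕtoℚ (suc m) * g ((i , suc m) ∷ (suc i , n) ∷ w)))
         (∑-derivᵘ κ (suc i) n w (λ v → g ((i , m) ∷ v)))) ⟩
  total κ ((i , m) ∷ (suc i , n) ∷ w) * ℕtoℚ (suc m) * x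
      + ((κ (suc i) + total κ w) * ℕtoℚ (suc n) * y + ∑[ v ∈ derivᵘ κ w ] g ((i , m) ∷ (suc i , n) ∷ v))
    ≡⟨ cong₂ (λ s t → s * ℕtoℚ (suc m) * x + t) total-0
         (cong₂ (λ s t → s * ℕtoℚ (suc n) * y + t) (cong₂ _+_ κ-suc w-0) (derivᵘ-vanish vanish (λ v → g ((i , m) ∷ (suc i , n) ∷ v)))) ⟩
  0ℚ * ℕtoℚ (suc m) * x + ((1ℚ + 0ℚ) * ℕtoℚ (suc n) * y + 0ℚ)
    ≡⟨ ring (ℕtoℚ (suc m)) x (ℕtoℚ (suc n)) y ⟩
  ℕtoℚ (suc n) * y ∎
  where
  κ : ℕ → ℚ
  κ = δ-diff (suc i) i
  g : CF → ℚ
  g v = f (pre ++ v)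
  x = g ((i , suc m) ∷ (suc i , n) ∷ w)
  y = g ((i , m) ∷ (suc i , suc n) ∷ w)
  κ-≢ : ∀ {l} → l ≢ suc i → l ≢ i → κ l ≡ 0ℚ
  κ-≢ l≢j l≢i = cong₂ (λ s t → s + - 1ℚ * t) (δ-≢ l≢j) (δ-≢ l≢i)
  κ-suc : κ (suc i) ≡ 1ℚ
  κ-suc = cong₂ (λ s t → s + - 1ℚ * t) (δ-≡ (suc i)) (δ-≢ {i} {suc i} ℕP.1+n≢n)
  κ-i : κ i ≡ - 1ℚ
  κ-i = cong₂ (λ s t → s + - 1ℚ * t) (δ-≢ {suc i} {i} (ℕP.1+n≢n ∘ sym)) (δ-≡ i)
  vanish : All (λ l → κ l ≡ 0ℚ) (labels w)
  vanish = All.map (λ i<l → κ-≢ (ℕP.<⇒≢ i<l ∘ sym) (ℕP.<⇒≢ (ℕP.<⇒≤ i<l) ∘ sym)) i<w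
  w-0 : total κ w ≡ 0ℚ
  w-0 = total-vanish {κ} {w} vanish
  total-0 : total κ ((i , m) ∷ (suc i , n) ∷ w) ≡ 0ℚ
  total-0 = cong₂ _+_ κ-i (cong₂ _+_ κ-suc w-0)
  ring : ∀ a x b y → 0ℚ * a * x + ((1ℚ + 0ℚ) * b * y + 0ℚ) ≡ b * y
  ring = solve-∀ ℚ-ring

-- The factor n + 1 produced by differentiation cancels against the 1/(n + 1) of the recursion.
Θ-raise : ∀ κ (w : ℕ → CF) → (∀ n (f : CF → ℚ) → ∑ (derivᵘ κ (w n)) f ≡ ℕtoℚ (suc n) * f (w (suc n))) →
  ∀ {t} → (∀ (f : CF → ℚ) → ∑[ a ∈ t ] ∑ (Θ a) f ≡ f (w 0)) →
  ∀ n (f : CF → ℚ) → ∑[ a ∈ raiseᵛ κ n t ] ∑ (Θ a) f ≡ f (w n)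
Θ-raise κ w step h zero f = h f
Θ-raise κ w step {t} h (suc n) f = begin
  ∑[ a ∈ raiseᵛ κ (suc n) t ] ∑ (Θ a) f
    ≡⟨ ∑-raiseᵛ-suc κ n t (λ a → ∑ (Θ a) f) ⟩
  c * ∑[ a ∈ raiseᵛ κ n t ] ∑[ b ∈ derivᵛ κ a ] ∑ (Θ b) f
    ≡⟨ cong (c *_) (∑-cong (raiseᵛ κ n t) λ a → Θ-deriv κ a f) ⟩
  c * ∑[ a ∈ raiseᵛ κ n t ] ∑[ u ∈ Θ a ] ∑ (derivᵘ κ u) f
    ≡⟨ cong (c *_) (Θ-raise κ w step {t} h n (λ u → ∑ (derivᵘ κ u) f)) ⟩
  c * ∑ (derivᵘ κ (w n)) f
    ≡⟨ cong (c *_) (step n f) ⟩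
  c * (ℕtoℚ (suc n) * f (w (suc n)))
    ≡⟨ ℚP.*-assoc c (ℕtoℚ (suc n)) (f (w (suc n))) ⟨
  c * ℕtoℚ (suc n) * f (w (suc n))
    ≡⟨ cong (_* f (w (suc n))) (1/suc-inverse n) ⟩
  1ℚ * f (w (suc n))
    ≡⟨ ℚP.*-identityˡ _ ⟩
  f (w (suc n)) ∎
  where c = + 1 / suc n

-- The standard labels 1, ..., k

seg : ℕ → ℕ → List ℕ
seg a zero = []
seg a (suc k) = a ∷ seg (suc a) k

map-suc-applyUpTo : ∀ (g : ℕ → ℕ) a k → (∀ n → suc (g n) ≡ a ℕ.+ n) → map suc (applyUpTo g k) ≡ seg a k
map-suc-applyUpTo g a zero h = refl
map-suc-applyUpTo g a (suc k) h = cong₂ _∷_ (trans (h 0) (ℕP.+-identityʳ a))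
  (map-suc-applyUpTo (g ∘ suc) (suc a) k λ n → trans (h (suc n)) (ℕP.+-suc a n))

seg-above : ∀ a k → All (a ℕ.≤_) (seg a k)
seg-above a zero = []
seg-above a (suc k) = ℕP.≤-refl ∷ All.map ℕP.<⇒≤ (seg-above (suc a) k)

seg-unique : ∀ a k → Unique (seg a k)
seg-unique a zero = []
seg-unique a (suc k) = All.map ℕP.<⇒≢ (seg-above (suc a) k) ∷ seg-unique (suc a) k

length-seg : ∀ a k → length (seg a k) ≡ k
length-seg a zero = refl
length-seg a (suc k) = cong suc (length-seg (suc a) k)

labels-ones : ∀ I → labels (ones I) ≡ I
labels-ones [] = refl
labels-ones (i ∷ I) = cong (i ∷_) (labels-ones I)

π-zip : ∀ a w → π (zip (seg a (length w)) w) ≡ w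
π-zip a [] = refl
π-zip a (n ∷ w) = cong (n ∷_) (π-zip (suc a) w)

-- Entries up to label `i` already have their final exponents, and later ones still have s = 1. The
-- next difference operator touches only the entry labelled `suc i`, because labels to the left are
-- smaller and labels to the right larger.
Θ-raise-diffs : ∀ i pre m ns → All (ℕ._< i) (labels pre) → ∀ {t} →
  (∀ (f : CF → ℚ) → ∑[ a ∈ t ] ∑ (Θ a) f ≡ f (pre ++ (i , m) ∷ ones (seg (suc i) (length ns)))) →
  ∀ (f : CF → ℚ) → ∑[ a ∈ raiseAllᵛ (diffs i (seg (suc i) (length ns))) ns t ] ∑ (Θ a) f
    ≡ f (pre ++ (i , m) ∷ zip (seg (suc i) (length ns)) ns)
Θ-raise-diffs i pre m [] pre<i h = h
Θ-raise-diffs i pre m (n ∷ ns) pre<i {t} h f = trans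
  (Θ-raise-diffs (suc i) (pre ∷ʳ (i , m)) n ns below
     (λ f → trans (Θ-raise (δ-diff (suc i) i) (λ n → pre ++ (i , m) ∷ (suc i , n) ∷ ones J)
                    (λ n → derivᵘ-δ-diff i pre m n (ones J) pre<i
                        (subst (All (suc i ℕ.<_)) (sym (labels-ones J)) (seg-above (suc (suc i)) (length ns)))) {t} h n f)
                  (cong f (sym (LP.∷ʳ-++ pre (i , m) ((suc i , n) ∷ ones J))))) f)
  (cong f (LP.∷ʳ-++ pre (i , m) ((suc i , n) ∷ zip J ns)))
  where
  J = seg (suc (suc i)) (length ns)
  below : All (ℕ._< suc i) (labels (pre ∷ʳ (i , m)))
  below = subst (All (ℕ._< suc i)) (sym (LP.map-++ proj₁ pre ((i , m) ∷ []))) (AllP.++⁺ (All.map ℕP.m<n⇒m<1+n pre<i) (ℕP.n<1+n i ∷ []))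

standard : Comp → List ℕ
standard w = seg 1 (length w)

-- The recursion for Δᶜʰ performed on the fraction itself in the basis (eₐ). Under `Θ` it returns
-- the Chen fraction with exponents `w`; under `coproductᶜ` it returns Δᶜʰ of that fraction.
inverseᶜ : Comp → FS CF
inverseᶜ w = raiseAllᵛ (dirs (standard w)) w (basis (ones (standard w)))

Θ-inverseᶜ : ∀ w (f : CF → ℚ) → ∑[ a ∈ inverseᶜ w ] ∑ (Θ a) f ≡ f (zip (standard w) w)
Θ-inverseᶜ [] f = trans (∑-basis [] (λ a → ∑ (Θ a) f)) (∑-basis [] f)
-- The first operator is ∂₁ alone, by the convention for d_{i₁,i₀}; difference operators take over
-- from the second label on.
Θ-inverseᶜ (n ∷ w) f = Θ-raise-diffs 1 [] n w [] {raiseᵛ (δ 1) n (basis (ones (1 ∷ J)))}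
  (Θ-raise (δ 1) (λ n → (1 , n) ∷ ones J)
      (λ n → derivᵘ-δ 1 n (ones J) (subst (All (1 ℕ.<_)) (sym (labels-ones J)) (seg-above 2 (length w)))) {basis (ones (1 ∷ J))}
     (λ f → trans (∑-basis (ones (1 ∷ J)) (λ a → ∑ (Θ a) f)) (Θ-ones (1 ∷ J) f)) n) f
  where J = seg 2 (length w)

-- The coproduct on symbols as deconcatenation

∑-Δch-ones : ∀ I (f : CF × CF → ℚ) → ∑ (Δch-ones I) f ≡ ∑ (dec (ones I)) f
∑-Δch-ones [] f = refl
∑-Δch-ones (x ∷ I) f = trans
  (cong₂ _+_ (ℚP.*-identityˡ (f ([] , ones (x ∷ I)))) (trans (shift (splits I)) (∑-Δch-ones I (f ∘ consˡ (x , 0)))))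
  (sym (∑-dec-∷ (x , 0) (ones I) f))
  where
  unit : List ℕ × List ℕ → ℚ × (CF × CF)
  unit p = 1ℚ , (ones (proj₁ p) , ones (proj₂ p))
  shift : ∀ S → ∑ (map unit (map (consˡ x) S)) f ≡ ∑[ p ∈ map unit S ] f (consˡ (x , 0) p)
  shift [] = refl
  shift (p ∷ S) = cong (_+_ (1ℚ * f (consˡ (x , 0) (ones (proj₁ p) , ones (proj₂ p))))) (shift S)

coproductᶜ-ones : ∀ I (f : CF × CF → ℚ) → ∑[ a ∈ basis (ones I) ] ∑ (coproductᶜ a) f ≡ ∑ (Δch-ones I) f
coproductᶜ-ones I f = begin
  ∑[ a ∈ basis (ones I) ] ∑ (coproductᶜ a) f
    ≡⟨ ∑-basis (ones I) (λ a → ∑ (coproductᶜ a) f) ⟩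
  ∑ (coproductᶜ (ones I)) f
    ≡⟨ ∑-coproductᶜ (ones I) f ⟩
  ∑ (dec (ones I)) ΘΘ
    ≡⟨ ∑-Δch-ones I ΘΘ ⟨
  ∑ (Δch-ones I) ΘΘ
    ≡⟨ fixed (splits I) ⟩
  ∑ (Δch-ones I) f ∎
  where
  ΘΘ : CF × CF → ℚ
  ΘΘ p = ∑[ u ∈ Θ (proj₁ p) ] ∑[ v ∈ Θ (proj₂ p) ] f (u , v)
  unit : List ℕ × List ℕ → ℚ × (CF × CF)
  unit p = 1ℚ , (ones (proj₁ p) , ones (proj₂ p))
  fixed : ∀ S → ∑ (map unit S) ΘΘ ≡ ∑ (map unit S) f
  fixed [] = refl
  fixed ((J , K) ∷ S) = cong₂ (λ s t → 1ℚ * s + t)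
    (trans (Θ-ones J (λ u → ∑[ v ∈ Θ (ones K) ] f (u , v))) (Θ-ones K (λ v → f (ones J , v)))) (fixed S)

splits-All : ∀ {P : ℕ → Set} {I} → All P I → All (λ p → All P (proj₁ p)) (splits I)
splits-All [] = [] ∷ []
splits-All (p ∷ ps) = [] ∷ AllP.map⁺ (All.map (p ∷_) (splits-All ps))

splits-unique : ∀ {I} → Unique I →
  All (λ p → Unique (proj₁ p) × Unique (proj₂ p) × length (proj₁ p) ℕ.+ length (proj₂ p) ≡ length I) (splits I)
splits-unique [] = ([] , [] , refl) ∷ []
splits-unique (i∉I ∷ unique) = ([] , i∉I ∷ unique , refl)
  ∷ AllP.map⁺ (All.zipWith (λ (i∉J , J! , K! , eq) → i∉J ∷ J! , K! , cong suc eq) (splits-All i∉I , splits-unique unique))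

weight-ones : ∀ I → weight (π (ones I)) ≡ length I
weight-ones [] = refl
weight-ones (i ∷ I) = cong suc (weight-ones I)

Δch-ones-balanced : ∀ {I} → Unique I → Supported (Balanced (length I)) (Δch-ones I)
Δch-ones-balanced unique = AllP.map⁺ (All.map (λ { {(J , K)} (J! , K! , eq) →
    subst Unique (sym (labels-ones J)) J! , subst Unique (sym (labels-ones K)) K! ,
    trans (cong₂ ℕ._+_ (weight-ones J) (weight-ones K)) eq })
  (splits-unique unique))

length-diffs : ∀ i I → length (diffs i I) ≡ length I
length-diffs i [] = refl
length-diffs i (j ∷ J) = cong suc (length-diffs j J)

length-dirs : ∀ I → length (dirs I) ≡ length I
length-dirs [] = refl
length-dirs (i ∷ I) = cong suc (length-diffs i I)

standard-≡ : ∀ w → map suc (upTo (length w)) ≡ standard w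
standard-≡ w = map-suc-applyUpTo (λ n → n) 1 (length w) λ _ → refl

π₂ : CF × CF → Comp × Comp
π₂ q = π (proj₁ q) , π (proj₂ q)

∑-Δdesc-Δch : ∀ w (f : Comp × Comp → ℚ) → ∑ (Δdesc w) f ≡ ∑[ q ∈ Δch (standard w) w ] f (π₂ q)
∑-Δdesc-Δch w f = trans (∑-map π₂ (Δch (map suc (upTo (length w))) w) f)
  (cong (λ I → ∑[ q ∈ Δch I w ] f (π₂ q)) (standard-≡ w))

weight-sum : ∀ w → weight w ≡ sum w ℕ.+ length w
weight-sum [] = refl
weight-sum (n ∷ w) = trans (cong (λ m → suc (n ℕ.+ m)) (weight-sum w))
  (trans (cong suc (sym (ℕP.+-assoc n (sum w) (length w)))) (sym (ℕP.+-suc (n ℕ.+ sum w) (length w))))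

-- The recursion starts from Φ^{1,...,1}, of weight k, and applies `sum w` operators, each of which
-- adds one to the total weight of a tensor.
Δdesc-weight : ∀ w → Supported (λ p → weight (proj₁ p) ℕ.+ weight (proj₂ p) ≡ weight w) (Δdesc w)
Δdesc-weight w = AllP.map⁺ (All.map (λ (_ , _ , eq) → trans eq (trans (cong (sum w ℕ.+_) (length-seg 1 (length w))) (sym (weight-sum w))))
  (subst (λ I → Supported (Balanced (sum w ℕ.+ length (standard w))) (Δch I w)) (sym (standard-≡ w))
    (raiseAll-balanced (dOps-realise (standard w)) w
       (trans (Pointwise-length (dOps-realise (standard w))) (trans (length-dirs (standard w)) (length-seg 1 (length w))))
       (Δch-ones-balanced (seg-unique 1 (length w))))))

∑-dec-π : ∀ a (f : Comp × Comp → ℚ) → ∑[ p ∈ dec a ] f (π₂ p) ≡ ∑ (dec (π a)) f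
∑-dec-π [] f = refl
∑-dec-π ((l , n) ∷ a) f = trans (∑-dec-∷ (l , n) a (f ∘ π₂))
  (trans (cong (_+_ (f ([] , n ∷ π a))) (∑-dec-π a (f ∘ consˡ n))) (sym (∑-dec-∷ n (π a) f)))

θ₂ : (Comp × Comp → ℚ) → Comp × Comp → ℚ
θ₂ f p = ∑[ u ∈ θ (proj₁ p) ] ∑[ v ∈ θ (proj₂ p) ] f (u , v)

-- This is Δdesc = (θ ⊗ θ) ∘ dec ∘ ψ. It holds at Φ^{1,...,1}, and the operators of the recursion
-- respect both sides.
∑-Δdesc : ∀ w (f : Comp × Comp → ℚ) → ∑ (Δdesc w) f ≡ ∑[ a ∈ ψ w ] ∑ (dec a) (θ₂ f)
∑-Δdesc w f = begin
  ∑ (Δdesc w) f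
    ≡⟨ ∑-Δdesc-Δch w f ⟩
  ∑[ q ∈ Δch I w ] f (π₂ q)
    ≡⟨ coproductᶜ-raiseAll (dOps-realise I) w {t = basis (ones I)} (Δch-ones-balanced (seg-unique 1 (length w))) (coproductᶜ-ones I) (f ∘ π₂) ⟨
  ∑[ a ∈ inverseᶜ w ] ∑ (coproductᶜ a) (f ∘ π₂)
    ≡⟨ ∑-cong (inverseᶜ w) forget ⟩
  ∑[ a ∈ inverseᶜ w ] H (π a)
    -- Inserting ψ ∘ θ turns `H (π a)` into a functional evaluated on `Θ a`, so that `Θ-inverseᶜ`
    -- collapses the whole sum to the one fraction with exponents `w`.
    ≡⟨ ∑-cong (inverseᶜ w) (λ a → trans (sym (ψ∘θ (π a) H)) (sym (π-Θ a (λ v → ∑ (ψ v) H)))) ⟩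
  ∑[ a ∈ inverseᶜ w ] ∑[ u ∈ Θ a ] ∑ (ψ (π u)) H
    ≡⟨ Θ-inverseᶜ w (λ u → ∑ (ψ (π u)) H) ⟩
  ∑ (ψ (π (zip I w))) H
    ≡⟨ cong (λ v → ∑ (ψ v) H) (π-zip 1 w) ⟩
  ∑ (ψ w) H ∎
  where
  I = standard w
  H : Comp → ℚ
  H b = ∑ (dec b) (θ₂ f)
  forget : ∀ a → ∑ (coproductᶜ a) (f ∘ π₂) ≡ H (π a)
  forget a = trans (∑-coproductᶜ a (f ∘ π₂))
    (trans (∑-cong (dec a) λ p → trans (∑-cong (Θ (proj₁ p)) λ u → π-Θ (proj₂ p) (λ v → f (π u , v)))
                                       (π-Θ (proj₁ p) (λ u → ∑[ v ∈ θ (π (proj₂ p)) ] f (u , v))))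
           (∑-dec-π a (θ₂ f)))

-- Compatibility with the weight

coeff-supported : (eq : DecidableEquality A) {P : A → Set} {u : FS A} → Supported P u → ∀ b → ¬ (coeff eq u b ≡ 0ℚ) → P b
coeff-supported eq [] b nz = contradiction refl nz
coeff-supported eq {u = (c , a) ∷ u} (p ∷ ps) b nz with eq a b
... | yes refl = p
... | no _ = coeff-supported eq ps b nz

sh-length : ∀ u v → Supported (λ w → length w ≡ length u ℕ.+ length v) (sh u v)
sh-length [] v = refl ∷ []
sh-length (a ∷ u) [] = cong suc (sym (ℕP.+-identityʳ (length u))) ∷ []
sh-length (a ∷ u) (b ∷ v) = AllP.++⁺
  (AllP.map⁺ (All.map (cong suc) (sh-length u (b ∷ v))))
  (AllP.map⁺ (All.map (λ eq → cong suc (trans eq (sym (ℕP.+-suc (length u) (length v))))) (sh-length (a ∷ u) v)))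

length-ρ : ∀ w → length (ρ w) ≡ weight w
length-ρ [] = refl
length-ρ (n ∷ w) = trans (LP.length-++ (replicate n false))
    (trans (cong₂ ℕ._+_ (LP.length-replicate n) (cong suc (length-ρ w))) (ℕP.+-suc n (weight w)))

-- The weight is the length of the decoded word, counting the k copies of x₀ already read.
weight-ρ⁻¹ : ∀ k w {u} → ρ⁻¹-word k w ≡ just u → weight u ≡ k ℕ.+ length w
weight-ρ⁻¹ zero [] refl = refl
weight-ρ⁻¹ zero (false ∷ w) eq = weight-ρ⁻¹ 1 w eq
weight-ρ⁻¹ (suc k) (false ∷ w) eq = trans (weight-ρ⁻¹ (suc (suc k)) w eq) (cong suc (sym (ℕP.+-suc k (length w))))
weight-ρ⁻¹ zero (true ∷ w) eq with ρ⁻¹-word 0 w in eq′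
weight-ρ⁻¹ zero (true ∷ w) refl | just u = cong suc (weight-ρ⁻¹ 0 w eq′)
weight-ρ⁻¹ (suc k) (true ∷ w) eq with ρ⁻¹-word 0 w in eq′
weight-ρ⁻¹ (suc k) (true ∷ w) refl | just u = cong suc (trans (cong (λ m → suc (k ℕ.+ m)) (weight-ρ⁻¹ 0 w eq′)) (sym (ℕP.+-suc k (length w))))

ρ⁻¹-supported : ∀ {N} z → Supported (λ w → length w ≡ N) z → Supported (λ u → weight u ≡ N) (ρ⁻¹ z)
ρ⁻¹-supported [] [] = []
ρ⁻¹-supported ((c , w) ∷ z) (p ∷ ps) with ρ⁻¹-word 0 w in eq
... | just u = trans (weight-ρ⁻¹ 0 w eq) p ∷ ρ⁻¹-supported z ps
... | nothing = ρ⁻¹-supported z ps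

ш*-weight : ∀ u v → Supported (λ w → weight w ≡ weight u ℕ.+ weight v) (u ш* v)
ш*-weight u v = ρ⁻¹-supported (sh (ρ u) (ρ v))
  (All.map (λ eq → trans eq (cong₂ ℕ._+_ (length-ρ u) (length-ρ v))) (sh-length (ρ u) (ρ v)))

-- Transport along θ

-- The eₐ span: θ ∘ ψ is the identity.
θ-surjective : ∀ (L R : Comp → ℚ) → (∀ a → ∑ (θ a) L ≡ ∑ (θ a) R) → ∀ u → L u ≡ R u
θ-surjective L R h u = trans (sym (θ∘ψ u L)) (trans (∑-cong (ψ u) h) (θ∘ψ u R))

θ-shuffle′ : ∀ a b (f : Comp → ℚ) →
  ∑[ v ∈ θ b ] ∑[ u ∈ θ a ] ∑ (u ш* v) f ≡ ∑[ c ∈ shuffle a b ] ∑ (θ c) f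
θ-shuffle′ a b f = trans (∑-swap (θ b) (θ a) (λ v u → ∑ (u ш* v) f)) (sym (θ-shuffle a b f))

ш*-assoc : ∀ u v w (f : Comp → ℚ) → ∑[ d ∈ u ш* v ] ∑ (d ш* w) f ≡ ∑[ d ∈ v ш* w ] ∑ (u ш* d) f
ш*-assoc u v w f =
  -- One variable at a time is replaced by basis elements eₐ, so the variable treated last is summed
  -- outermost.
  θ-surjective (λ u → ∑[ d ∈ u ш* v ] ∑ (d ш* w) f) (λ u → ∑[ d ∈ v ш* w ] ∑ (u ш* d) f) (λ a →
  θ-surjective (λ v → ∑[ u ∈ θ a ] ∑[ d ∈ u ш* v ] ∑ (d ш* w) f) (λ v → ∑[ u ∈ θ a ] ∑[ d ∈ v ш* w ] ∑ (u ш* d) f) (λ b →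
  θ-surjective (λ w → ∑[ v ∈ θ b ] ∑[ u ∈ θ a ] ∑[ d ∈ u ш* v ] ∑ (d ш* w) f)
               (λ w → ∑[ v ∈ θ b ] ∑[ u ∈ θ a ] ∑[ d ∈ v ш* w ] ∑ (u ш* d) f) (λ c → on-θ a b c) w) v) u
  where
  on-θ : ∀ a b c → ∑[ w ∈ θ c ] ∑[ v ∈ θ b ] ∑[ u ∈ θ a ] ∑[ d ∈ u ш* v ] ∑ (d ш* w) f
                       ≡ ∑[ w ∈ θ c ] ∑[ v ∈ θ b ] ∑[ u ∈ θ a ] ∑[ d ∈ v ш* w ] ∑ (u ш* d) f
  on-θ a b c = begin
    ∑[ w ∈ θ c ] ∑[ v ∈ θ b ] ∑[ u ∈ θ a ] ∑[ d ∈ u ш* v ] ∑ (d ш* w) f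
      ≡⟨ ∑-cong (θ c) (λ w → θ-shuffle′ a b (λ d → ∑ (d ш* w) f)) ⟩
    ∑[ w ∈ θ c ] ∑[ e ∈ shuffle a b ] ∑[ d ∈ θ e ] ∑ (d ш* w) f
      ≡⟨ ∑-swap (θ c) (shuffle a b) (λ w e → ∑[ d ∈ θ e ] ∑ (d ш* w) f) ⟩
    ∑[ e ∈ shuffle a b ] ∑[ w ∈ θ c ] ∑[ d ∈ θ e ] ∑ (d ш* w) f
      ≡⟨ ∑-cong (shuffle a b) (λ e → θ-shuffle′ e c f) ⟩
    ∑[ e ∈ shuffle a b ] ∑[ k ∈ shuffle e c ] ∑ (θ k) f
      ≡⟨ shuffle-assoc a b c (λ k → ∑ (θ k) f) ⟩
    ∑[ e ∈ shuffle b c ] ∑[ k ∈ shuffle a e ] ∑ (θ k) f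
      ≡⟨ ∑-cong (shuffle b c) (λ e → θ-shuffle′ a e f) ⟨
    ∑[ e ∈ shuffle b c ] ∑[ d ∈ θ e ] ∑[ u ∈ θ a ] ∑ (u ш* d) f
      ≡⟨ θ-shuffle′ b c (λ d → ∑[ u ∈ θ a ] ∑ (u ш* d) f) ⟨
    ∑[ w ∈ θ c ] ∑[ v ∈ θ b ] ∑[ d ∈ v ш* w ] ∑[ u ∈ θ a ] ∑ (u ш* d) f
      ≡⟨ ∑-cong (θ c) (λ w → ∑-cong (θ b) λ v → ∑-swap (v ш* w) (θ a) (λ d u → ∑ (u ш* d) f)) ⟩
    ∑[ w ∈ θ c ] ∑[ v ∈ θ b ] ∑[ u ∈ θ a ] ∑[ d ∈ v ш* w ] ∑ (u ш* d) f ∎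

Δdesc-θ : ∀ a (f : Comp × Comp → ℚ) → ∑[ u ∈ θ a ] ∑ (Δdesc u) f ≡ ∑ (dec a) (θ₂ f)
Δdesc-θ a f = trans (∑-cong (θ a) λ u → ∑-Δdesc u f) (ψ∘θ a (λ b → ∑ (dec b) (θ₂ f)))

Δdesc-coassoc : ∀ w (f : Comp → Comp → Comp → ℚ) →
  ∑[ p ∈ Δdesc w ] ∑[ q ∈ Δdesc (proj₁ p) ] f (proj₁ q) (proj₂ q) (proj₂ p)
    ≡ ∑[ p ∈ Δdesc w ] ∑[ q ∈ Δdesc (proj₂ p) ] f (proj₁ p) (proj₁ q) (proj₂ q)
Δdesc-coassoc w f = θ-surjective _ _ (λ a → begin
  ∑[ w ∈ θ a ] ∑[ p ∈ Δdesc w ] ∑[ q ∈ Δdesc (proj₁ p) ] f (proj₁ q) (proj₂ q) (proj₂ p)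
    ≡⟨ Δdesc-θ a (λ p → ∑[ q ∈ Δdesc (proj₁ p) ] f (proj₁ q) (proj₂ q) (proj₂ p)) ⟩
  ∑[ p ∈ dec a ] ∑[ u ∈ θ (proj₁ p) ] ∑[ v ∈ θ (proj₂ p) ] ∑[ q ∈ Δdesc u ] f (proj₁ q) (proj₂ q) v
    ≡⟨ ∑-cong (dec a) (λ p → left (proj₁ p) (proj₂ p)) ⟩
  ∑[ p ∈ dec a ] ∑[ q ∈ dec (proj₁ p) ] θ₃ (proj₁ q) (proj₂ q) (proj₂ p)
    ≡⟨ dec-coassoc a θ₃ ⟩
  ∑[ p ∈ dec a ] ∑[ q ∈ dec (proj₂ p) ] θ₃ (proj₁ p) (proj₁ q) (proj₂ q)
    ≡⟨ ∑-cong (dec a) (λ p → right (proj₁ p) (proj₂ p)) ⟨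
  ∑[ p ∈ dec a ] ∑[ u ∈ θ (proj₁ p) ] ∑[ v ∈ θ (proj₂ p) ] ∑[ q ∈ Δdesc v ] f u (proj₁ q) (proj₂ q)
    ≡⟨ Δdesc-θ a (λ p → ∑[ q ∈ Δdesc (proj₂ p) ] f (proj₁ p) (proj₁ q) (proj₂ q)) ⟨
  ∑[ w ∈ θ a ] ∑[ p ∈ Δdesc w ] ∑[ q ∈ Δdesc (proj₂ p) ] f (proj₁ p) (proj₁ q) (proj₂ q) ∎) w
  where
  θ₃ : Comp → Comp → Comp → ℚ
  θ₃ a b c = ∑[ x ∈ θ a ] ∑[ y ∈ θ b ] ∑[ z ∈ θ c ] f x y z
  left : ∀ p r → ∑[ u ∈ θ p ] ∑[ v ∈ θ r ] ∑[ q ∈ Δdesc u ] f (proj₁ q) (proj₂ q) v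
               ≡ ∑[ q ∈ dec p ] θ₃ (proj₁ q) (proj₂ q) r
  left p r = begin
    ∑[ u ∈ θ p ] ∑[ v ∈ θ r ] ∑[ q ∈ Δdesc u ] f (proj₁ q) (proj₂ q) v
      ≡⟨ ∑-cong (θ p) (λ u → ∑-swap (θ r) (Δdesc u) (λ v q → f (proj₁ q) (proj₂ q) v)) ⟩
    ∑[ u ∈ θ p ] ∑[ q ∈ Δdesc u ] ∑[ v ∈ θ r ] f (proj₁ q) (proj₂ q) v
      ≡⟨ Δdesc-θ p (λ q → ∑[ v ∈ θ r ] f (proj₁ q) (proj₂ q) v) ⟩
    ∑[ q ∈ dec p ] θ₃ (proj₁ q) (proj₂ q) r ∎
  right : ∀ p r → ∑[ u ∈ θ p ] ∑[ v ∈ θ r ] ∑[ q ∈ Δdesc v ] f u (proj₁ q) (proj₂ q)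
                ≡ ∑[ q ∈ dec r ] θ₃ p (proj₁ q) (proj₂ q)
  right p r = begin
    ∑[ u ∈ θ p ] ∑[ v ∈ θ r ] ∑[ q ∈ Δdesc v ] f u (proj₁ q) (proj₂ q)
      ≡⟨ ∑-cong (θ p) (λ u → Δdesc-θ r (λ q → f u (proj₁ q) (proj₂ q))) ⟩
    ∑[ u ∈ θ p ] ∑[ q ∈ dec r ] ∑[ y ∈ θ (proj₁ q) ] ∑[ z ∈ θ (proj₂ q) ] f u y z
      ≡⟨ ∑-swap (θ p) (dec r) (λ u q → ∑[ y ∈ θ (proj₁ q) ] ∑[ z ∈ θ (proj₂ q) ] f u y z) ⟩
    ∑[ q ∈ dec r ] θ₃ p (proj₁ q) (proj₂ q) ∎

θ-vanish : ∀ a as {f : Comp → ℚ} → (∀ n w → f (n ∷ w) ≡ 0ℚ) → ∑ (θ (a ∷ as)) f ≡ 0ℚ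
θ-vanish a as h = trans (θ-cong-∷ a as h) (∑-0 (θ (a ∷ as)))

Δdesc-counitˡ : ∀ w (f : Comp → ℚ) → ∑[ p ∈ Δdesc w ] (ε (proj₁ p) * f (proj₂ p)) ≡ f w
Δdesc-counitˡ w f = θ-surjective (λ w → ∑[ p ∈ Δdesc w ] (ε (proj₁ p) * f (proj₂ p))) f (λ a →
  trans (Δdesc-θ a g)
    -- Cuts with a nonempty left piece drop out: `θ` of that piece has only nonempty terms, on which
    -- `ε` is zero.
    (trans (∑-dec-[]ˡ a (θ₂ g) λ x u v → θ-vanish x u λ n w → trans (∑-cong (θ v) λ z → ℚP.*-zeroˡ (f z)) (∑-0 (θ v)))
      (trans (∑-basis [] (λ u → ∑[ v ∈ θ a ] g (u , v))) (∑-cong (θ a) λ v → ℚP.*-identityˡ (f v))))) w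
  where
  g : Comp × Comp → ℚ
  g p = ε (proj₁ p) * f (proj₂ p)

Δdesc-counitʳ : ∀ w (f : Comp → ℚ) → ∑[ p ∈ Δdesc w ] (ε (proj₂ p) * f (proj₁ p)) ≡ f w
Δdesc-counitʳ w f = θ-surjective (λ w → ∑[ p ∈ Δdesc w ] (ε (proj₂ p) * f (proj₁ p))) f (λ a →
  trans (Δdesc-θ a g)
    (trans (∑-dec-[]ʳ a (θ₂ g) λ u x v → trans (∑-cong (θ u) λ z → θ-vanish x v λ n w → ℚP.*-zeroˡ (f z)) (∑-0 (θ u)))
      (∑-cong (θ a) λ u → trans (∑-basis [] (λ v → g (u , v))) (ℚP.*-identityˡ (f u))))) w
  where
  g : Comp × Comp → ℚ
  g p = ε (proj₂ p) * f (proj₁ p)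

_ш₂_ : Comp × Comp → Comp × Comp → FS (Comp × Comp)
p ш₂ q = (proj₁ p ш* proj₁ q) ⊗ᵥ (proj₂ p ш* proj₂ q)

Δdesc-ш* : ∀ u v (f : Comp × Comp → ℚ) →
  ∑[ c ∈ u ш* v ] ∑ (Δdesc c) f ≡ ∑[ p ∈ Δdesc u ] ∑[ q ∈ Δdesc v ] ∑ (p ш₂ q) f
Δdesc-ш* u v f =
  θ-surjective (λ u → ∑[ c ∈ u ш* v ] ∑ (Δdesc c) f) (λ u → ∑[ p ∈ Δdesc u ] ∑[ q ∈ Δdesc v ] ∑ (p ш₂ q) f) (λ a →
  θ-surjective (λ v → ∑[ u ∈ θ a ] ∑[ c ∈ u ш* v ] ∑ (Δdesc c) f) (λ v → ∑[ u ∈ θ a ] ∑[ p ∈ Δdesc u ] ∑[ q ∈ Δdesc v ] ∑ (p ш₂ q) f)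
    (λ b → on-θ a b) v) u
  where
  -- `shuffle₂` pairs first components with first and second with second, while `θ₂` expands one
  -- tensor at a time. The exchanges of sums reconcile the two orders.
  tensor : ∀ p q → ∑ (shuffle₂ p q) (θ₂ f)
      ≡ ∑[ x ∈ θ (proj₁ p) ] ∑[ y ∈ θ (proj₂ p) ] ∑[ s ∈ θ (proj₁ q) ] ∑[ t ∈ θ (proj₂ q) ] ∑ ((x , y) ш₂ (s , t)) f
  tensor (a , b) (c , d) = begin
    ∑ (shuffle a c ⊗ᵥ shuffle b d) (θ₂ f)
      ≡⟨ ∑-⊗ (shuffle a c) (shuffle b d) (θ₂ f) ⟩
    ∑[ j ∈ shuffle a c ] ∑[ k ∈ shuffle b d ] ∑[ m ∈ θ j ] ∑[ n ∈ θ k ] f (m , n)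
      ≡⟨ ∑-cong (shuffle a c) (λ j → ∑-swap (shuffle b d) (θ j) (λ k m → ∑[ n ∈ θ k ] f (m , n))) ⟩
    ∑[ j ∈ shuffle a c ] ∑[ m ∈ θ j ] ∑[ k ∈ shuffle b d ] ∑[ n ∈ θ k ] f (m , n)
      ≡⟨ θ-shuffle a c (λ m → ∑[ k ∈ shuffle b d ] ∑[ n ∈ θ k ] f (m , n)) ⟩
    ∑[ x ∈ θ a ] ∑[ s ∈ θ c ] ∑[ m ∈ x ш* s ] ∑[ k ∈ shuffle b d ] ∑[ n ∈ θ k ] f (m , n)
      ≡⟨ ∑-cong (θ a) (λ x → ∑-cong (θ c) λ s → trans (∑-cong (x ш* s) λ m → θ-shuffle b d (λ n → f (m , n)))
           (trans (∑-swap (x ш* s) (θ b) (λ m y → ∑[ t ∈ θ d ] ∑[ n ∈ y ш* t ] f (m , n)))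
             (∑-cong (θ b) λ y → trans (∑-swap (x ш* s) (θ d) (λ m t → ∑[ n ∈ y ш* t ] f (m , n)))
               (∑-cong (θ d) λ t → sym (∑-⊗ (x ш* s) (y ш* t) f))))) ⟩
    ∑[ x ∈ θ a ] ∑[ s ∈ θ c ] ∑[ y ∈ θ b ] ∑[ t ∈ θ d ] ∑ ((x , y) ш₂ (s , t)) f
      ≡⟨ ∑-cong (θ a) (λ x → ∑-swap (θ c) (θ b) (λ s y → ∑[ t ∈ θ d ] ∑ ((x , y) ш₂ (s , t)) f)) ⟩
    ∑[ x ∈ θ a ] ∑[ y ∈ θ b ] ∑[ s ∈ θ c ] ∑[ t ∈ θ d ] ∑ ((x , y) ш₂ (s , t)) f ∎
  on-θ : ∀ a b → ∑[ v ∈ θ b ] ∑[ u ∈ θ a ] ∑[ c ∈ u ш* v ] ∑ (Δdesc c) f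
                     ≡ ∑[ v ∈ θ b ] ∑[ u ∈ θ a ] ∑[ p ∈ Δdesc u ] ∑[ q ∈ Δdesc v ] ∑ (p ш₂ q) f
  on-θ a b = begin
    ∑[ v ∈ θ b ] ∑[ u ∈ θ a ] ∑[ c ∈ u ш* v ] ∑ (Δdesc c) f
      ≡⟨ θ-shuffle′ a b (λ c → ∑ (Δdesc c) f) ⟩
    ∑[ c ∈ shuffle a b ] ∑[ u ∈ θ c ] ∑ (Δdesc u) f
      ≡⟨ ∑-cong (shuffle a b) (λ c → Δdesc-θ c f) ⟩
    ∑[ c ∈ shuffle a b ] ∑ (dec c) (θ₂ f)
      ≡⟨ dec-shuffle a b (θ₂ f) ⟩
    ∑[ p ∈ dec a ] ∑[ q ∈ dec b ] ∑ (shuffle₂ p q) (θ₂ f)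
      ≡⟨ ∑-cong (dec a) (λ p → trans (∑-cong (dec b) (tensor p))
           (trans (∑-swap (dec b) (θ (proj₁ p)) (λ q x → ∑[ y ∈ θ (proj₂ p) ] θ₂ (λ r → ∑ ((x , y) ш₂ r) f) q))
             (∑-cong (θ (proj₁ p)) λ x → ∑-swap (dec b) (θ (proj₂ p)) (λ q y → θ₂ (λ r → ∑ ((x , y) ш₂ r) f) q)))) ⟩
    ∑[ p ∈ dec a ] ∑[ x ∈ θ (proj₁ p) ] ∑[ y ∈ θ (proj₂ p) ] ∑[ q ∈ dec b ] θ₂ (λ r → ∑ ((x , y) ш₂ r) f) q
      ≡⟨ Δdesc-θ a (λ p → ∑[ q ∈ dec b ] θ₂ (λ r → ∑ (p ш₂ r) f) q) ⟨
    ∑[ u ∈ θ a ] ∑[ p ∈ Δdesc u ] ∑[ q ∈ dec b ] θ₂ (λ r → ∑ (p ш₂ r) f) q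
      ≡⟨ ∑-cong (θ a) (λ u → ∑-cong (Δdesc u) λ p → Δdesc-θ b (λ q → ∑ (p ш₂ q) f)) ⟨
    ∑[ u ∈ θ a ] ∑[ p ∈ Δdesc u ] ∑[ v ∈ θ b ] ∑[ q ∈ Δdesc v ] ∑ (p ш₂ q) f
      ≡⟨ ∑-cong (θ a) (λ u → ∑-swap (Δdesc u) (θ b) (λ p v → ∑[ q ∈ Δdesc v ] ∑ (p ш₂ q) f)) ⟩
    ∑[ u ∈ θ a ] ∑[ v ∈ θ b ] ∑[ p ∈ Δdesc u ] ∑[ q ∈ Δdesc v ] ∑ (p ш₂ q) f
      ≡⟨ ∑-swap (θ a) (θ b) (λ u v → ∑[ p ∈ Δdesc u ] ∑[ q ∈ Δdesc v ] ∑ (p ш₂ q) f) ⟩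
    ∑[ v ∈ θ b ] ∑[ u ∈ θ a ] ∑[ p ∈ Δdesc u ] ∑[ q ∈ Δdesc v ] ∑ (p ш₂ q) f ∎

ε-ш* : ∀ u v → ∑ (u ш* v) ε ≡ ε u * ε v
ε-ш* [] v = trans (∑-ш*-[]ˡ v ε) (sym (ℚP.*-identityˡ (ε v)))
ε-ш* (n ∷ u) [] = ∑-ш*-[]ʳ (n ∷ u) ε
ε-ш* (n ∷ u) (m ∷ v) = trans (∑-ш*-∷ n u m v ε) (cong₂ _+_
  -- The product of two nonempty words has no constant term: both prefixing x₁ and prefixing x₀ turn
  -- `ε` into 0.
  (cong₂ _+_ (trans (cong (ifZero n) (∑-0 (u ш* (m ∷ v)))) (ifZero-0 n)) (trans (lowered-cong n λ n → onRaised-ε ((n ∷ u) ш* (m ∷ v))) (lowered-0 n)))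
  (cong₂ _+_ (trans (cong (ifZero m) (∑-0 ((n ∷ u) ш* v))) (ifZero-0 m))
      (trans (lowered-cong m λ m → onRaised-ε ((n ∷ u) ш* (m ∷ v))) (lowered-0 m))))
  where
  onRaised-ε : ∀ z → ∑ z (onRaised ε) ≡ 0ℚ
  onRaised-ε z = trans (∑-cong z λ { [] → refl ; (_ ∷ _) → refl }) (∑-0 z)

antipode : Comp → FS Comp
antipode w = ext (λ a → sign (length a) · θ (reverse a)) (ψ w)

∑-antipode-θ : ∀ a (f : Comp → ℚ) → ∑[ w ∈ θ a ] ∑ (antipode w) f ≡ sign (length a) * ∑ (θ (reverse a)) f
∑-antipode-θ a f = trans (∑-cong (θ a) λ w → ∑-ext (λ a → sign (length a) · θ (reverse a)) (ψ w) f)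
  (trans (ψ∘θ a (λ b → ∑ (sign (length b) · θ (reverse b)) f)) (∑-· (sign (length a)) (θ (reverse a)) f))

∑-θ-ε : ∀ a c → ∑[ w ∈ θ a ] (ε w * c) ≡ ifEmpty a * c
∑-θ-ε [] c = ∑-basis [] (λ w → ε w * c)
∑-θ-ε (x ∷ a) c = trans (θ-vanish x a λ _ _ → ℚP.*-zeroˡ c) (sym (ℚP.*-zeroˡ c))

antipode-inverseˡ : ∀ w (f : Comp → ℚ) → ∑[ p ∈ Δdesc w ] ∑[ u ∈ antipode (proj₁ p) ] ∑ (u ш* proj₂ p) f ≡ ε w * f []
antipode-inverseˡ w f = θ-surjective (λ w → ∑[ p ∈ Δdesc w ] ∑[ u ∈ antipode (proj₁ p) ] ∑ (u ш* proj₂ p) f) (λ w → ε w * f []) (λ a → begin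
  ∑[ w ∈ θ a ] ∑[ p ∈ Δdesc w ] ∑[ u ∈ antipode (proj₁ p) ] ∑ (u ш* proj₂ p) f
    ≡⟨ Δdesc-θ a (λ p → ∑[ u ∈ antipode (proj₁ p) ] ∑ (u ш* proj₂ p) f) ⟩
  ∑[ p ∈ dec a ] ∑[ x ∈ θ (proj₁ p) ] ∑[ y ∈ θ (proj₂ p) ] ∑[ u ∈ antipode x ] ∑ (u ш* y) f
    ≡⟨ ∑-cong (dec a) step ⟩
  ∑[ p ∈ dec a ] (sign (length (proj₁ p)) * ∑[ c ∈ shuffle (reverse (proj₁ p)) (proj₂ p) ] ∑ (θ c) f)
    ≡⟨ antipodeˡ a (λ c → ∑ (θ c) f) ⟩
  ifEmpty a * ∑ (θ []) f
    ≡⟨ cong (ifEmpty a *_) (∑-basis [] f) ⟩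
  ifEmpty a * f []
    ≡⟨ ∑-θ-ε a (f []) ⟨
  ∑[ w ∈ θ a ] (ε w * f []) ∎) w
  where
  step : ∀ p → ∑[ x ∈ θ (proj₁ p) ] ∑[ y ∈ θ (proj₂ p) ] ∑[ u ∈ antipode x ] ∑ (u ш* y) f
             ≡ sign (length (proj₁ p)) * ∑[ c ∈ shuffle (reverse (proj₁ p)) (proj₂ p) ] ∑ (θ c) f
  step (a , b) = trans (∑-cong (θ a) λ x → ∑-swap (θ b) (antipode x) (λ y u → ∑ (u ш* y) f))
    (trans (∑-antipode-θ a (λ u → ∑[ y ∈ θ b ] ∑ (u ш* y) f)) (cong (sign (length a) *_) (sym (θ-shuffle (reverse a) b f))))

antipode-inverseʳ : ∀ w (f : Comp → ℚ) → ∑[ p ∈ Δdesc w ] ∑[ u ∈ antipode (proj₂ p) ] ∑ (proj₁ p ш* u) f ≡ ε w * f []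
antipode-inverseʳ w f = θ-surjective (λ w → ∑[ p ∈ Δdesc w ] ∑[ u ∈ antipode (proj₂ p) ] ∑ (proj₁ p ш* u) f) (λ w → ε w * f []) (λ a → begin
  ∑[ w ∈ θ a ] ∑[ p ∈ Δdesc w ] ∑[ u ∈ antipode (proj₂ p) ] ∑ (proj₁ p ш* u) f
    ≡⟨ Δdesc-θ a (λ p → ∑[ u ∈ antipode (proj₂ p) ] ∑ (proj₁ p ш* u) f) ⟩
  ∑[ p ∈ dec a ] ∑[ x ∈ θ (proj₁ p) ] ∑[ y ∈ θ (proj₂ p) ] ∑[ u ∈ antipode y ] ∑ (x ш* u) f
    ≡⟨ ∑-cong (dec a) step ⟩
  ∑[ p ∈ dec a ] (sign (length (proj₂ p)) * ∑[ c ∈ shuffle (proj₁ p) (reverse (proj₂ p)) ] ∑ (θ c) f)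
    ≡⟨ antipodeʳ a (λ c → ∑ (θ c) f) ⟩
  ifEmpty a * ∑ (θ []) f
    ≡⟨ cong (ifEmpty a *_) (∑-basis [] f) ⟩
  ifEmpty a * f []
    ≡⟨ ∑-θ-ε a (f []) ⟨
  ∑[ w ∈ θ a ] (ε w * f []) ∎) w
  where
  step : ∀ p → ∑[ x ∈ θ (proj₁ p) ] ∑[ y ∈ θ (proj₂ p) ] ∑[ u ∈ antipode y ] ∑ (x ш* u) f
             ≡ sign (length (proj₂ p)) * ∑[ c ∈ shuffle (proj₁ p) (reverse (proj₂ p)) ] ∑ (θ c) f
  step (a , b) = trans (∑-cong (θ a) λ x → ∑-antipode-θ b (λ u → ∑ (x ш* u) f))
    (trans (∑-* (θ a) (sign (length b)) (λ x → ∑[ u ∈ θ (reverse b) ] ∑ (x ш* u) f))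
           (cong (sign (length b) *_) (sym (θ-shuffle a (reverse b) f))))

-- From basis elements to linear maps

∑-ext2 : ∀ (m : A → B → FS C) x y (f : C → ℚ) → ∑ (ext2 m x y) f ≡ ∑[ a ∈ x ] ∑[ b ∈ y ] ∑ (m a b) f
∑-ext2 m x y f = trans (∑-ext (λ a → ext (m a) y) x f) (∑-cong x λ a → ∑-ext (m a) y f)

∑-⊗ₗ : ∀ {A′ B′ : Set} (g : FS A → FS A′) (h : FS B → FS B′) t (f : A′ × B′ → ℚ) →
  ∑ ((g ⊗ₗ h) t) f ≡ ∑[ p ∈ t ] ∑[ a ∈ g (basis (proj₁ p)) ] ∑[ b ∈ h (basis (proj₂ p)) ] f (a , b)
∑-⊗ₗ g h t f = trans (∑-ext (λ p → g (basis (proj₁ p)) ⊗ᵥ h (basis (proj₂ p))) t f)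
  (∑-cong t λ p → ∑-⊗ (g (basis (proj₁ p))) (h (basis (proj₂ p))) f)

∑-ext-basis : ∀ (g : A → FS B) a (f : B → ℚ) → ∑ (ext g (basis a)) f ≡ ∑ (g a) f
∑-ext-basis g a f = trans (∑-ext g (basis a) f) (∑-basis a (λ a → ∑ (g a) f))

∑-*ʳ : ∀ (u : FS A) (f : A → ℚ) c → ∑[ a ∈ u ] (f a * c) ≡ ∑ u f * c
∑-*ʳ u f c = trans (∑-cong u λ a → ℚP.*-comm (f a) c) (trans (∑-* u c f) (ℚP.*-comm c (∑ u f)))

desc-isBialgebra : IsConnectedGradedBialgebra _≟C_ _ш*_ 𝟏 Δdesc ε weight
desc-isBialgebra = record
  { assoc = λ x y z → fromFunctionals _≟C_ (ext2 _ш*_ (ext2 _ш*_ x y) z) (ext2 _ш*_ x (ext2 _ш*_ y z)) λ f → begin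
      ∑ (ext2 _ш*_ (ext2 _ш*_ x y) z) f
        ≡⟨ trans (∑-ext2 _ш*_ (ext2 _ш*_ x y) z f) (∑-ext2 _ш*_ x y (λ d → ∑[ c ∈ z ] ∑ (d ш* c) f)) ⟩
      ∑[ a ∈ x ] ∑[ b ∈ y ] ∑[ d ∈ a ш* b ] ∑[ c ∈ z ] ∑ (d ш* c) f
        ≡⟨ ∑-cong x (λ a → ∑-cong y λ b → trans (∑-swap (a ш* b) z (λ d c → ∑ (d ш* c) f)) (∑-cong z λ c → ш*-assoc a b c f)) ⟩
      ∑[ a ∈ x ] ∑[ b ∈ y ] ∑[ c ∈ z ] ∑[ d ∈ b ш* c ] ∑ (a ш* d) f
        ≡⟨ trans (∑-ext2 _ш*_ x (ext2 _ш*_ y z) f) (∑-cong x λ a → ∑-ext2 _ш*_ y z (λ d → ∑ (a ш* d) f)) ⟨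
      ∑ (ext2 _ш*_ x (ext2 _ш*_ y z)) f ∎
  ; unitˡ = λ x → fromFunctionals _≟C_ (ext2 _ш*_ (basis []) x) x λ f → trans (∑-ext2 _ш*_ (basis []) x f)
      (trans (∑-basis [] (λ a → ∑[ b ∈ x ] ∑ (a ш* b) f)) (∑-cong x λ b → ∑-ш*-[]ˡ b f))
  ; unitʳ = λ x → fromFunctionals _≟C_ (ext2 _ш*_ x (basis [])) x λ f → trans (∑-ext2 _ш*_ x (basis []) f)
      (∑-cong x λ a → trans (∑-basis [] (λ b → ∑ (a ш* b) f)) (∑-ш*-[]ʳ a f))
  ; coassoc = λ x → fromFunctionals (eq3 _≟C_) (reassoc ((ext Δdesc ⊗ₗ idV) (ext Δdesc x))) ((idV ⊗ₗ ext Δdesc) (ext Δdesc x)) λ f → begin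
      ∑ (reassoc ((ext Δdesc ⊗ₗ idV) (ext Δdesc x))) f
        ≡⟨ ∑-map (λ p → proj₁ (proj₁ p) , (proj₂ (proj₁ p) , proj₂ p)) ((ext Δdesc ⊗ₗ idV) (ext Δdesc x)) f ⟩
      ∑[ p ∈ (ext Δdesc ⊗ₗ idV) (ext Δdesc x) ] f (proj₁ (proj₁ p) , (proj₂ (proj₁ p) , proj₂ p))
        ≡⟨ trans (∑-⊗ₗ (ext Δdesc) idV (ext Δdesc x) (λ p → f (proj₁ (proj₁ p) , (proj₂ (proj₁ p) , proj₂ p))))
             (trans (∑-ext Δdesc x (λ p → ∑[ q ∈ ext Δdesc (basis (proj₁ p)) ] ∑[ c ∈ basis (proj₂ p) ] f (proj₁ q , (proj₂ q , c))))
           (∑-cong x λ a → ∑-cong (Δdesc a) λ p → trans (∑-ext-basis Δdesc (proj₁ p) (λ q → ∑[ c ∈ basis (proj₂ p) ] f (proj₁ q , (proj₂ q , c))))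
               (∑-cong (Δdesc (proj₁ p)) λ q → ∑-basis (proj₂ p) (λ c → f (proj₁ q , (proj₂ q , c)))))) ⟩
      ∑[ a ∈ x ] ∑[ p ∈ Δdesc a ] ∑[ q ∈ Δdesc (proj₁ p) ] f (proj₁ q , (proj₂ q , proj₂ p))
        ≡⟨ ∑-cong x (λ a → Δdesc-coassoc a (λ u v w → f (u , (v , w)))) ⟩
      ∑[ a ∈ x ] ∑[ p ∈ Δdesc a ] ∑[ q ∈ Δdesc (proj₂ p) ] f (proj₁ p , q)
        ≡⟨ trans (∑-⊗ₗ idV (ext Δdesc) (ext Δdesc x) f)
             (trans (∑-ext Δdesc x (λ p → ∑[ c ∈ basis (proj₁ p) ] ∑[ q ∈ ext Δdesc (basis (proj₂ p)) ] f (c , q)))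
           (∑-cong x λ a → ∑-cong (Δdesc a) λ p → trans (∑-basis (proj₁ p) (λ c → ∑[ q ∈ ext Δdesc (basis (proj₂ p)) ] f (c , q)))
               (∑-ext-basis Δdesc (proj₂ p) (λ q → f (proj₁ p , q))))) ⟨
      ∑ ((idV ⊗ₗ ext Δdesc) (ext Δdesc x)) f ∎
  ; counitˡ = λ x → fromFunctionals _≟C_ (ext (λ p → ε (proj₁ p) · basis (proj₂ p)) (ext Δdesc x)) x
      λ f → trans (∑-ext (λ p → ε (proj₁ p) · basis (proj₂ p)) (ext Δdesc x) f)
      (trans (∑-ext Δdesc x (λ p → ∑ (ε (proj₁ p) · basis (proj₂ p)) f))
        (∑-cong x λ a → trans (∑-cong (Δdesc a) λ p → trans (∑-· (ε (proj₁ p)) (basis (proj₂ p)) f) (cong (ε (proj₁ p) *_) (∑-basis (proj₂ p) f)))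
                              (Δdesc-counitˡ a f)))
  ; counitʳ = λ x → fromFunctionals _≟C_ (ext (λ p → ε (proj₂ p) · basis (proj₁ p)) (ext Δdesc x)) x
      λ f → trans (∑-ext (λ p → ε (proj₂ p) · basis (proj₁ p)) (ext Δdesc x) f)
      (trans (∑-ext Δdesc x (λ p → ∑ (ε (proj₂ p) · basis (proj₁ p)) f))
        (∑-cong x λ a → trans (∑-cong (Δdesc a) λ p → trans (∑-· (ε (proj₂ p)) (basis (proj₁ p)) f) (cong (ε (proj₂ p) *_) (∑-basis (proj₁ p) f)))
                              (Δdesc-counitʳ a f)))
  ; Δ-mul = λ x y → fromFunctionals (eq2 _≟C_) (ext Δdesc (ext2 _ш*_ x y)) (ext2 _ш₂_ (ext Δdesc x) (ext Δdesc y)) λ f → begin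
      ∑ (ext Δdesc (ext2 _ш*_ x y)) f
        ≡⟨ trans (∑-ext Δdesc (ext2 _ш*_ x y) f) (∑-ext2 _ш*_ x y (λ c → ∑ (Δdesc c) f)) ⟩
      ∑[ a ∈ x ] ∑[ b ∈ y ] ∑[ c ∈ a ш* b ] ∑ (Δdesc c) f
        ≡⟨ ∑-cong x (λ a → trans (∑-cong y λ b → Δdesc-ш* a b f) (∑-swap y (Δdesc a) (λ b p → ∑[ q ∈ Δdesc b ] ∑ (p ш₂ q) f))) ⟩
      ∑[ a ∈ x ] ∑[ p ∈ Δdesc a ] ∑[ b ∈ y ] ∑[ q ∈ Δdesc b ] ∑ (p ш₂ q) f
        ≡⟨ trans (∑-ext2 _ш₂_ (ext Δdesc x) (ext Δdesc y) f) (trans (∑-ext Δdesc x (λ p → ∑[ q ∈ ext Δdesc y ] ∑ (p ш₂ q) f))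
             (∑-cong x λ a → ∑-cong (Δdesc a) λ p → ∑-ext Δdesc y (λ q → ∑ (p ш₂ q) f))) ⟨
      ∑ (ext2 _ш₂_ (ext Δdesc x) (ext Δdesc y)) f ∎
  ; Δ-one = fromFunctionals (eq2 _≟C_) (ext Δdesc (basis [])) (basis [] ⊗ᵥ basis []) λ f → trans (∑-ext-basis Δdesc [] f)
      (sym (trans (∑-⊗ (basis []) (basis []) f) (∑-basis [] (λ u → ∑[ v ∈ basis [] ] f (u , v)))))
  ; ε-mul = λ x y → trans (∑-ext2 _ш*_ x y ε)
      (trans (∑-cong x λ a → trans (∑-cong y λ b → ε-ш* a b) (∑-* y (ε a) ε)) (∑-*ʳ x ε (∑ y ε)))
  ; ε-one = refl
  ; gr-mul = λ a b c → coeff-supported _≟C_ (ш*-weight a b) c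
  ; gr-one = refl
  ; gr-Δ = λ a b c → coeff-supported (eq2 _≟C_) (Δdesc-weight a) (b , c)
  ; gr-ε = λ { [] _ → refl ; (_ ∷ _) nz → contradiction refl nz }
  -- Every entry adds at least 1 to the weight, so only the empty composition has weight 0.
  ; connected = λ { [] _ → refl }
  }

desc-hasAntipode : HasAntipode _≟C_ _ш*_ 𝟏 Δdesc ε
desc-hasAntipode = antipode ,
  (λ x → fromFunctionals _≟C_ (ext μ ((ext antipode ⊗ₗ idV) (ext Δdesc x))) (∑ x ε · basis []) λ f → begin
    ∑ (ext μ ((ext antipode ⊗ₗ idV) (ext Δdesc x))) f
      ≡⟨ trans (∑-ext μ ((ext antipode ⊗ₗ idV) (ext Δdesc x)) f) (trans (∑-⊗ₗ (ext antipode) idV (ext Δdesc x) (λ p → ∑ (μ p) f))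
           (∑-ext Δdesc x (λ p → ∑[ u ∈ ext antipode (basis (proj₁ p)) ] ∑[ v ∈ basis (proj₂ p) ] ∑ (u ш* v) f))) ⟩
    ∑[ a ∈ x ] ∑[ p ∈ Δdesc a ] ∑[ u ∈ ext antipode (basis (proj₁ p)) ] ∑[ v ∈ basis (proj₂ p) ] ∑ (u ш* v) f
      ≡⟨ ∑-cong x (λ a → trans (∑-cong (Δdesc a) λ p → trans (∑-ext-basis antipode (proj₁ p) (λ u → ∑[ v ∈ basis (proj₂ p) ] ∑ (u ш* v) f))
            (∑-cong (antipode (proj₁ p)) λ u → ∑-basis (proj₂ p) (λ v → ∑ (u ш* v) f))) (antipode-inverseˡ a f)) ⟩
    ∑[ a ∈ x ] (ε a * f [])
      ≡⟨ ∑-ηε x f ⟨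
    ∑ (∑ x ε · basis []) f ∎) ,
  (λ x → fromFunctionals _≟C_ (ext μ ((idV ⊗ₗ ext antipode) (ext Δdesc x))) (∑ x ε · basis []) λ f → begin
    ∑ (ext μ ((idV ⊗ₗ ext antipode) (ext Δdesc x))) f
      ≡⟨ trans (∑-ext μ ((idV ⊗ₗ ext antipode) (ext Δdesc x)) f) (trans (∑-⊗ₗ idV (ext antipode) (ext Δdesc x) (λ p → ∑ (μ p) f))
           (∑-ext Δdesc x (λ p → ∑[ u ∈ basis (proj₁ p) ] ∑[ v ∈ ext antipode (basis (proj₂ p)) ] ∑ (u ш* v) f))) ⟩
    ∑[ a ∈ x ] ∑[ p ∈ Δdesc a ] ∑[ u ∈ basis (proj₁ p) ] ∑[ v ∈ ext antipode (basis (proj₂ p)) ] ∑ (u ш* v) f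
      ≡⟨ ∑-cong x (λ a → trans (∑-cong (Δdesc a) λ p → trans (∑-basis (proj₁ p) (λ u → ∑[ v ∈ ext antipode (basis (proj₂ p)) ] ∑ (u ш* v) f))
            (∑-ext-basis antipode (proj₂ p) (λ v → ∑ (proj₁ p ш* v) f))) (antipode-inverseʳ a f)) ⟩
    ∑[ a ∈ x ] (ε a * f [])
      ≡⟨ ∑-ηε x f ⟨
    ∑ (∑ x ε · basis []) f ∎)
  where
  μ : Comp × Comp → FS Comp
  μ p = proj₁ p ш* proj₂ p
  ∑-ηε : ∀ x (f : Comp → ℚ) → ∑ (∑ x ε · basis []) f ≡ ∑[ a ∈ x ] (ε a * f [])
  ∑-ηε x f = trans (∑-· (∑ x ε) (basis []) f) (trans (cong (∑ x ε *_) (∑-basis [] f)) (sym (∑-*ʳ x ε (f []))))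

theorem4p8 : IsConnectedGradedBialgebra _≟C_ _ш*_ 𝟏 Δdesc ε weight
    × HasAntipode _≟C_ _ш*_ 𝟏 Δdesc ε
theorem4p8 = desc-isBialgebra , desc-hasAntipode
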